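{- Let $n\ge 2$. For $B\ge1$ let $M_B$ be the set of $n\times n$ integer matrices all of whose entries are bounded in absolute value by $B$, and let $N(n,B)$ be the number of matrices in $M_B$ whose characteristic polynomial is reducible over $\mathbb{Z}$. Then $N(n,B)/|M_B|\to 0$ as $B\to\infty$. -}

module Defs where

open import Level using (0ℓ)
open import Algebra.Bundles.Raw using (RawRing)
open import Data.Nat.Base as ℕ using (ℕ; zero; suc; z≤n; s≤s; s≤s⁻¹; NonZero)
import Data.Nat.Properties as ℕ
open import Data.Integer.Base as ℤ using (ℤ; +_; -[1+_]; ∣_∣; 0ℤ; 1ℤ)
import Data.Integer.Properties as ℤ
open import Data.Integer.Tactic.RingSolver using (solve-∀)
open import Data.Rational.Base as ℚ using (ℚ; 0ℚ)
open import Data.Bool.Base using (if_then_else_)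
open import Data.Fin.Base using (Fin; zero; suc; toℕ; punchIn)
import Data.Fin.Properties as Fin
open import Data.List.Base as List
  using (List; []; _∷_; length; take; upTo; filter; cartesianProductWith)
import Data.List.Properties as List
open import Data.List.Relation.Unary.Any as Any using (Any; here)
import Data.List.Relation.Unary.Any.Properties as Any
open import Data.List.Relation.Unary.All using () renaming ([] to []ᴬ)
import Data.List.Relation.Unary.AllPairs as AllPairs
open import Data.List.Relation.Unary.Unique.Propositional using (Unique)
import Data.List.Relation.Unary.Unique.Propositional.Properties as Unique
open import Data.List.Membership.Propositional using (_∈_; find)
open import Data.List.Membership.Propositional.Properties
  using (∈-map⁺; ∈-map⁻; ∈-upTo⁺; ∈-upTo⁻; ∈-cartesianProductWith⁺; ∈-cartesianProductWith⁻)
open import Data.Vec.Base as Vec using (Vec; []; _∷_; lookup)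
import Data.Vec.Properties as Vec
open import Data.Product.Base using (∃; ∃₂; _×_; _,_; proj₁; proj₂; uncurry)
open import Data.Sum.Base using (_⊎_; inj₁; inj₂)
open import Data.Empty using (⊥-elim)
open import Function.Base using (_∘_)
open import Relation.Nullary using (¬_; Dec; yes; no)
open import Relation.Nullary.Decidable using (map′; ¬?; ⌊_⌋; _×-dec_)
open import Relation.Unary using (Decidable)
open import Relation.Binary.PropositionalEquality

------------------------------------------------------------------------
-- Determinants over an arbitrary (raw) ring

module Determinant {c ℓ} (R : RawRing c ℓ) where
  open RawRing R
  open import Algebra.Definitions.RawSemiring rawSemiring using (sum; _^_)

  -- Laplace expansion along the first row.
  det : ∀ {n} → (Fin n → Fin n → Carrier) → Carrier
  det {zero}  A = 1#
  det {suc n} A = sum λ j →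
    ((- 1#) ^ toℕ j) * (A zero j * det (λ i k → A (suc i) (punchIn j k)))

------------------------------------------------------------------------
-- The polynomial ring ℤ[X]

-- Coefficient lists, constant term first.  Trailing zeros are allowed,
-- so equality of polynomials is _≈_ below, not propositional equality.
Poly : Set
Poly = List ℤ

coeff : Poly → ℕ → ℤ
coeff []      _       = 0ℤ
coeff (a ∷ p) zero    = a
coeff (a ∷ p) (suc i) = coeff p i

infix  4 _≈_
infixl 6 _+ₚ_
infixl 7 _·ₚ_ _*ₚ_

_≈_ : Poly → Poly → Set
p ≈ q = ∀ i → coeff p i ≡ coeff q i

_+ₚ_ : Poly → Poly → Poly
[]      +ₚ q       = q
(a ∷ p) +ₚ []      = a ∷ p
(a ∷ p) +ₚ (b ∷ q) = a ℤ.+ b ∷ (p +ₚ q)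

_·ₚ_ : ℤ → Poly → Poly
a ·ₚ p = List.map (a ℤ.*_) p

_*ₚ_ : Poly → Poly → Poly
[]      *ₚ q = []
(a ∷ p) *ₚ q = (a ·ₚ q) +ₚ (0ℤ ∷ p *ₚ q)

const : ℤ → Poly
const a = a ∷ []

X : Poly
X = 0ℤ ∷ 1ℤ ∷ []

ℤ[X] : RawRing 0ℓ 0ℓ
ℤ[X] = record
  { Carrier = Poly
  ; _≈_     = _≈_
  ; _+_     = _+ₚ_
  ; _*_     = _*ₚ_
  ; -_      = List.map (λ a → ℤ.- a)
  ; 0#      = []
  ; 1#      = const 1ℤ
  }

module ℤ[X] = RawRing ℤ[X]

open import Algebra.Definitions.RawSemiring ℤ[X].rawSemiring using (_∣_; _∤_)
open import Algebra.Definitions.RawMagma ℤ[X].*-rawMagma using ()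
  renaming (_,_ to _by_)

-- A nonzero polynomial that is a product of two non-units of ℤ[X].
Reducible : Poly → Set
Reducible f = f ℤ[X].≉ ℤ[X].0# ×
  ∃₂ λ g h → f ≈ g ℤ[X].* h × g ∤ ℤ[X].1# × h ∤ ℤ[X].1#

------------------------------------------------------------------------
-- Integer matrices and their characteristic polynomials

Matrix : ℕ → Set
Matrix n = Vec (Vec ℤ n) n

entry : ∀ {n} → Matrix n → Fin n → Fin n → ℤ
entry A i j = lookup (lookup A i) j

-- det (X I - A)
charPoly : ∀ {n} → Matrix n → Poly
charPoly A = det λ i j →
  (if ⌊ i Fin.≟ j ⌋ then X else ℤ[X].0#) ℤ[X].+ (ℤ[X].- const (entry A i j))
  where open Determinant ℤ[X]

------------------------------------------------------------------------
-- Reducibility in ℤ[X] is decidable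
--
-- A divisor g of f ≠ 0 has degree at most d = deg f, and g(a) divides
-- f(a) for all a.  At d + 1 consecutive points where f does not vanish
-- the values of g are therefore bounded, which leaves finitely many g.

module _ where
  open import Data.Integer.Base using (_+_; _*_; _-_; -_)

  coeff-+ : ∀ p q i → coeff (p +ₚ q) i ≡ coeff p i + coeff q i
  coeff-+ []      q       i       = sym (ℤ.+-identityˡ _)
  coeff-+ (a ∷ p) []      i       = sym (ℤ.+-identityʳ _)
  coeff-+ (a ∷ p) (b ∷ q) zero    = refl
  coeff-+ (a ∷ p) (b ∷ q) (suc i) = coeff-+ p q i

  coeff-· : ∀ a p i → coeff (a ·ₚ p) i ≡ a * coeff p i
  coeff-· a []      i       = sym (ℤ.*-zeroʳ a)
  coeff-· a (b ∷ p) zero    = refl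
  coeff-· a (b ∷ p) (suc i) = coeff-· a p i

  coeff-* : ∀ a p q i →
            coeff ((a ∷ p) *ₚ q) i ≡ a * coeff q i + coeff (0ℤ ∷ p *ₚ q) i
  coeff-* a p q i = trans (coeff-+ (a ·ₚ q) (0ℤ ∷ p *ₚ q) i)
    (cong (_+ coeff (0ℤ ∷ p *ₚ q) i) (coeff-· a q i))

  ∷-cong : ∀ {a b p q} → a ≡ b → p ≈ q → (a ∷ p) ≈ (b ∷ q)
  ∷-cong a≡b p≈q zero    = a≡b
  ∷-cong a≡b p≈q (suc i) = p≈q i

  0∷[]≈[] : ∀ {p} → p ≈ [] → (0ℤ ∷ p) ≈ []
  0∷[]≈[] p≈0 zero    = refl
  0∷[]≈[] p≈0 (suc i) = p≈0 i

  _≈?_ : ∀ p q → Dec (p ≈ q)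
  []      ≈? []      = yes λ _ → refl
  []      ≈? (b ∷ q) = map′
    (λ { (b≡0 , q≈0) zero → sym b≡0 ; (b≡0 , q≈0) (suc i) → q≈0 i })
    (λ 0≈q → sym (0≈q 0) , λ i → 0≈q (suc i))
    ((b ℤ.≟ 0ℤ) ×-dec ([] ≈? q))
  (a ∷ p) ≈? []      = map′
    (λ { (a≡0 , p≈0) zero → a≡0 ; (a≡0 , p≈0) (suc i) → p≈0 i })
    (λ p≈0 → p≈0 0 , λ i → p≈0 (suc i))
    ((a ℤ.≟ 0ℤ) ×-dec (p ≈? []))
  (a ∷ p) ≈? (b ∷ q) = map′ (uncurry ∷-cong)
    (λ p≈q → p≈q 0 , λ i → p≈q (suc i))
    ((a ℤ.≟ b) ×-dec (p ≈? q))

  *-congʳ : ∀ p {q q′} → q ≈ q′ → (p *ₚ q) ≈ (p *ₚ q′)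
  *-congʳ []      q≈q′ i = refl
  *-congʳ (a ∷ p) {q} {q′} q≈q′ i =
    trans (coeff-* a p q i) (trans
      (cong₂ _+_ (cong (a *_) (q≈q′ i)) (∷-cong refl (*-congʳ p q≈q′) i))
      (sym (coeff-* a p q′ i)))

  *-zeroˡ : ∀ p q → p ≈ [] → (p *ₚ q) ≈ []
  *-zeroˡ []      q p≈0 i = refl
  *-zeroˡ (a ∷ p) q p≈0 i = trans (coeff-* a p q i)
    (cong₂ _+_ (cong (_* coeff q i) (p≈0 0))
               (0∷[]≈[] (*-zeroˡ p q (p≈0 ∘ suc)) i))

  *-zeroʳ : ∀ p q → q ≈ [] → (p *ₚ q) ≈ []
  *-zeroʳ []      q q≈0 i = refl
  *-zeroʳ (a ∷ p) q q≈0 i = trans (coeff-* a p q i)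
    (cong₂ _+_ (trans (cong (a *_) (q≈0 i)) (ℤ.*-zeroʳ a))
               (0∷[]≈[] (*-zeroʳ p q q≈0) i))

  *-congˡ : ∀ {p p′} q → p ≈ p′ → (p *ₚ q) ≈ (p′ *ₚ q)
  *-congˡ {[]}    {p′}     q p≈p′ i = sym (*-zeroˡ p′ q (sym ∘ p≈p′) i)
  *-congˡ {a ∷ p} {[]}     q p≈p′ i = *-zeroˡ (a ∷ p) q p≈p′ i
  *-congˡ {a ∷ p} {b ∷ p′} q p≈p′ i =
    trans (coeff-* a p q i) (trans
      (cong₂ _+_ (cong (_* coeff q i) (p≈p′ 0))
                 (∷-cong refl (*-congˡ {p} {p′} q (p≈p′ ∘ suc)) i))
      (sym (coeff-* b p′ q i)))

  *-cong : ∀ {p p′ q q′} → p ≈ p′ → q ≈ q′ → (p *ₚ q) ≈ (p′ *ₚ q′)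
  *-cong {p} {p′} {q} p≈p′ q≈q′ i =
    trans (*-congˡ {p} {p′} q p≈p′ i) (*-congʳ p′ q≈q′ i)

  HasDegree : ℕ → Poly → Set
  HasDegree d p = coeff p d ≢ 0ℤ × (∀ i → d ℕ.< i → coeff p i ≡ 0ℤ)

  degree : ∀ p → p ≈ [] ⊎ ∃ λ d → HasDegree d p
  degree []      = inj₁ λ _ → refl
  degree (a ∷ p) with degree p
  ... | inj₂ (d , lead , above) =
    inj₂ (suc d , lead , λ { (suc i) (s≤s d<i) → above i d<i })
  ... | inj₁ p≈0 with a ℤ.≟ 0ℤ
  ...   | yes refl = inj₁ (0∷[]≈[] p≈0)
  ...   | no a≢0   = inj₂ (0 , a≢0 , λ { (suc i) _ → p≈0 i })

  coeff-*-top : ∀ d e p q → (∀ i → d ℕ.< i → coeff p i ≡ 0ℤ) →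
                (∀ i → e ℕ.< i → coeff q i ≡ 0ℤ) →
                coeff (p *ₚ q) (d ℕ.+ e) ≡ coeff p d * coeff q e
  coeff-*-top d       e []      q pz qz = refl
  coeff-*-top zero    e (a ∷ p) q pz qz = trans (coeff-* a p q e)
    (trans (cong (λ u → a * coeff q e + u)
              (0∷[]≈[] (*-zeroˡ p q (λ i → pz (suc i) (s≤s z≤n))) e))
           (ℤ.+-identityʳ _))
  coeff-*-top (suc d) e (a ∷ p) q pz qz = trans (coeff-* a p q (suc d ℕ.+ e))
    (trans (cong₂ _+_
              (trans (cong (a *_) (qz (suc d ℕ.+ e) (s≤s (ℕ.m≤n+m e d)))) (ℤ.*-zeroʳ a))
              (coeff-*-top d e p q (λ i d<i → pz (suc i) (s≤s d<i)) qz))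
           (ℤ.+-identityˡ _))

  factor-degrees : ∀ {d d′ e f g h} → HasDegree d f → HasDegree d′ g →
                   HasDegree e h → f ≈ g *ₚ h → d′ ℕ.+ e ℕ.≤ d
  factor-degrees {d} {d′} {e} {f} {g} {h} (_ , fz) (g≢0 , gz) (h≢0 , hz) f≈gh
    with (d′ ℕ.+ e) ℕ.≤? d
  ... | yes le = le
  ... | no ≰d  with ℤ.i*j≡0⇒i≡0∨j≡0 (coeff g d′)
                     (trans (sym (coeff-*-top d′ e g h gz hz))
                       (trans (sym (f≈gh (d′ ℕ.+ e))) (fz _ (ℕ.≰⇒> ≰d))))
  ...   | inj₁ g≡0 = ⊥-elim (g≢0 g≡0)
  ...   | inj₂ h≡0 = ⊥-elim (h≢0 h≡0)

  truncate : ∀ d p → (∀ i → d ℕ.≤ i → coeff p i ≡ 0ℤ) → p ≈ take d p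
  truncate zero    p       pz i       = pz i z≤n
  truncate (suc d) []      pz i       = refl
  truncate (suc d) (a ∷ p) pz zero    = refl
  truncate (suc d) (a ∷ p) pz (suc i) =
    truncate d p (λ j d≤j → pz (suc j) (s≤s d≤j)) i

  eval : Poly → ℤ → ℤ
  eval []      x = 0ℤ
  eval (a ∷ p) x = a + x * eval p x

  eval-0 : ∀ p x → p ≈ [] → eval p x ≡ 0ℤ
  eval-0 []      x p≈0 = refl
  eval-0 (a ∷ p) x p≈0 = cong₂ _+_ (p≈0 0)
    (trans (cong (x *_) (eval-0 p x (p≈0 ∘ suc))) (ℤ.*-zeroʳ x))

  eval-cong : ∀ {p q} x → p ≈ q → eval p x ≡ eval q x
  eval-cong {[]}    {q}     x p≈q = sym (eval-0 q x (sym ∘ p≈q))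
  eval-cong {a ∷ p} {[]}    x p≈q = eval-0 (a ∷ p) x p≈q
  eval-cong {a ∷ p} {b ∷ q} x p≈q =
    cong₂ (λ u v → u + x * v) (p≈q 0) (eval-cong {p} {q} x (p≈q ∘ suc))

  eval-+ : ∀ p q x → eval (p +ₚ q) x ≡ eval p x + eval q x
  eval-+ []      q       x = sym (ℤ.+-identityˡ _)
  eval-+ (a ∷ p) []      x = sym (ℤ.+-identityʳ _)
  eval-+ (a ∷ p) (b ∷ q) x =
    trans (cong (λ u → a + b + x * u) (eval-+ p q x)) (lemma a b x _ _)
    where
    lemma : ∀ a b x u v → a + b + x * (u + v) ≡ (a + x * u) + (b + x * v)
    lemma = solve-∀

  eval-· : ∀ a p x → eval (a ·ₚ p) x ≡ a * eval p x
  eval-· a []      x = sym (ℤ.*-zeroʳ a)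
  eval-· a (b ∷ p) x =
    trans (cong (λ u → a * b + x * u) (eval-· a p x)) (lemma a b x _)
    where
    lemma : ∀ a b x u → a * b + x * (a * u) ≡ a * (b + x * u)
    lemma = solve-∀

  eval-* : ∀ p q x → eval (p *ₚ q) x ≡ eval p x * eval q x
  eval-* []      q x = refl
  eval-* (a ∷ p) q x = trans (eval-+ (a ·ₚ q) (0ℤ ∷ p *ₚ q) x)
    (trans (cong₂ (λ u v → u + (0ℤ + x * v)) (eval-· a q x) (eval-* p q x))
           (lemma a x _ _))
    where
    lemma : ∀ a x u v → a * v + (0ℤ + x * (u * v)) ≡ (a + x * u) * v
    lemma = solve-∀

  -- Synthetic division: a ∷ p equals its value at m plus (X - m) times quo m p.
  quo : ℤ → Poly → Poly
  quo m []      = []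
  quo m (a ∷ p) = eval (a ∷ p) m ∷ quo m p

  length-quo : ∀ m p → length (quo m p) ≡ length p
  length-quo m []      = refl
  length-quo m (a ∷ p) = cong suc (length-quo m p)

  coeff-quo-0 : ∀ m p → coeff (quo m p) 0 ≡ eval p m
  coeff-quo-0 m []      = refl
  coeff-quo-0 m (a ∷ p) = refl

  coeff-quo : ∀ m p i →
              coeff (quo m p) i ≡ coeff p i + m * coeff (quo m p) (suc i)
  coeff-quo m []      i       = sym (trans (ℤ.+-identityˡ _) (ℤ.*-zeroʳ m))
  coeff-quo m (a ∷ p) zero    = cong (λ u → a + m * u) (sym (coeff-quo-0 m p))
  coeff-quo m (a ∷ p) (suc i) = coeff-quo m p i

  newton : ℤ → ℤ → Poly → Poly
  newton m c q = const c +ₚ ((- m) ·ₚ q +ₚ (0ℤ ∷ q))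

  coeff-newton : ∀ m c q i →
    coeff (newton m c q) i ≡ coeff (const c) i + (- m * coeff q i + coeff (0ℤ ∷ q) i)
  coeff-newton m c q i = trans (coeff-+ (const c) ((- m) ·ₚ q +ₚ (0ℤ ∷ q)) i)
    (cong (λ u → coeff (const c) i + u)
      (trans (coeff-+ ((- m) ·ₚ q) (0ℤ ∷ q) i)
             (cong (_+ coeff (0ℤ ∷ q) i) (coeff-· (- m) q i))))

  newton-cong : ∀ m c {q q′} → q ≈ q′ → newton m c q ≈ newton m c q′
  newton-cong m c {q} {q′} q≈q′ i = trans (coeff-newton m c q i)
    (trans (cong (λ u → coeff (const c) i + u)
              (cong₂ _+_ (cong (- m *_) (q≈q′ i)) (∷-cong refl q≈q′ i)))
           (sym (coeff-newton m c q′ i)))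

  newton-quo : ∀ m a p → (a ∷ p) ≈ newton m (eval (a ∷ p) m) (quo m p)
  newton-quo m a p zero = sym (trans (coeff-newton m _ (quo m p) 0)
    (trans (cong (λ u → eval (a ∷ p) m + (- m * u + 0ℤ)) (coeff-quo-0 m p))
           (lemma a m _)))
    where
    lemma : ∀ a m u → a + m * u + (- m * u + 0ℤ) ≡ a
    lemma = solve-∀
  newton-quo m a p (suc i) = sym (trans (coeff-newton m _ (quo m p) (suc i))
    (trans (cong (λ u → 0ℤ + (- m * coeff (quo m p) (suc i) + u)) (coeff-quo m p i))
           (lemma m _ _)))
    where
    lemma : ∀ m u v → 0ℤ + (- m * u + (v + m * u)) ≡ v
    lemma = solve-∀

  eval-quo : ∀ m a p x →
    eval (a ∷ p) x ≡ eval (a ∷ p) m + (x - m) * eval (quo m p) x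
  eval-quo m a []      x = lemma a m x
    where
    lemma : ∀ a m x → a + x * 0ℤ ≡ a + m * 0ℤ + (x - m) * 0ℤ
    lemma = solve-∀
  eval-quo m a (b ∷ p) x =
    trans (cong (λ u → a + x * u) (eval-quo m b p x)) (lemma a m x _ _)
    where
    lemma : ∀ a m x u v →
      a + x * (u + (x - m) * v) ≡ a + m * u + (x - m) * (u + x * v)
    lemma = solve-∀

-- The integers of absolute value at most B, each listed once.
interval : ℕ → List ℤ
interval B = List.map (λ k → + k ℤ.- + B) (upTo (suc (B ℕ.+ B)))

∈-interval⁺ : ∀ B a → ∣ a ∣ ℕ.≤ B → a ∈ interval B
∈-interval⁺ B (+ k) k≤B =
  subst (_∈ interval B) (lemma (+ k) (+ B))
    (∈-map⁺ (λ k → + k ℤ.- + B) (∈-upTo⁺ {i = k ℕ.+ B} (s≤s (ℕ.+-monoˡ-≤ B k≤B))))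
  where
  lemma : ∀ x y → (x ℤ.+ y) ℤ.- y ≡ x
  lemma = solve-∀
∈-interval⁺ B (-[1+ k ]) k<B =
  subst (_∈ interval B) eq
    (∈-map⁺ (λ k → + k ℤ.- + B)
      (∈-upTo⁺ (s≤s (ℕ.≤-trans (ℕ.m∸n≤m B (suc k)) (ℕ.m≤m+n B B)))))
  where
  lemma : ∀ x y → (x ℤ.- y) ℤ.- x ≡ ℤ.- y
  lemma = solve-∀
  eq : + (B ℕ.∸ suc k) ℤ.- + B ≡ -[1+ k ]
  eq = trans (cong (ℤ._- + B)
                (trans (sym (ℤ.⊖-≥ k<B)) (sym (ℤ.m-n≡m⊖n B (suc k)))))
             (lemma (+ B) (+ suc k))

∈-interval⁻ : ∀ B a → a ∈ interval B → ∣ a ∣ ℕ.≤ B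
∈-interval⁻ B a a∈ with ∈-map⁻ (λ k → + k ℤ.- + B) a∈
... | k , k∈ , refl rewrite ℤ.m-n≡m⊖n k B with ℕ.≤-total B k
...   | inj₁ B≤k rewrite ℤ.⊖-≥ B≤k =
        ℕ.≤-trans (ℕ.∸-monoˡ-≤ B (s≤s⁻¹ (∈-upTo⁻ k∈))) (ℕ.≤-reflexive (ℕ.m+n∸n≡m B B))
...   | inj₂ k≤B rewrite ℤ.⊖-≤ k≤B | ℤ.∣-i∣≡∣i∣ (+ (B ℕ.∸ k)) = ℕ.m∸n≤m B k

interval-unique : ∀ B → Unique (interval B)
interval-unique B = Unique.map⁺
  (λ {k} {l} eq → ℤ.+-injective
    (trans (sym (lemma (+ k) (+ B))) (trans (cong (ℤ._+ + B) eq) (lemma (+ l) (+ B)))))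
  (Unique.upTo⁺ (suc (B ℕ.+ B)))
  where
  lemma : ∀ x y → (x ℤ.- y) ℤ.+ y ≡ x
  lemma = solve-∀

-- All polynomials with at most d coefficients, up to _≈_, whose values
-- at m, …, m + d - 1 are bounded by C (and possibly some others).
bounded : ℕ → ℕ → ℕ → List Poly
bounded zero    m C = [] ∷ []
bounded (suc d) m C =
  cartesianProductWith (newton (+ m)) (interval C) (bounded d (suc m) (C ℕ.+ C))

bounded-complete : ∀ d m C g → length g ℕ.≤ d →
  (∀ i → i ℕ.< d → ∣ eval g (+ (m ℕ.+ i)) ∣ ℕ.≤ C) → Any (g ≈_) (bounded d m C)
bounded-complete zero    m C []      len val = here λ _ → refl
bounded-complete (suc d) m C []      len val =
  Any.cartesianProductWith⁺ (newton (+ m)) (λ {c} {q} → pres {c} {q})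
    (∈-interval⁺ C 0ℤ z≤n)
    (bounded-complete d (suc m) (C ℕ.+ C) [] z≤n λ _ _ → z≤n)
  where
  newton-0 : [] ≈ newton (+ m) 0ℤ []
  newton-0 zero    = refl
  newton-0 (suc _) = refl
  pres : ∀ {c q} → 0ℤ ≡ c → [] ≈ q → [] ≈ newton (+ m) c q
  pres {q = q} refl 0≈q i = trans (newton-0 i) (newton-cong (+ m) 0ℤ {[]} {q} 0≈q i)
bounded-complete (suc d) m C (a ∷ p) (s≤s len) val =
  Any.cartesianProductWith⁺ (newton (+ m)) (λ {c} {q} → pres {c} {q})
    (∈-interval⁺ C (eval (a ∷ p) (+ m)) at-m)
    (bounded-complete d (suc m) (C ℕ.+ C) (quo (+ m) p)
      (ℕ.≤-trans (ℕ.≤-reflexive (length-quo (+ m) p)) len) quo-val)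
  where
  pres : ∀ {c q} → eval (a ∷ p) (+ m) ≡ c → quo (+ m) p ≈ q →
         (a ∷ p) ≈ newton (+ m) c q
  pres {q = q} refl q≈ i = trans (newton-quo (+ m) a p i)
    (newton-cong (+ m) (eval (a ∷ p) (+ m)) {quo (+ m) p} {q} q≈ i)

  at-m : ∣ eval (a ∷ p) (+ m) ∣ ℕ.≤ C
  at-m = subst (λ k → ∣ eval (a ∷ p) (+ k) ∣ ℕ.≤ C) (ℕ.+-identityʳ m) (val 0 (s≤s z≤n))

  quo-val : ∀ i → i ℕ.< d → ∣ eval (quo (+ m) p) (+ (suc m ℕ.+ i)) ∣ ℕ.≤ C ℕ.+ C
  quo-val i i<d = begin
    ∣ v ∣                            ≤⟨ ℕ.m≤n*m ∣ v ∣ (suc i) ⟩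
    suc i ℕ.* ∣ v ∣                  ≡⟨ ℤ.abs-* (+ suc i) v ⟨
    ∣ + suc i ℤ.* v ∣                ≡⟨ cong ∣_∣ eq ⟩
    ∣ eval (a ∷ p) (+ x) ℤ.- eval (a ∷ p) (+ m) ∣
                                     ≤⟨ ℤ.∣i-j∣≤∣i∣+∣j∣ (eval (a ∷ p) (+ x)) _ ⟩
    ∣ eval (a ∷ p) (+ x) ∣ ℕ.+ ∣ eval (a ∷ p) (+ m) ∣
                                     ≤⟨ ℕ.+-mono-≤ at-x at-m ⟩
    C ℕ.+ C                          ∎
    where
    open ℕ.≤-Reasoning
    x = suc m ℕ.+ i
    v = eval (quo (+ m) p) (+ x)
    at-x : ∣ eval (a ∷ p) (+ x) ∣ ℕ.≤ C
    at-x = subst (λ k → ∣ eval (a ∷ p) (+ k) ∣ ℕ.≤ C) (ℕ.+-suc m i) (val (suc i) (s≤s i<d))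
    x≡ : + x ≡ + m ℤ.+ + suc i
    x≡ = cong +_ (sym (ℕ.+-suc m i))
    lemma : ∀ m k u v → (u ℤ.+ (m ℤ.+ k ℤ.- m) ℤ.* v) ℤ.- u ≡ k ℤ.* v
    lemma = solve-∀
    eq : + suc i ℤ.* v ≡ eval (a ∷ p) (+ x) ℤ.- eval (a ∷ p) (+ m)
    eq = sym (trans (cong (ℤ._- eval (a ∷ p) (+ m)) (eval-quo (+ m) a p (+ x)))
      (trans (cong (λ y → (eval (a ∷ p) (+ m) ℤ.+ (y ℤ.- + m) ℤ.* v) ℤ.- eval (a ∷ p) (+ m)) x≡)
             (lemma (+ m) (+ suc i) (eval (a ∷ p) (+ m)) v)))

eventually-nonzero : ∀ p → p ≈ [] ⊎ ∃ λ m → ∀ x → m ℕ.≤ x → eval p (+ x) ≢ 0ℤ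
eventually-nonzero []      = inj₁ λ _ → refl
eventually-nonzero (a ∷ p) with eventually-nonzero p
... | inj₁ p≈0 with a ℤ.≟ 0ℤ
...   | yes refl = inj₁ (0∷[]≈[] p≈0)
...   | no a≢0   = inj₂ (0 , λ x _ ev → a≢0 (trans (sym (value x)) ev))
  where
  value : ∀ x → eval (a ∷ p) (+ x) ≡ a
  value x = trans (cong (λ u → a ℤ.+ + x ℤ.* u) (eval-0 p (+ x) p≈0))
    (trans (cong (λ u → a ℤ.+ u) (ℤ.*-zeroʳ (+ x))) (ℤ.+-identityʳ a))
eventually-nonzero (a ∷ p) | inj₂ (m , nz) = inj₂ (m ℕ.⊔ suc ∣ a ∣ , go)
  where
  lemma : ∀ a u → a ≡ (a ℤ.+ u) ℤ.- u
  lemma = solve-∀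
  go : ∀ x → m ℕ.⊔ suc ∣ a ∣ ℕ.≤ x → eval (a ∷ p) (+ x) ≢ 0ℤ
  go x m≤x ev = ℕ.<-irrefl refl (begin-strict
    ∣ a ∣                  <⟨ ℕ.m⊔n≤o⇒n≤o m (suc ∣ a ∣) m≤x ⟩
    x                      ≤⟨ ℕ.m≤m*n x ∣ v ∣ {{ℕ.≢-nonZero (v≢0 ∘ ℤ.∣i∣≡0⇒i≡0)}} ⟩
    x ℕ.* ∣ v ∣            ≡⟨ ℤ.abs-* (+ x) v ⟨
    ∣ + x ℤ.* v ∣          ≡⟨ ℤ.∣-i∣≡∣i∣ (+ x ℤ.* v) ⟨
    ∣ ℤ.- (+ x ℤ.* v) ∣    ≡⟨ cong ∣_∣ (ℤ.+-identityˡ (ℤ.- (+ x ℤ.* v))) ⟨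
    ∣ 0ℤ ℤ.- (+ x ℤ.* v) ∣ ≡⟨ cong (λ u → ∣ u ℤ.- (+ x ℤ.* v) ∣) ev ⟨
    ∣ (a ℤ.+ + x ℤ.* v) ℤ.- (+ x ℤ.* v) ∣ ≡⟨ cong ∣_∣ (lemma a (+ x ℤ.* v)) ⟨
    ∣ a ∣ ∎)
    where
    open ℕ.≤-Reasoning
    v = eval p (+ x)
    v≢0 : v ≢ 0ℤ
    v≢0 = nz x (ℕ.m⊔n≤o⇒m≤o m (suc ∣ a ∣) m≤x)

valueBound : Poly → ℕ → ℕ → ℕ
valueBound f m zero    = 0
valueBound f m (suc d) = valueBound f m d ℕ.+ ∣ eval f (+ (m ℕ.+ d)) ∣

valueBound-max : ∀ f m d i → i ℕ.< d → ∣ eval f (+ (m ℕ.+ i)) ∣ ℕ.≤ valueBound f m d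
valueBound-max f m (suc d) i i<d with ℕ.m<1+n⇒m<n∨m≡n i<d
... | inj₁ i<d′ = ℕ.≤-trans (valueBound-max f m d i i<d′) (ℕ.m≤m+n _ _)
... | inj₂ refl = ℕ.m≤n+m _ _

divisors : ∀ f → ¬ (f ≈ []) → ∃ λ L → ∀ g h → f ≈ g *ₚ h → Any (g ≈_) L × Any (h ≈_) L
divisors f f≉0 with degree f | eventually-nonzero f
... | inj₁ f≈0 | _        = ⊥-elim (f≉0 f≈0)
... | inj₂ _   | inj₁ f≈0 = ⊥-elim (f≉0 f≈0)
... | inj₂ (d , deg-f) | inj₂ (m , nz) = bounded (suc d) m C , complete
  where
  C = valueBound f m (suc d)

  one : ∀ {e} g (cofactor : ℤ → ℤ) → HasDegree e g → e ℕ.≤ d →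
        (∀ x → eval f x ≡ eval g x ℤ.* cofactor x) → Any (g ≈_) (bounded (suc d) m C)
  one {e} g h (_ , gz) e≤d f≡gh =
    Any.map (λ g′≈q i → trans (g≈g′ i) (g′≈q i))
      (bounded-complete (suc d) m C (take (suc e) g)
        (ℕ.≤-trans (ℕ.≤-reflexive (List.length-take (suc e) g))
          (ℕ.≤-trans (ℕ.m⊓n≤m (suc e) (length g)) (s≤s e≤d)))
        value)
    where
    g≈g′ : g ≈ take (suc e) g
    g≈g′ = truncate (suc e) g gz
    value : ∀ i → i ℕ.< suc d → ∣ eval (take (suc e) g) (+ (m ℕ.+ i)) ∣ ℕ.≤ C
    value i i≤d = begin
      ∣ eval (take (suc e) g) x ∣  ≡⟨ cong ∣_∣ (eval-cong {g} {take (suc e) g} x g≈g′) ⟨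
      ∣ eval g x ∣                 ≤⟨ ℕ.m≤m*n ∣ eval g x ∣ ∣ h x ∣ {{ℕ.≢-nonZero (h≢0 ∘ ℤ.∣i∣≡0⇒i≡0)}} ⟩
      ∣ eval g x ∣ ℕ.* ∣ h x ∣     ≡⟨ ℤ.abs-* (eval g x) (h x) ⟨
      ∣ eval g x ℤ.* h x ∣         ≡⟨ cong ∣_∣ (f≡gh x) ⟨
      ∣ eval f x ∣                 ≤⟨ valueBound-max f m (suc d) i i≤d ⟩
      C                            ∎
      where
      open ℕ.≤-Reasoning
      x = + (m ℕ.+ i)
      h≢0 : h x ≢ 0ℤ
      h≢0 h≡0 = nz (m ℕ.+ i) (ℕ.m≤m+n m i)
        (trans (f≡gh x) (trans (cong (eval g x ℤ.*_) h≡0) (ℤ.*-zeroʳ (eval g x))))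

  complete : ∀ g h → f ≈ g *ₚ h →
    Any (g ≈_) (bounded (suc d) m C) × Any (h ≈_) (bounded (suc d) m C)
  complete g h f≈gh with degree g | degree h
  ... | inj₁ g≈0 | _ = ⊥-elim (f≉0 λ i → trans (f≈gh i) (*-zeroˡ g h g≈0 i))
  ... | inj₂ _ | inj₁ h≈0 = ⊥-elim (f≉0 λ i → trans (f≈gh i) (*-zeroʳ g h h≈0 i))
  ... | inj₂ (d₁ , deg-g) | inj₂ (d₂ , deg-h) =
    one g (eval h) deg-g (ℕ.≤-trans (ℕ.m≤m+n d₁ d₂) d₁+d₂≤d) values ,
    one h (eval g) deg-h (ℕ.≤-trans (ℕ.m≤n+m d₂ d₁) d₁+d₂≤d)
      (λ x → trans (values x) (ℤ.*-comm (eval g x) (eval h x)))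
    where
    d₁+d₂≤d : d₁ ℕ.+ d₂ ℕ.≤ d
    d₁+d₂≤d = factor-degrees {f = f} {g} {h} deg-f deg-g deg-h f≈gh
    values : ∀ x → eval f x ≡ eval g x ℤ.* eval h x
    values x = trans (eval-cong {f} {g *ₚ h} x f≈gh) (eval-* g h x)

1≉0 : ¬ (const 1ℤ ≈ [])
1≉0 1≈0 with 1≈0 0
... | ()

∣1-resp : ∀ {p q} → p ≈ q → p ∣ const 1ℤ → q ∣ const 1ℤ
∣1-resp {p} {q} p≈q (r by rp≈1) =
  r by λ i → trans (*-congʳ r (sym ∘ p≈q) i) (rp≈1 i)

∣1? : ∀ p → Dec (p ∣ const 1ℤ)
∣1? p with divisors (const 1ℤ) 1≉0
... | L , complete = map′ to from (Any.any? (λ r → (r *ₚ p) ≈? const 1ℤ) L)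
  where
  to : Any (λ r → (r *ₚ p) ≈ const 1ℤ) L → p ∣ const 1ℤ
  to any with find any
  ... | r , _ , rp≈1 = r by rp≈1
  from : p ∣ const 1ℤ → Any (λ r → (r *ₚ p) ≈ const 1ℤ) L
  from (r by rp≈1) = Any.map
    (λ {r′} r≈r′ i → trans (*-congˡ {r′} {r} p (sym ∘ r≈r′) i) (rp≈1 i))
    (proj₁ (complete r p (sym ∘ rp≈1)))

reducible? : Decidable Reducible
reducible? f with f ≈? []
... | yes f≈0 = no λ (f≉0 , _) → f≉0 f≈0
... | no f≉0 with divisors f f≉0
...   | L , complete = map′ to from
          (Any.any? (λ g → Any.any? (λ h → (f ≈? (g *ₚ h)) ×-dec
                                           (¬? (∣1? g) ×-dec ¬? (∣1? h))) L) L)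
  where
  Split : Poly → Poly → Set
  Split g h = f ≈ g *ₚ h × g ∤ const 1ℤ × h ∤ const 1ℤ
  to : Any (λ g → Any (Split g) L) L → Reducible f
  to any with find any
  ... | g , _ , any′ with find any′
  ...   | h , _ , split = f≉0 , g , h , split
  from : Reducible f → Any (λ g → Any (Split g) L) L
  from (_ , g , h , f≈gh , g∤1 , h∤1) = Any.map
    (λ {g′} g≈g′ → Any.map
      (λ {h′} h≈h′ →
        (λ i → trans (f≈gh i) (*-cong {g} {g′} {h} {h′} g≈g′ h≈h′ i)) ,
        g∤1 ∘ ∣1-resp {g′} {g} (sym ∘ g≈g′) ,
        h∤1 ∘ ∣1-resp {h′} {h} (sym ∘ h≈h′))
      (proj₂ (complete g h f≈gh)))
    (proj₁ (complete g h f≈gh))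

------------------------------------------------------------------------
-- The matrices with entries bounded by B

vectors : ∀ {A : Set} → List A → ∀ n → List (Vec A n)
vectors xs zero    = [] ∷ []
vectors xs (suc n) = cartesianProductWith _∷_ xs (vectors xs n)

∈-vectors⁺ : ∀ {A : Set} {xs : List A} {n} (v : Vec A n) →
             (∀ i → lookup v i ∈ xs) → v ∈ vectors xs n
∈-vectors⁺ []      _   = here refl
∈-vectors⁺ (x ∷ v) mem =
  ∈-cartesianProductWith⁺ _∷_ (mem zero) (∈-vectors⁺ v (mem ∘ suc))

∈-vectors⁻ : ∀ {A : Set} {xs : List A} {n} (v : Vec A n) →
             v ∈ vectors xs n → ∀ i → lookup v i ∈ xs
∈-vectors⁻ {xs = xs} {suc n} v v∈ i
  with ∈-cartesianProductWith⁻ _∷_ xs (vectors xs n) v∈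
∈-vectors⁻ v v∈ zero    | x , w , x∈ , w∈ , refl = x∈
∈-vectors⁻ v v∈ (suc i) | x , w , x∈ , w∈ , refl = ∈-vectors⁻ w w∈ i

vectors-unique : ∀ {A : Set} {xs : List A} n → Unique xs → Unique (vectors xs n)
vectors-unique zero    xs! = []ᴬ AllPairs.∷ AllPairs.[]
vectors-unique (suc n) xs! =
  Unique.cartesianProductWith⁺ _∷_ Vec.∷-injective xs! (vectors-unique n xs!)

-- By the three facts below, M n B lists each n × n integer matrix with
-- entries bounded by B exactly once.
M : ∀ n → ℕ → List (Matrix n)
M n B = vectors (vectors (interval B) n) n

∈-M⁺ : ∀ n B (A : Matrix n) → (∀ i j → ∣ entry A i j ∣ ℕ.≤ B) → A ∈ M n B
∈-M⁺ n B A bnd =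
  ∈-vectors⁺ A λ i → ∈-vectors⁺ (lookup A i) λ j → ∈-interval⁺ B _ (bnd i j)

∈-M⁻ : ∀ n B (A : Matrix n) → A ∈ M n B → ∀ i j → ∣ entry A i j ∣ ℕ.≤ B
∈-M⁻ n B A A∈ i j = ∈-interval⁻ B _ (∈-vectors⁻ (lookup A i) (∈-vectors⁻ A A∈ i) j)

M-unique : ∀ n B → Unique (M n B)
M-unique n B = vectors-unique n (vectors-unique n (interval-unique B))

M-nonEmpty : ∀ n B → NonZero (length (M n B))
M-nonEmpty n B = nonZero (∈-M⁺ n B 0ᴹ λ i j →
  subst (λ a → ∣ a ∣ ℕ.≤ B) (sym (0-entry i j)) z≤n)
  where
  0ᴹ : Matrix n
  0ᴹ = Vec.replicate n (Vec.replicate n 0ℤ)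
  0-entry : ∀ i j → entry 0ᴹ i j ≡ 0ℤ
  0-entry i j = trans
    (cong (λ v → lookup v j) (Vec.lookup-replicate i (Vec.replicate n 0ℤ)))
    (Vec.lookup-replicate j 0ℤ)
  nonZero : ∀ {A : Set} {x : A} {xs} → x ∈ xs → NonZero (length xs)
  nonZero {xs = _ ∷ _} _ = _

N : ℕ → ℕ → ℕ
N n B = length (filter (reducible? ∘ charPoly) (M n B))

------------------------------------------------------------------------
-- Limits of rational sequences

_TendsTo_ : (ℕ → ℚ) → ℚ → Set
a TendsTo l = ∀ ε → 0ℚ ℚ.< ε → ∃ λ B₀ → ∀ B → B₀ ℕ.≤ B → ℚ.∣ a B ℚ.- l ∣ ℚ.< ε

{-# OPTIONS --safe #-}

-- A sieve over primes.  Fix a shape (k , l) with k + l = n.  For a large prime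
-- p, the proportion of matrices modulo p whose characteristic polynomial
-- splits into monic factors of degrees k and l is at most 1 - 1/(36 n²):
-- * For fixed lower rows R, the characteristic polynomial is an affine
--   function of the first row, injective when the determinant of the
--   cofactors at n points is prime to p; by Lagrange's theorem on lines through
--   an arrow-shaped R this holds for at least half of all R.
-- * There are pⁿ pairs (g , h) of monic polynomials of degrees k and l, but
--   many products coincide: if g has a root r and h a root s ≢ r, trading
--   these roots does not change g h.  So a fixed proportion of the monic
--   polynomials of degree n is not of the form g h.
-- By the Chinese remainder theorem the proportions for distinct primes
-- multiply, and a box of matrices is covered by full residue systems.

module Submission where

open import Defs
open import Data.Nat.Base using (ℕ; _≤_)
open import Data.Integer.Base using (+_)
open import Data.Rational.Base using (_/_; 0ℚ)
open import Data.List.Base using (length)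

open import Level using (0ℓ)
open import Algebra.Bundles.Raw using (RawRing)
import Data.Nat.Base as ℕ
import Data.Nat.Properties as ℕ
import Data.Nat.Divisibility as ℕ
import Data.Nat.DivMod as ℕ
open import Data.Nat.Base using (zero; suc; z≤n; s≤s; s≤s⁻¹; z<s; NonZero)
open import Data.Nat.Primality using (Prime; euclidsLemma; prime⇒nonZero; prime⇒nonTrivial)
open import Data.Integer.Base as ℤ using (ℤ; 0ℤ; 1ℤ; -1ℤ; ∣_∣; -[1+_])
import Data.Integer.Properties as ℤ
import Data.Integer.DivMod as ℤ
import Data.Integer.Divisibility.Signed as ℤ
open import Data.Fin.Base as Fin using (Fin; zero; suc; toℕ; punchIn)
import Data.Fin.Properties as Fin
open import Data.List.Base as List using (List; []; _∷_; _++_; map; upTo; filter; cartesianProductWith)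
import Data.List.Properties as List
open import Data.List.Membership.Propositional using (_∈_; find; lose)
open import Data.List.Membership.Propositional.Properties
open import Data.List.Relation.Unary.Any as Any using (Any; here; there)
open import Data.List.Relation.Unary.All as All using (All; []; _∷_)
open import Data.List.Relation.Unary.AllPairs using (AllPairs; []; _∷_)
import Data.List.Relation.Unary.AllPairs.Properties as AllPairs
import Data.List.Relation.Unary.All.Properties as All
open import Data.List.Relation.Unary.Unique.Propositional using (Unique)
import Data.List.Relation.Unary.Unique.Propositional.Properties as Unique
open import Data.Vec.Base as Vec using (Vec; []; _∷_; lookup)
import Data.Vec.Properties as Vec
open import Data.Vec.Relation.Binary.Pointwise.Inductive as Pointwise using (Pointwise; []; _∷_)
open import Data.Product.Base using (∃; ∃₂; _×_; _,_; proj₁; proj₂)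
open import Data.Sum.Base using (_⊎_; inj₁; inj₂; [_,_]′)
open import Data.Unit.Base using (⊤; tt)
import Data.Rational.Base as ℚ
import Data.Rational.Properties as ℚ
import Data.Rational.Unnormalised.Base as ℚᵘ
import Data.Rational.Unnormalised.Properties as ℚᵘ
open import Data.Empty using (⊥-elim)
open import Data.Bool.Base using (true; false; if_then_else_)
open import Function.Base using (_∘_; id; flip)
open import Relation.Nullary using (¬_; Dec; yes; no)
open import Relation.Nullary.Decidable using (⌊_⌋; ¬?; _×-dec_; map′)
open import Relation.Unary using (Decidable; Pred)
open import Relation.Binary.Definitions using (tri<; tri≈; tri>)
open import Relation.Binary.PropositionalEquality
open import Algebra.Definitions.RawMagma ℤ[X].*-rawMagma using () renaming (_,_ to _by_)

-- Finite sums of natural numbers over lists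

-- The pairs (g , h) are as numerous as the monic polynomials of degree n, so a plain count saves
-- nothing; every gain comes from collisions. The constant 36 n² arises as follows. The roots r of g
-- and s of h are taken from two disjoint sets of residues, each with at least p/3 elements, which
-- gives 9. A monic polynomial of degree d has at most d roots, so at least 1/(9 k l) ≥ 1/(9 n²) of
-- all pairs can be exchanged. Since a collision may merely pair up two witnesses, only half of
-- these are saved; and only half of the lower rows R are known to be regular. A constant gain per
-- prime is enough because s primes leave the proportion (1 - 1/(36 n²))^s. The number s, and with
-- it the modulus, is fixed before B grows. Covering the box by full residue systems then costs a
-- factor 2^(n²) that does not depend on s. No polynomials over a finite field occur: modulo p a
-- factorisation is a family of congruences between integer values at the residues.

module _ where
  open import Data.Nat.Base using (_+_; _*_; _^_; _<_)

  ∑ : {A : Set} → List A → (A → ℕ) → ℕ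
  ∑ []       f = 0
  ∑ (x ∷ xs) f = f x + ∑ xs f

  𝟙 : {P : Set} → Dec P → ℕ
  𝟙 (yes _) = 1
  𝟙 (no _)  = 0

  𝟙-mono : {P Q : Set} (P? : Dec P) (Q? : Dec Q) → (P → Q) → 𝟙 P? ≤ 𝟙 Q?
  𝟙-mono (no _)  _       _   = z≤n
  𝟙-mono (yes p) (yes q) _   = ℕ.≤-refl
  𝟙-mono (yes p) (no ¬q) P⇒Q = ⊥-elim (¬q (P⇒Q p))

  𝟙-yes : {P : Set} (P? : Dec P) → P → 𝟙 P? ≡ 1
  𝟙-yes (yes _) p = refl
  𝟙-yes (no ¬p) p = ⊥-elim (¬p p)

  𝟙≤1 : {P : Set} (P? : Dec P) → 𝟙 P? ≤ 1
  𝟙≤1 (yes _) = ℕ.≤-refl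
  𝟙≤1 (no _)  = z≤n

  𝟙-¬ : {P : Set} (P? : Dec P) → 𝟙 P? + 𝟙 (¬? P?) ≡ 1
  𝟙-¬ (yes _) = refl
  𝟙-¬ (no _)  = refl

  private variable
    A C D : Set

  ∑-mono : ∀ (xs : List A) {f g} → (∀ x → x ∈ xs → f x ≤ g x) → ∑ xs f ≤ ∑ xs g
  ∑-mono []       f≤g = z≤n
  ∑-mono (x ∷ xs) f≤g = ℕ.+-mono-≤ (f≤g x (here refl)) (∑-mono xs λ y → f≤g y ∘ there)

  ∑-cong : ∀ (xs : List A) {f g} → (∀ x → f x ≡ g x) → ∑ xs f ≡ ∑ xs g
  ∑-cong []       f≡g = refl
  ∑-cong (x ∷ xs) f≡g = cong₂ _+_ (f≡g x) (∑-cong xs f≡g)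

  interchange : ∀ a b c d → (a + b) + (c + d) ≡ (a + c) + (b + d)
  interchange = solve-∀
    where open import Data.Nat.Tactic.RingSolver using (solve-∀)

  ∑-+ : ∀ (xs : List A) f g → ∑ xs (λ x → f x + g x) ≡ ∑ xs f + ∑ xs g
  ∑-+ []       f g = refl
  ∑-+ (x ∷ xs) f g =
    trans (cong (λ u → f x + g x + u) (∑-+ xs f g)) (interchange (f x) (g x) (∑ xs f) (∑ xs g))

  ∑-*ˡ : ∀ c (xs : List A) f → ∑ xs (λ x → c * f x) ≡ c * ∑ xs f
  ∑-*ˡ c []       f = sym (ℕ.*-zeroʳ c)
  ∑-*ˡ c (x ∷ xs) f =
    trans (cong (λ u → c * f x + u) (∑-*ˡ c xs f)) (sym (ℕ.*-distribˡ-+ c (f x) (∑ xs f)))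

  ∑-*ʳ : ∀ c (xs : List A) f → ∑ xs (λ x → f x * c) ≡ ∑ xs f * c
  ∑-*ʳ c xs f = trans (∑-cong xs λ x → ℕ.*-comm (f x) c)
    (trans (∑-*ˡ c xs f) (ℕ.*-comm c _))

  ∑-const : ∀ (xs : List A) c → ∑ xs (λ _ → c) ≡ length xs * c
  ∑-const []       c = refl
  ∑-const (x ∷ xs) c = cong (λ u → c + u) (∑-const xs c)

  ∑-bound : ∀ (xs : List A) {f} c → (∀ x → x ∈ xs → f x ≤ c) → ∑ xs f ≤ length xs * c
  ∑-bound xs c f≤c = ℕ.≤-trans (∑-mono xs f≤c) (ℕ.≤-reflexive (∑-const xs c))

  ∑-map : ∀ (h : A → C) xs f → ∑ (map h xs) f ≡ ∑ xs (f ∘ h)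
  ∑-map h []       f = refl
  ∑-map h (x ∷ xs) f = cong (λ u → f (h x) + u) (∑-map h xs f)

  ∑-++ : ∀ (xs ys : List A) f → ∑ (xs ++ ys) f ≡ ∑ xs f + ∑ ys f
  ∑-++ []       ys f = refl
  ∑-++ (x ∷ xs) ys f =
    trans (cong (λ u → f x + u) (∑-++ xs ys f)) (sym (ℕ.+-assoc (f x) (∑ xs f) (∑ ys f)))

  ∑-product : ∀ (h : A → C → D) xs ys f →
    ∑ (cartesianProductWith h xs ys) f ≡ ∑ xs λ x → ∑ ys λ y → f (h x y)
  ∑-product h []       ys f = refl
  ∑-product h (x ∷ xs) ys f = trans (∑-++ (map (h x) ys) _ f)
    (cong₂ _+_ (∑-map (h x) ys f) (∑-product h xs ys f))

  ∑-swap : ∀ (xs : List A) (ys : List C) (f : A → C → ℕ) →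
    (∑ xs λ x → ∑ ys λ y → f x y) ≡ (∑ ys λ y → ∑ xs λ x → f x y)
  ∑-swap []       ys f = sym (trans (∑-const ys 0) (ℕ.*-zeroʳ (length ys)))
  ∑-swap (x ∷ xs) ys f = trans (cong (λ u → ∑ ys (f x) + u) (∑-swap xs ys f))
    (sym (∑-+ ys (f x) λ y → ∑ xs λ x → f x y))

  length-filter-∑ : ∀ {P : Pred A 0ℓ} (P? : Decidable P) xs →
    length (filter P? xs) ≡ ∑ xs (𝟙 ∘ P?)
  length-filter-∑ P? []       = refl
  length-filter-∑ P? (x ∷ xs) with P? x
  ... | yes _ = cong suc (length-filter-∑ P? xs)
  ... | no _  = length-filter-∑ P? xs

  ∑-≥₁ : ∀ {xs : List A} {x} f → x ∈ xs → f x ≤ ∑ xs f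
  ∑-≥₁ f (here refl)      = ℕ.m≤m+n _ _
  ∑-≥₁ {xs = y ∷ _} f (there x∈xs) = ℕ.≤-trans (∑-≥₁ f x∈xs) (ℕ.m≤n+m _ (f y))

  ∑-≥₂ : ∀ {xs : List A} {x y} f → x ∈ xs → y ∈ xs → x ≢ y → f x + f y ≤ ∑ xs f
  ∑-≥₂ f (here refl) (here refl) x≢y = ⊥-elim (x≢y refl)
  ∑-≥₂ {x = x} f (here refl) (there y∈) x≢y = ℕ.+-monoʳ-≤ (f x) (∑-≥₁ f y∈)
  ∑-≥₂ {x = x} {y} f (there x∈) (here refl) x≢y =
    ℕ.≤-trans (ℕ.≤-reflexive (ℕ.+-comm (f x) (f y))) (ℕ.+-monoʳ-≤ (f y) (∑-≥₁ f x∈))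
  ∑-≥₂ {xs = z ∷ _} f (there x∈) (there y∈) x≢y =
    ℕ.≤-trans (∑-≥₂ f x∈ y∈ x≢y) (ℕ.m≤n+m _ (f z))

  ∑-≤1 : ∀ {P : Pred A 0ℓ} (P? : Decidable P) {xs} → Unique xs →
    (∀ {x y} → x ∈ xs → y ∈ xs → P x → P y → x ≡ y) → ∑ xs (𝟙 ∘ P?) ≤ 1
  ∑-≤1 P? {[]}     _              _    = z≤n
  ∑-≤1 P? {x ∷ xs} (x≢ ∷ unique) same with P? x
  ... | no _   = ∑-≤1 P? unique λ y∈ z∈ → same (there y∈) (there z∈)
  ... | yes px = s≤s (ℕ.≤-reflexive (∑-zero λ y y∈ → none y y∈ (P? y)))
    where
    none : ∀ y → y ∈ xs → (Q? : Dec _) → 𝟙 Q? ≡ 0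
    none y y∈ (no _)   = refl
    none y y∈ (yes py) = ⊥-elim (All.lookup x≢ y∈ (same (here refl) (there y∈) px py))
    ∑-zero : ∀ {f} {ys : List _} → (∀ y → y ∈ ys → f y ≡ 0) → ∑ ys f ≡ 0
    ∑-zero {ys = []}     f≡0 = refl
    ∑-zero {ys = y ∷ ys} f≡0 = cong₂ _+_ (f≡0 y (here refl)) (∑-zero λ z → f≡0 z ∘ there)

  ∑-injection : ∀ {xs : List A} {ys : List C} (h : A → C) f → Unique xs →
    (∀ {x} → x ∈ xs → h x ∈ ys) →
    (∀ {x y} → x ∈ xs → y ∈ xs → h x ≡ h y → x ≡ y) → ∑ xs (f ∘ h) ≤ ∑ ys f
  ∑-injection {xs = []}     h f unique into inj = z≤n
  ∑-injection {xs = x ∷ xs} h f (x≢ ∷ unique) into inj with ∈-∃++ (into (here refl))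
  ... | us , vs , refl = ℕ.≤-trans (ℕ.+-monoʳ-≤ (f (h x)) rest) (ℕ.≤-reflexive eq)
    where
    avoid : ∀ {y} → y ∈ xs → h y ∈ us ++ vs
    avoid {y} y∈ with ∈-++⁻ us (into (there y∈))
    ... | inj₁ ∈us              = ∈-++⁺ˡ ∈us
    ... | inj₂ (there ∈vs)      = ∈-++⁺ʳ us ∈vs
    ... | inj₂ (here hy≡hx) =
      ⊥-elim (All.lookup x≢ y∈ (inj (here refl) (there y∈) (sym hy≡hx)))
    rest : ∑ xs (f ∘ h) ≤ ∑ (us ++ vs) f
    rest = ∑-injection h f unique avoid λ y∈ z∈ → inj (there y∈) (there z∈)
    swap-head : ∀ a b c → a + (b + c) ≡ b + (a + c)
    swap-head = solve-∀
      where open import Data.Nat.Tactic.RingSolver using (solve-∀)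
    eq : f (h x) + ∑ (us ++ vs) f ≡ ∑ (us ++ h x ∷ vs) f
    eq = trans (cong (λ u → f (h x) + u) (∑-++ us vs f))
      (trans (swap-head (f (h x)) (∑ us f) (∑ vs f)) (sym (∑-++ us (h x ∷ vs) f)))

  length-cartesianProductWith : ∀ (h : A → C → D) xs ys →
    length (cartesianProductWith h xs ys) ≡ length xs * length ys
  length-cartesianProductWith h []       ys = refl
  length-cartesianProductWith h (x ∷ xs) ys = trans (List.length-++ (map (h x) ys))
    (cong₂ _+_ (List.length-map (h x) ys) (length-cartesianProductWith h xs ys))

  length-vectors : ∀ (xs : List A) n → length (vectors xs n) ≡ length xs ^ n
  length-vectors xs zero    = refl
  length-vectors xs (suc n) = trans (length-cartesianProductWith _∷_ xs (vectors xs n))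
    (cong (λ u → length xs * u) (length-vectors xs n))

  -- Lifts a splitting of one coordinate into pairs to all coordinates at once. Applied to its own
  -- result, it lifts the splitting from entries to matrices.
  ∑-vectors-zipWith : ∀ (h : A → C → D) {xs ys zs} →
    (∀ f → ∑ zs f ≡ ∑ xs λ x → ∑ ys λ y → f (h x y)) →
    ∀ n f → ∑ (vectors zs n) f ≡
            ∑ (vectors xs n) λ u → ∑ (vectors ys n) λ v → f (Vec.zipWith h u v)
  ∑-vectors-zipWith h H zero    f = cong (_+ 0) (sym (ℕ.+-identityʳ _))
  ∑-vectors-zipWith h {xs} {ys} {zs} H (suc n) f = begin
    ∑ (vectors zs (suc n)) f
      ≡⟨ ∑-product _∷_ zs (vectors zs n) f ⟩
    (∑ zs λ z → ∑ (vectors zs n) λ w → f (z ∷ w))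
      ≡⟨ H _ ⟩
    (∑ xs λ x → ∑ ys λ y → ∑ (vectors zs n) λ w → f (h x y ∷ w))
      ≡⟨ ∑-cong xs (λ x → ∑-cong ys λ y → ∑-vectors-zipWith h H n _) ⟩
    (∑ xs λ x → ∑ ys λ y → ∑ (vectors xs n) λ u → ∑ (vectors ys n) λ v →
      f (h x y ∷ Vec.zipWith h u v))
      ≡⟨ ∑-cong xs (λ x → ∑-swap ys (vectors xs n) _) ⟩
    (∑ xs λ x → ∑ (vectors xs n) λ u → ∑ ys λ y → ∑ (vectors ys n) λ v →
      f (h x y ∷ Vec.zipWith h u v))
      ≡⟨ ∑-cong xs (λ x → ∑-cong (vectors xs n) λ u → ∑-product _∷_ ys (vectors ys n) _) ⟨
    (∑ xs λ x → ∑ (vectors xs n) λ u → ∑ (vectors ys (suc n)) λ v →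
      f (Vec.zipWith h (x ∷ u) v))
      ≡⟨ ∑-product _∷_ xs (vectors xs n) _ ⟨
    (∑ (vectors xs (suc n)) λ u → ∑ (vectors ys (suc n)) λ v → f (Vec.zipWith h u v)) ∎
    where open ≡-Reasoning

  Respects : (A → A → Set) → (A → ℕ) → Set
  Respects _~_ f = ∀ {x y} → x ~ y → f x ≡ f y

  ∑-vectors-transport : (_~_ : A → A → Set) → (∀ {x} → x ~ x) →
    ∀ (h : C → A → A) {xs ys} →
    (∀ c f → Respects _~_ f → ∑ xs (f ∘ h c) ≤ ∑ ys f) →
    ∀ {n} (u : Vec C n) f → Respects (Pointwise _~_) f →
    ∑ (vectors xs n) (f ∘ Vec.zipWith h u) ≤ ∑ (vectors ys n) f
  ∑-vectors-transport _~_ rfl h H []      f f-resp = ℕ.≤-refl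
  ∑-vectors-transport _~_ rfl h {xs} {ys} H {suc n} (c ∷ u) f f-resp = begin
    ∑ (vectors xs (suc n)) (f ∘ Vec.zipWith h (c ∷ u))
      ≡⟨ ∑-product _∷_ xs (vectors xs n) _ ⟩
    (∑ xs λ x → ∑ (vectors xs n) λ v → f (h c x ∷ Vec.zipWith h u v))
      ≤⟨ ∑-mono xs (λ x _ → ∑-vectors-transport _~_ rfl h H u (λ v → f (h c x ∷ v))
                      λ v~w → f-resp (rfl ∷ v~w)) ⟩
    (∑ xs λ x → ∑ (vectors ys n) λ v → f (h c x ∷ v))
      ≤⟨ H c (λ y → ∑ (vectors ys n) λ v → f (y ∷ v))
           (λ x~y → ∑-cong (vectors ys n) λ v →
             f-resp (x~y ∷ Pointwise.refl (λ {x} → rfl {x}))) ⟩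
    (∑ ys λ y → ∑ (vectors ys n) λ v → f (y ∷ v))
      ≡⟨ ∑-product _∷_ ys (vectors ys n) f ⟨
    ∑ (vectors ys (suc n)) f ∎
    where open ℕ.≤-Reasoning

-- Determinants

-- Determinants preserve whatever relation the ring operations preserve. The instances are equality,
-- which stands in for extensionality of entry functions, congruence modulo m, and evaluation of
-- polynomials at a point.
record RingRelation (R S : RawRing 0ℓ 0ℓ) : Set₁ where
  private
    module R = RawRing R
    module S = RawRing S
  infix 4 _~_
  field
    _~_ : R.Carrier → S.Carrier → Set
    +-~ : ∀ {a b c d} → a ~ b → c ~ d → (a R.+ c) ~ (b S.+ d)
    *-~ : ∀ {a b c d} → a ~ b → c ~ d → (a R.* c) ~ (b S.* d)
    -‿~ : ∀ {a b} → a ~ b → (R.- a) ~ (S.- b)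
    0-~ : R.0# ~ S.0#
    1-~ : R.1# ~ S.1#

  open import Algebra.Definitions.RawSemiring R.rawSemiring using ()
    renaming (sum to sumᴿ; _^_ to _^ᴿ_)
  open import Algebra.Definitions.RawSemiring S.rawSemiring using ()
    renaming (sum to sumˢ; _^_ to _^ˢ_)

  sum-~ : ∀ {n} {f : Fin n → R.Carrier} {g : Fin n → S.Carrier} →
          (∀ i → f i ~ g i) → sumᴿ f ~ sumˢ g
  sum-~ {zero}  f~g = 0-~
  sum-~ {suc n} f~g = +-~ (f~g zero) (sum-~ (f~g ∘ suc))

  ^-~ : ∀ k {a b} → a ~ b → (a ^ᴿ k) ~ (b ^ˢ k)
  ^-~ zero    a~b = 1-~
  ^-~ (suc k) a~b = *-~ a~b (^-~ k a~b)

  if-~ : ∀ t {a b c d} → a ~ b → c ~ d → (if t then a else c) ~ (if t then b else d)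
  if-~ true  a~b c~d = a~b
  if-~ false a~b c~d = c~d

  det-~ : ∀ {n} {A : Fin n → Fin n → R.Carrier} {B : Fin n → Fin n → S.Carrier} →
          (∀ i j → A i j ~ B i j) → Determinant.det R A ~ Determinant.det S B
  det-~ {zero}  A~B = 1-~
  det-~ {suc n} A~B = sum-~ λ j →
    *-~ (^-~ (toℕ j) (-‿~ 1-~)) (*-~ (A~B zero j) (det-~ λ i k → A~B (suc i) (punchIn j k)))

module CharacteristicMatrix (S : RawRing 0ℓ 0ℓ) where
  open RawRing S
  open Determinant S
  open import Algebra.Definitions.RawSemiring rawSemiring using (_^_)

  -- `σ i` is the position of row i in the square matrix: `id` for a whole matrix, `suc` for the
  -- rows below the first.
  charEntry : ∀ {m n} → Carrier → (Fin m → Fin n → Carrier) → (Fin m → Fin n) →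
              Fin m → Fin n → Carrier
  charEntry x A σ i j = (if ⌊ σ i Fin.≟ j ⌋ then x else 0#) + - A i j

  -- R consists of the rows of a square matrix below the first one.
  cofactor : ∀ {n} → Carrier → (Fin n → Fin (suc n) → Carrier) → Fin (suc n) → Carrier
  cofactor x R j =
    (- 1#) ^ toℕ j * det (λ i k → charEntry x R suc i (punchIn j k))

  -- Evaluation points index the columns, so a change of the first row acts by a linear combination
  -- of rows, the form that `cramer` takes.
  cofactorMatrix : ∀ {n} → (Fin (suc n) → Carrier) → (Fin n → Fin (suc n) → Carrier) →
                   Fin (suc n) → Fin (suc n) → Carrier
  cofactorMatrix x R j i = cofactor (x i) R j

module _ {R S : RawRing 0ℓ 0ℓ} (rel : RingRelation R S) where
  open RingRelation rel
  private
    module Cᴿ = CharacteristicMatrix R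
    module Cˢ = CharacteristicMatrix S

  charEntry-~ : ∀ {m n x y A B} (σ : Fin m → Fin n) i j → x ~ y → A i j ~ B i j →
                Cᴿ.charEntry x A σ i j ~ Cˢ.charEntry y B σ i j
  charEntry-~ σ i j x~y A~B = +-~ (if-~ ⌊ σ i Fin.≟ j ⌋ x~y 0-~) (-‿~ A~B)

  cofactor-~ : ∀ {n x y} {A : Fin n → Fin (suc n) → _} {B : Fin n → Fin (suc n) → _} →
               x ~ y → (∀ i j → A i j ~ B i j) → ∀ j →
               Cᴿ.cofactor x A j ~ Cˢ.cofactor y B j
  cofactor-~ {A = A} {B} x~y A~B j = *-~ (^-~ (toℕ j) (-‿~ 1-~))
    (det-~ λ i k → charEntry-~ {A = A} {B} suc i (punchIn j k) x~y (A~B i (punchIn j k)))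

ℤᴿ : RawRing 0ℓ 0ℓ
ℤᴿ = ℤ.+-*-rawRing

open CharacteristicMatrix ℤᴿ
open Determinant ℤᴿ using (det)
open import Algebra.Definitions.RawSemiring (RawRing.rawSemiring ℤᴿ) using (sum; _^_)

≡-relation : RingRelation ℤᴿ ℤᴿ
≡-relation = record
  { _~_ = _≡_
  ; +-~ = cong₂ ℤ._+_
  ; *-~ = cong₂ ℤ._*_
  ; -‿~ = cong (λ a → ℤ.- a)
  ; 0-~ = refl
  ; 1-~ = refl
  }

sum-cong : ∀ {n} {f g : Fin n → ℤ} → (∀ i → f i ≡ g i) → sum f ≡ sum g
sum-cong = RingRelation.sum-~ ≡-relation

δ-suc : ∀ {A : Set} {n} (i j : Fin n) {a b : A} →
        (if ⌊ suc i Fin.≟ suc j ⌋ then a else b) ≡ (if ⌊ i Fin.≟ j ⌋ then a else b)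
δ-suc i j with i Fin.≟ j
... | yes _ = refl
... | no _  = refl

δ-≢ : ∀ {A : Set} {n} {i j : Fin n} {a b : A} → i ≢ j → (if ⌊ i Fin.≟ j ⌋ then a else b) ≡ b
δ-≢ {i = i} {j} i≢j with i Fin.≟ j
... | yes i≡j = ⊥-elim (i≢j i≡j)
... | no _    = refl

δ-≡ : ∀ {A : Set} {n} (i : Fin n) {a b : A} → (if ⌊ i Fin.≟ i ⌋ then a else b) ≡ a
δ-≡ i with i Fin.≟ i
... | yes _   = refl
... | no i≢i = ⊥-elim (i≢i refl)

-- Products and triangular determinants over the integers.

module _ where
  open import Data.Integer.Base using (_+_; _*_; _-_; -_)
  open import Data.Integer.Tactic.RingSolver using (solve-∀)

  ∏ : ∀ {n} → (Fin n → ℤ) → ℤ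
  ∏ {zero}  f = 1ℤ
  ∏ {suc n} f = f zero * ∏ (f ∘ suc)

  ∏-cong : ∀ {n} {f g : Fin n → ℤ} → (∀ i → f i ≡ g i) → ∏ f ≡ ∏ g
  ∏-cong {zero}  f≡g = refl
  ∏-cong {suc n} f≡g = cong₂ _*_ (f≡g zero) (∏-cong (f≡g ∘ suc))

  ∏-1 : ∀ n → ∏ {n} (λ _ → 1ℤ) ≡ 1ℤ
  ∏-1 zero    = refl
  ∏-1 (suc n) = cong (1ℤ *_) (∏-1 n)

  sum-zero : ∀ {n} {f : Fin n → ℤ} → (∀ i → f i ≡ 0ℤ) → sum f ≡ 0ℤ
  sum-zero {zero}  f≡0 = refl
  sum-zero {suc n} f≡0 = cong₂ _+_ (f≡0 zero) (sum-zero (f≡0 ∘ suc))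

  sum-- : ∀ {n} (f g : Fin n → ℤ) → sum f - sum g ≡ sum (λ i → f i - g i)
  sum-- {zero}  f g = refl
  sum-- {suc n} f g = trans (lemma (f zero) (g zero) _ _)
    (cong (λ u → f zero - g zero + u) (sum-- (f ∘ suc) (g ∘ suc)))
    where
    lemma : ∀ a b c d → a + c - (b + d) ≡ a - b + (c - d)
    lemma = solve-∀

  det-lowerTriangular : ∀ {n} (A : Fin n → Fin n → ℤ) →
    (∀ i j → i Fin.< j → A i j ≡ 0ℤ) → det A ≡ ∏ λ i → A i i
  det-lowerTriangular {zero}  A lower = refl
  det-lowerTriangular {suc n} A lower = trans
    (cong₂ (λ u v → 1ℤ * (A zero zero * u) + v)
      (det-lowerTriangular (λ i k → A (suc i) (suc k)) λ i j i<j → lower (suc i) (suc j) (s≤s i<j))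
      (sum-zero λ j → trans
        
          (cong (λ u → (- 1ℤ) ^ toℕ (suc j) * (u * det λ i k → A (suc i) (punchIn (suc j) k)))
                (lower zero (suc j) z<s))
        (ℤ.*-zeroʳ ((- 1ℤ) ^ toℕ (suc j)))))
    (lemma (A zero zero) _)
    where
    lemma : ∀ a b → 1ℤ * (a * b) + 0ℤ ≡ a * b
    lemma = solve-∀

-- The determinant as an iterated contraction: Λ n is the exterior algebra
-- of ℤⁿ, a pair (x , y) standing for x + e₀ ∧ y.

module _ where
  open import Data.Integer.Base using (_+_; _*_; _-_; -_)
  open import Data.Integer.Tactic.RingSolver using (solve-∀)

  Λ : ℕ → Set
  Λ zero    = ℤ
  Λ (suc n) = Λ n × Λ n

  0Λ : ∀ {n} → Λ n
  0Λ {zero}  = 0ℤ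
  0Λ {suc n} = 0Λ , 0Λ

  infixl 6 _⊕_
  infixr 7 _⊙_

  _⊕_ : ∀ {n} → Λ n → Λ n → Λ n
  _⊕_ {zero}  x       y       = x + y
  _⊕_ {suc n} (x , y) (z , w) = x ⊕ z , y ⊕ w

  _⊙_ : ∀ {n} → ℤ → Λ n → Λ n
  _⊙_ {zero}  c x       = c * x
  _⊙_ {suc n} c (x , y) = c ⊙ x , c ⊙ y

  ⊕-comm : ∀ {n} (x y : Λ n) → x ⊕ y ≡ y ⊕ x
  ⊕-comm {zero}  x       y       = ℤ.+-comm x y
  ⊕-comm {suc n} (x , y) (z , w) = cong₂ _,_ (⊕-comm x z) (⊕-comm y w)

  ⊕-assoc : ∀ {n} (x y z : Λ n) → (x ⊕ y) ⊕ z ≡ x ⊕ (y ⊕ z)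
  ⊕-assoc {zero}  x       y        z        = ℤ.+-assoc x y z
  ⊕-assoc {suc n} (x , y) (x′ , y′) (x″ , y″) = cong₂ _,_ (⊕-assoc x x′ x″) (⊕-assoc y y′ y″)

  ⊕-identityʳ : ∀ {n} (x : Λ n) → x ⊕ 0Λ ≡ x
  ⊕-identityʳ {zero}  x       = ℤ.+-identityʳ x
  ⊕-identityʳ {suc n} (x , y) = cong₂ _,_ (⊕-identityʳ x) (⊕-identityʳ y)

  ⊕-identityˡ : ∀ {n} (x : Λ n) → 0Λ ⊕ x ≡ x
  ⊕-identityˡ x = trans (⊕-comm 0Λ x) (⊕-identityʳ x)

  ⊕-interchange : ∀ {n} (x y z w : Λ n) → (x ⊕ y) ⊕ (z ⊕ w) ≡ (x ⊕ z) ⊕ (y ⊕ w)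
  ⊕-interchange {zero}  = lemma
    where
    lemma : ∀ a b c d → a + b + (c + d) ≡ a + c + (b + d)
    lemma = solve-∀
  ⊕-interchange {suc n} (x , x′) (y , y′) (z , z′) (w , w′) =
    cong₂ _,_ (⊕-interchange x y z w) (⊕-interchange x′ y′ z′ w′)

  ⊙-distribˡ : ∀ {n} c (x y : Λ n) → c ⊙ (x ⊕ y) ≡ c ⊙ x ⊕ c ⊙ y
  ⊙-distribˡ {zero}  c x       y       = ℤ.*-distribˡ-+ c x y
  ⊙-distribˡ {suc n} c (x , y) (z , w) = cong₂ _,_ (⊙-distribˡ c x z) (⊙-distribˡ c y w)

  ⊙-distribʳ : ∀ {n} c d (x : Λ n) → (c + d) ⊙ x ≡ c ⊙ x ⊕ d ⊙ x
  ⊙-distribʳ {zero}  c d x       = ℤ.*-distribʳ-+ x c d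
  ⊙-distribʳ {suc n} c d (x , y) = cong₂ _,_ (⊙-distribʳ c d x) (⊙-distribʳ c d y)

  ⊙-assoc : ∀ {n} c d (x : Λ n) → (c * d) ⊙ x ≡ c ⊙ (d ⊙ x)
  ⊙-assoc {zero}  c d x       = ℤ.*-assoc c d x
  ⊙-assoc {suc n} c d (x , y) = cong₂ _,_ (⊙-assoc c d x) (⊙-assoc c d y)

  ⊙-comm : ∀ {n} c d (x : Λ n) → c ⊙ (d ⊙ x) ≡ d ⊙ (c ⊙ x)
  ⊙-comm c d x = trans (sym (⊙-assoc c d x)) (trans (cong (_⊙ x) (ℤ.*-comm c d)) (⊙-assoc d c x))

  ⊙-zeroˡ : ∀ {n} (x : Λ n) → 0ℤ ⊙ x ≡ 0Λ
  ⊙-zeroˡ {zero}  x       = refl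
  ⊙-zeroˡ {suc n} (x , y) = cong₂ _,_ (⊙-zeroˡ x) (⊙-zeroˡ y)

  ⊙-zeroʳ : ∀ {n} c → c ⊙ 0Λ {n} ≡ 0Λ
  ⊙-zeroʳ {zero}  c = ℤ.*-zeroʳ c
  ⊙-zeroʳ {suc n} c = cong₂ _,_ (⊙-zeroʳ c) (⊙-zeroʳ c)

  ⊙-identity : ∀ {n} (x : Λ n) → 1ℤ ⊙ x ≡ x
  ⊙-identity {zero}  x       = ℤ.*-identityˡ x
  ⊙-identity {suc n} (x , y) = cong₂ _,_ (⊙-identity x) (⊙-identity y)

  ⊕-inverse : ∀ {n} (x : Λ n) → x ⊕ -1ℤ ⊙ x ≡ 0Λ
  ⊕-inverse x = trans (cong (_⊕ -1ℤ ⊙ x) (sym (⊙-identity x)))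
    (trans (sym (⊙-distribʳ 1ℤ -1ℤ x)) (⊙-zeroˡ x))

  -- Contraction with the linear form `a`. It is an antiderivation, so e₀ ∧ y goes to a₀ y - e₀ ∧ ι
  -- y.
  ι : ∀ {n} → (Fin n → ℤ) → Λ n → Λ n
  ι {zero}  a x       = 0ℤ
  ι {suc n} a (x , y) = ι (a ∘ suc) x ⊕ a zero ⊙ y , -1ℤ ⊙ ι (a ∘ suc) y

  ι-cong : ∀ {n} {a b : Fin n → ℤ} → (∀ i → a i ≡ b i) → ∀ x → ι a x ≡ ι b x
  ι-cong {zero}  a≡b x       = refl
  ι-cong {suc n} a≡b (x , y) = cong₂ _,_
    (cong₂ _⊕_ (ι-cong (a≡b ∘ suc) x) (cong (_⊙ y) (a≡b zero)))
    (cong (-1ℤ ⊙_) (ι-cong (a≡b ∘ suc) y))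

  ι-⊕ : ∀ {n} (a : Fin n → ℤ) x y → ι a (x ⊕ y) ≡ ι a x ⊕ ι a y
  ι-⊕ {zero}  a x       y       = refl
  ι-⊕ {suc n} a (x , y) (z , w) = cong₂ _,_
    (trans (cong₂ _⊕_ (ι-⊕ (a ∘ suc) x z) (⊙-distribˡ (a zero) y w)) (⊕-interchange _ _ _ _))
    (trans (cong (-1ℤ ⊙_) (ι-⊕ (a ∘ suc) y w)) (⊙-distribˡ -1ℤ _ _))

  ι-⊙ : ∀ {n} (a : Fin n → ℤ) c x → ι a (c ⊙ x) ≡ c ⊙ ι a x
  ι-⊙ {zero}  a c x       = sym (ℤ.*-zeroʳ c)
  ι-⊙ {suc n} a c (x , y) = cong₂ _,_
    (trans (cong₂ _⊕_ (ι-⊙ (a ∘ suc) c x) (⊙-comm (a zero) c y)) (sym (⊙-distribˡ c _ _)))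
    (trans (cong (-1ℤ ⊙_) (ι-⊙ (a ∘ suc) c y)) (⊙-comm -1ℤ c _))

  ι-+ : ∀ {n} (a b : Fin n → ℤ) x → ι (λ i → a i + b i) x ≡ ι a x ⊕ ι b x
  ι-+ {zero}  a b x       = refl
  ι-+ {suc n} a b (x , y) = cong₂ _,_
    (trans (cong₂ _⊕_ (ι-+ (a ∘ suc) (b ∘ suc) x) (⊙-distribʳ (a zero) (b zero) y))
           (⊕-interchange _ _ _ _))
    (trans (cong (-1ℤ ⊙_) (ι-+ (a ∘ suc) (b ∘ suc) y)) (⊙-distribˡ -1ℤ _ _))

  ι-* : ∀ {n} c (a : Fin n → ℤ) x → ι (λ i → c * a i) x ≡ c ⊙ ι a x
  ι-* {zero}  c a x       = sym (ℤ.*-zeroʳ c)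
  ι-* {suc n} c a (x , y) = cong₂ _,_
    (trans (cong₂ _⊕_ (ι-* c (a ∘ suc) x) (⊙-assoc c (a zero) y)) (sym (⊙-distribˡ c _ _)))
    (trans (cong (-1ℤ ⊙_) (ι-* c (a ∘ suc) y)) (⊙-comm -1ℤ c _))

  ι-ι : ∀ {n} (a : Fin n → ℤ) x → ι a (ι a x) ≡ 0Λ
  ι-ι {zero}  a x       = refl
  ι-ι {suc n} a (x , y) = cong₂ _,_
    (begin
      ι a′ (ι a′ x ⊕ a zero ⊙ y) ⊕ a zero ⊙ (-1ℤ ⊙ ι a′ y)
        ≡⟨ cong₂ _⊕_ (trans (ι-⊕ a′ _ _) (cong₂ _⊕_ (ι-ι a′ x) (ι-⊙ a′ (a zero) y)))
                     (⊙-comm (a zero) -1ℤ _) ⟩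
      (0Λ ⊕ a zero ⊙ ι a′ y) ⊕ -1ℤ ⊙ (a zero ⊙ ι a′ y)
        ≡⟨ cong (_⊕ -1ℤ ⊙ (a zero ⊙ ι a′ y)) (⊕-identityˡ _) ⟩
      a zero ⊙ ι a′ y ⊕ -1ℤ ⊙ (a zero ⊙ ι a′ y)
        ≡⟨ ⊕-inverse _ ⟩
      0Λ ∎)
    (trans (cong (-1ℤ ⊙_) (trans (ι-⊙ a′ -1ℤ _) (trans (cong (-1ℤ ⊙_) (ι-ι a′ y)) (⊙-zeroʳ -1ℤ))))
           (⊙-zeroʳ -1ℤ))
    where
    open ≡-Reasoning
    a′ = a ∘ suc

  -- Polarisation of `ι-ι`: expand the square of the contraction with a + b. Row exchanges follow
  -- from this without comparing double Laplace expansions.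
  ι-anticomm : ∀ {n} (a b : Fin n → ℤ) x → ι a (ι b x) ≡ -1ℤ ⊙ ι b (ι a x)
  ι-anticomm a b x = begin
    ι a (ι b x)
      ≡⟨ ⊕-identityʳ _ ⟨
    ι a (ι b x) ⊕ 0Λ
      ≡⟨ cong (ι a (ι b x) ⊕_) (⊕-inverse (ι b (ι a x))) ⟨
    ι a (ι b x) ⊕ (ι b (ι a x) ⊕ -1ℤ ⊙ ι b (ι a x))
      ≡⟨ ⊕-assoc _ _ _ ⟨
    (ι a (ι b x) ⊕ ι b (ι a x)) ⊕ -1ℤ ⊙ ι b (ι a x)
      ≡⟨ cong (_⊕ -1ℤ ⊙ ι b (ι a x)) vanish ⟩
    0Λ ⊕ -1ℤ ⊙ ι b (ι a x)
      ≡⟨ ⊕-identityˡ _ ⟩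
    -1ℤ ⊙ ι b (ι a x) ∎
    where
    open ≡-Reasoning
    a+b : Fin _ → ℤ
    a+b i = a i + b i
    vanish : ι a (ι b x) ⊕ ι b (ι a x) ≡ 0Λ
    vanish = begin
      ι a (ι b x) ⊕ ι b (ι a x)
        ≡⟨ cong₂ _⊕_ (⊕-identityˡ _) (⊕-identityʳ _) ⟨
      (0Λ ⊕ ι a (ι b x)) ⊕ (ι b (ι a x) ⊕ 0Λ)
        ≡⟨ cong₂ (λ u v → (u ⊕ ι a (ι b x)) ⊕ (ι b (ι a x) ⊕ v)) (ι-ι a x) (ι-ι b x) ⟨
      (ι a (ι a x) ⊕ ι a (ι b x)) ⊕ (ι b (ι a x) ⊕ ι b (ι b x))
        ≡⟨ cong₂ _⊕_ (ι-⊕ a _ _) (ι-⊕ b _ _) ⟨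
      ι a (ι a x ⊕ ι b x) ⊕ ι b (ι a x ⊕ ι b x)
        ≡⟨ ι-+ a b _ ⟨
      ι a+b (ι a x ⊕ ι b x)
        ≡⟨ cong (ι a+b) (ι-+ a b x) ⟨
      ι a+b (ι a+b x)
        ≡⟨ ι-ι a+b x ⟩
      0Λ ∎

  contract : ∀ {m n} → (Fin m → Fin n → ℤ) → Λ n → Λ n
  contract {zero}  A x = x
  contract {suc m} A x = contract (A ∘ suc) (ι (A zero) x)

  contract-⊕ : ∀ {m n} (A : Fin m → Fin n → ℤ) x y →
               contract A (x ⊕ y) ≡ contract A x ⊕ contract A y
  contract-⊕ {zero}  A x y = refl
  contract-⊕ {suc m} A x y =
    trans (cong (contract (A ∘ suc)) (ι-⊕ (A zero) x y)) (contract-⊕ (A ∘ suc) _ _)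

  contract-⊙ : ∀ {m n} (A : Fin m → Fin n → ℤ) c x →
               contract A (c ⊙ x) ≡ c ⊙ contract A x
  contract-⊙ {zero}  A c x = refl
  contract-⊙ {suc m} A c x =
    trans (cong (contract (A ∘ suc)) (ι-⊙ (A zero) c x)) (contract-⊙ (A ∘ suc) c _)

  contract-0 : ∀ {m n} (A : Fin m → Fin n → ℤ) → contract A 0Λ ≡ 0Λ
  contract-0 A = trans (cong (contract A) (sym (⊙-zeroˡ 0Λ)))
    (trans (contract-⊙ A 0ℤ 0Λ) (⊙-zeroˡ _))

  contract-row : ∀ {m n} (A : Fin m → Fin n → ℤ) i x → contract A (ι (A i) x) ≡ 0Λ
  contract-row A zero    x = trans (cong (contract (A ∘ suc)) (ι-ι (A zero) x)) (contract-0 (A ∘ suc))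
  contract-row A (suc i) x = begin
    contract (A ∘ suc) (ι (A zero) (ι (A (suc i)) x))
      ≡⟨ cong (contract (A ∘ suc)) (ι-anticomm (A zero) (A (suc i)) x) ⟩
    contract (A ∘ suc) (-1ℤ ⊙ ι (A (suc i)) (ι (A zero) x))
      ≡⟨ contract-⊙ (A ∘ suc) -1ℤ _ ⟩
    -1ℤ ⊙ contract (A ∘ suc) (ι (A (suc i)) (ι (A zero) x))
      ≡⟨ cong (-1ℤ ⊙_) (contract-row (A ∘ suc) i _) ⟩
    -1ℤ ⊙ 0Λ
      ≡⟨ ⊙-zeroʳ -1ℤ ⟩
    0Λ ∎
    where open ≡-Reasoning

  -- Row operations: once `a` has been contracted, multiples of `a` in the later rows are invisible,
  -- since such a row anticommutes past ι a and its part along `a` squares to zero.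
  contract-add : ∀ {m n} (A B : Fin m → Fin n → ℤ) a (c : Fin m → ℤ) →
    (∀ i j → B i j ≡ A i j + c i * a j) → ∀ x → contract B (ι a x) ≡ contract A (ι a x)
  contract-add {zero}  A B a c eq x = refl
  contract-add {suc m} A B a c eq x = begin
    contract B′ (ι (B zero) (ι a x))
      ≡⟨ cong (contract B′) row ⟩
    contract B′ (-1ℤ ⊙ ι a (ι (A zero) x))
      ≡⟨ contract-⊙ B′ -1ℤ _ ⟩
    -1ℤ ⊙ contract B′ (ι a (ι (A zero) x))
      ≡⟨ cong (-1ℤ ⊙_) (contract-add A′ B′ a (c ∘ suc) (eq ∘ suc) _) ⟩
    -1ℤ ⊙ contract A′ (ι a (ι (A zero) x))
      ≡⟨ contract-⊙ A′ -1ℤ _ ⟨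
    contract A′ (-1ℤ ⊙ ι a (ι (A zero) x))
      ≡⟨ cong (contract A′) (ι-anticomm (A zero) a x) ⟨
    contract A′ (ι (A zero) (ι a x)) ∎
    where
    open ≡-Reasoning
    A′ = A ∘ suc
    B′ = B ∘ suc
    row : ι (B zero) (ι a x) ≡ -1ℤ ⊙ ι a (ι (A zero) x)
    row = begin
      ι (B zero) (ι a x)
        ≡⟨ trans (ι-cong (eq zero) _) (ι-+ (A zero) (λ j → c zero * a j) _) ⟩
      ι (A zero) (ι a x) ⊕ ι (λ j → c zero * a j) (ι a x)
        ≡⟨ cong (ι (A zero) (ι a x) ⊕_) (trans (ι-* (c zero) a _)
             (trans (cong (c zero ⊙_) (ι-ι a x)) (⊙-zeroʳ (c zero)))) ⟩
      ι (A zero) (ι a x) ⊕ 0Λ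
        ≡⟨ trans (⊕-identityʳ _) (ι-anticomm (A zero) a x) ⟩
      -1ℤ ⊙ ι a (ι (A zero) x) ∎

  scalar : ∀ {n} → Λ n → ℤ
  scalar {zero}  x       = x
  scalar {suc n} (x , y) = scalar x

  scalar-⊕ : ∀ {n} (x y : Λ n) → scalar (x ⊕ y) ≡ scalar x + scalar y
  scalar-⊕ {zero}  x       y       = refl
  scalar-⊕ {suc n} (x , y) (z , w) = scalar-⊕ x z

  scalar-⊙ : ∀ {n} c (x : Λ n) → scalar (c ⊙ x) ≡ c * scalar x
  scalar-⊙ {zero}  c x       = refl
  scalar-⊙ {suc n} c (x , y) = scalar-⊙ c x

  scalar-0 : ∀ n → scalar (0Λ {n}) ≡ 0ℤ
  scalar-0 zero    = refl
  scalar-0 (suc n) = scalar-0 n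

  top : ∀ {n} → Λ n
  top {zero}  = 1ℤ
  top {suc n} = 0Λ , top

  -- The inclusion of the exterior algebra on all basis vectors except the j-th one.
  embed : ∀ {n} → Fin (suc n) → Λ n → Λ (suc n)
  embed zero            x       = x , 0Λ
  embed {suc n} (suc j) (x , y) = embed j x , embed j y

  embed-0 : ∀ {n} (j : Fin (suc n)) → embed j 0Λ ≡ 0Λ
  embed-0 zero            = refl
  embed-0 {suc n} (suc j) = cong₂ _,_ (embed-0 j) (embed-0 j)

  embed-⊕ : ∀ {n} (j : Fin (suc n)) x y → embed j (x ⊕ y) ≡ embed j x ⊕ embed j y
  embed-⊕ zero            x       y       = cong (x ⊕ y ,_) (sym (⊕-identityʳ 0Λ))
  embed-⊕ {suc n} (suc j) (x , y) (z , w) = cong₂ _,_ (embed-⊕ j x z) (embed-⊕ j y w)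

  embed-⊙ : ∀ {n} (j : Fin (suc n)) c x → embed j (c ⊙ x) ≡ c ⊙ embed j x
  embed-⊙ zero            c x       = cong (c ⊙ x ,_) (sym (⊙-zeroʳ c))
  embed-⊙ {suc n} (suc j) c (x , y) = cong₂ _,_ (embed-⊙ j c x) (embed-⊙ j c y)

  scalar-embed : ∀ {n} (j : Fin (suc n)) x → scalar (embed j x) ≡ scalar x
  scalar-embed zero            x       = refl
  scalar-embed {suc n} (suc j) (x , y) = scalar-embed j x

  ι-0 : ∀ {n} (a : Fin n → ℤ) → ι a 0Λ ≡ 0Λ
  ι-0 a = trans (cong (ι a) (sym (⊙-zeroˡ 0Λ))) (trans (ι-⊙ a 0ℤ 0Λ) (⊙-zeroˡ _))

  ι-embed : ∀ {n} (a : Fin (suc n) → ℤ) j x → ι a (embed j x) ≡ embed j (ι (a ∘ punchIn j) x)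
  ι-embed a zero x = cong₂ _,_
    (trans (cong (ι (a ∘ suc) x ⊕_) (⊙-zeroʳ (a zero))) (⊕-identityʳ _))
    (trans (cong (-1ℤ ⊙_) (ι-0 (a ∘ suc))) (⊙-zeroʳ -1ℤ))
  ι-embed {suc n} a (suc j) (x , y) = cong₂ _,_
    (trans (cong₂ _⊕_ (ι-embed (a ∘ suc) j x) (sym (embed-⊙ j (a zero) y))) (sym (embed-⊕ j _ _)))
    (trans (cong (-1ℤ ⊙_) (ι-embed (a ∘ suc) j y)) (sym (embed-⊙ j -1ℤ _)))

  contract-embed : ∀ {m n} (A : Fin m → Fin (suc n) → ℤ) j x →
    contract A (embed j x) ≡ embed j (contract (λ i k → A i (punchIn j k)) x)
  contract-embed {zero}  A j x = refl
  contract-embed {suc m} A j x =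
    trans (cong (contract (A ∘ suc)) (ι-embed (A zero) j x)) (contract-embed (A ∘ suc) j _)

  sumΛ : ∀ {m n} → (Fin m → Λ n) → Λ n
  sumΛ {zero}  f = 0Λ
  sumΛ {suc m} f = f zero ⊕ sumΛ (f ∘ suc)

  sumΛ-cong : ∀ {m n} {f g : Fin m → Λ n} → (∀ i → f i ≡ g i) → sumΛ f ≡ sumΛ g
  sumΛ-cong {zero}  f≡g = refl
  sumΛ-cong {suc m} f≡g = cong₂ _⊕_ (f≡g zero) (sumΛ-cong (f≡g ∘ suc))

  sumΛ-, : ∀ {m n} (f : Fin m → Λ (suc n)) → sumΛ f ≡ (sumΛ (proj₁ ∘ f) , sumΛ (proj₂ ∘ f))
  sumΛ-, {zero}  f = refl
  sumΛ-, {suc m} f = cong (f zero ⊕_) (sumΛ-, (f ∘ suc))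

  sumΛ-⊙ : ∀ {m n} c (f : Fin m → Λ n) → c ⊙ sumΛ f ≡ sumΛ (λ i → c ⊙ f i)
  sumΛ-⊙ {zero}  c f = ⊙-zeroʳ c
  sumΛ-⊙ {suc m} c f = trans (⊙-distribˡ c _ _) (cong (c ⊙ f zero ⊕_) (sumΛ-⊙ c (f ∘ suc)))

  sumΛ-0 : ∀ m {n} → sumΛ {m} {n} (λ _ → 0Λ) ≡ 0Λ
  sumΛ-0 zero    = refl
  sumΛ-0 (suc m) = trans (⊕-identityˡ _) (sumΛ-0 m)

  ι-top : ∀ {n} (a : Fin (suc n) → ℤ) →
          ι a top ≡ sumΛ λ j → ((- 1ℤ) ^ toℕ j * a j) ⊙ embed j top
  ι-top {zero}  a = cong₂ _,_
    (trans (ℤ.+-identityˡ _) (lemma (a zero)))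
    (sym (trans (ℤ.+-identityʳ _) (ℤ.*-zeroʳ (1ℤ * a zero))))
    where
    lemma : ∀ x → x * 1ℤ ≡ 1ℤ * x * 1ℤ + 0ℤ
    lemma = solve-∀
  ι-top {suc n} a = cong₂ _,_ first second
    where
    open ≡-Reasoning
    c : Fin (suc (suc n)) → ℤ
    c j = (- 1ℤ) ^ toℕ j * a j
    tail : ∀ j → c (suc j) ⊙ embed (suc j) top ≡ (0Λ , c (suc j) ⊙ embed j top)
    tail j = cong (_, c (suc j) ⊙ embed j top) (trans (cong (c (suc j) ⊙_) (embed-0 j)) (⊙-zeroʳ _))
    first : ι (a ∘ suc) 0Λ ⊕ a zero ⊙ top ≡ c zero ⊙ top ⊕ proj₁ (sumΛ λ j → c (suc j) ⊙ embed (suc j) top)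
    first = begin
      ι (a ∘ suc) 0Λ ⊕ a zero ⊙ top
        ≡⟨ trans (cong (_⊕ a zero ⊙ top) (ι-0 (a ∘ suc))) (⊕-identityˡ _) ⟩
      a zero ⊙ top
        ≡⟨ cong (_⊙ top) (ℤ.*-identityˡ (a zero)) ⟨
      c zero ⊙ top
        ≡⟨ trans (cong (c zero ⊙ top ⊕_) (sumΛ-0 (suc n))) (⊕-identityʳ _) ⟨
      c zero ⊙ top ⊕ sumΛ {suc n} (λ _ → 0Λ)
        ≡⟨ cong (c zero ⊙ top ⊕_) (cong proj₁
             (trans (sumΛ-cong tail) (sumΛ-, λ j → 0Λ , c (suc j) ⊙ embed j top))) ⟨
      c zero ⊙ top ⊕ proj₁ (sumΛ λ j → c (suc j) ⊙ embed (suc j) top) ∎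
    second : -1ℤ ⊙ ι (a ∘ suc) top ≡ c zero ⊙ 0Λ ⊕ proj₂ (sumΛ λ j → c (suc j) ⊙ embed (suc j) top)
    second = begin
      -1ℤ ⊙ ι (a ∘ suc) top
        ≡⟨ cong (-1ℤ ⊙_) (ι-top (a ∘ suc)) ⟩
      -1ℤ ⊙ sumΛ (λ j → ((- 1ℤ) ^ toℕ j * a (suc j)) ⊙ embed j top)
        ≡⟨ sumΛ-⊙ -1ℤ (λ j → ((- 1ℤ) ^ toℕ j * a (suc j)) ⊙ embed j top) ⟩
      sumΛ (λ j → -1ℤ ⊙ (((- 1ℤ) ^ toℕ j * a (suc j)) ⊙ embed j top))
        ≡⟨ sumΛ-cong (λ j → trans (sym (⊙-assoc -1ℤ ((- 1ℤ) ^ toℕ j * a (suc j)) (embed j top)))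
             (cong (_⊙ embed j top) (sym (ℤ.*-assoc -1ℤ ((- 1ℤ) ^ toℕ j) (a (suc j)))))) ⟩
      sumΛ (λ j → c (suc j) ⊙ embed j top)
        ≡⟨ cong proj₂ (trans (sumΛ-cong tail) (sumΛ-, λ j → 0Λ , c (suc j) ⊙ embed j top)) ⟨
      proj₂ (sumΛ λ j → c (suc j) ⊙ embed (suc j) top)
        ≡⟨ trans (cong (_⊕ proj₂ (sumΛ λ j → c (suc j) ⊙ embed (suc j) top)) (⊙-zeroʳ (c zero))) (⊕-identityˡ _) ⟨
      c zero ⊙ 0Λ ⊕ proj₂ (sumΛ λ j → c (suc j) ⊙ embed (suc j) top) ∎

  scalar-contract-sumΛ : ∀ {k m n} (A : Fin m → Fin n → ℤ) (f : Fin k → Λ n) →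
    scalar (contract A (sumΛ f)) ≡ sum λ j → scalar (contract A (f j))
  scalar-contract-sumΛ {zero} {n = n} A f = trans (cong scalar (contract-0 A)) (scalar-0 n)
  scalar-contract-sumΛ {suc k} A f = trans (cong scalar (contract-⊕ A _ _))
    (trans (scalar-⊕ (contract A (f zero)) _)
      (cong (λ u → scalar (contract A (f zero)) + u) (scalar-contract-sumΛ A (f ∘ suc))))

  -- Contracting `top` with the first row gives a signed sum of top forms that omit one basis vector
  -- e_j. The later rows see such a form through `punchIn j`, which is exactly Laplace expansion
  -- along the first row.
  det-contract : ∀ {n} (A : Fin n → Fin n → ℤ) → det A ≡ scalar (contract A top)
  det-contract {zero}  A = refl
  det-contract {suc n} A = begin
    (sum λ j → (- 1ℤ) ^ toℕ j * (A zero j * det (minor j)))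
      ≡⟨ sum-cong term ⟩
    (sum λ j → scalar (contract (A ∘ suc) (((- 1ℤ) ^ toℕ j * A zero j) ⊙ embed j top)))
      ≡⟨ scalar-contract-sumΛ (A ∘ suc) (λ j → ((- 1ℤ) ^ toℕ j * A zero j) ⊙ embed j top) ⟨
    scalar (contract (A ∘ suc) (sumΛ λ j → ((- 1ℤ) ^ toℕ j * A zero j) ⊙ embed j top))
      ≡⟨ cong (scalar ∘ contract (A ∘ suc)) (ι-top (A zero)) ⟨
    scalar (contract A top) ∎
    where
    open ≡-Reasoning
    minor : Fin (suc n) → Fin n → Fin n → ℤ
    minor j i k = A (suc i) (punchIn j k)
    term : ∀ j → (- 1ℤ) ^ toℕ j * (A zero j * det (minor j)) ≡
                 scalar (contract (A ∘ suc) (((- 1ℤ) ^ toℕ j * A zero j) ⊙ embed j top))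
    term j = begin
      (- 1ℤ) ^ toℕ j * (A zero j * det (minor j))
        ≡⟨ ℤ.*-assoc ((- 1ℤ) ^ toℕ j) (A zero j) _ ⟨
      c * det (minor j)
        ≡⟨ cong (c *_) (det-contract (minor j)) ⟩
      c * scalar (contract (minor j) top)
        ≡⟨ cong (c *_) (trans (cong scalar (contract-embed (A ∘ suc) j top)) (scalar-embed j _)) ⟨
      c * scalar (contract (A ∘ suc) (embed j top))
        ≡⟨ scalar-⊙ c (contract (A ∘ suc) (embed j top)) ⟨
      scalar (c ⊙ contract (A ∘ suc) (embed j top))
        ≡⟨ cong scalar (contract-⊙ (A ∘ suc) c (embed j top)) ⟨
      scalar (contract (A ∘ suc) (c ⊙ embed j top)) ∎
      where c = (- 1ℤ) ^ toℕ j * A zero j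

-- Cramer's rule by contraction.

module _ where
  open import Data.Integer.Base using (_+_; _*_; _-_; -_)
  open import Data.Integer.Tactic.RingSolver using (solve-∀)

  sum-single : ∀ {n} (f : Fin n → ℤ) j → (∀ i → i ≢ j → f i ≡ 0ℤ) → sum f ≡ f j
  sum-single f zero    f≡0 =
    trans (cong (λ u → f zero + u) (sum-zero λ i → f≡0 (suc i) λ ())) (ℤ.+-identityʳ _)
  sum-single f (suc j) f≡0 = trans (cong₂ _+_ (f≡0 zero λ ())
      (sum-single (f ∘ suc) j λ i i≢j → f≡0 (suc i) (i≢j ∘ Fin.suc-injective)))
    (ℤ.+-identityˡ _)

  ι-sum : ∀ {m n} (d : Fin m → ℤ) (A : Fin m → Fin n → ℤ) x →
    ι (λ i → sum λ l → d l * A l i) x ≡ sumΛ λ l → d l ⊙ ι (A l) x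
  ι-sum {zero}  d A x = ι-zero x
    where
    ι-zero : ∀ {n} (x : Λ n) → ι (λ _ → 0ℤ) x ≡ 0Λ
    ι-zero x = trans (ι-* 0ℤ (λ _ → 0ℤ) x) (⊙-zeroˡ (ι (λ _ → 0ℤ) x))
  ι-sum {suc m} d A x = trans (ι-+ (λ i → d zero * A zero i) _ x)
    (cong₂ _⊕_ (ι-* (d zero) (A zero) x) (ι-sum (d ∘ suc) (A ∘ suc) x))

  contract-punchIn : ∀ {m n} (A : Fin (suc m) → Fin n → ℤ) j x →
    contract A x ≡ (- 1ℤ) ^ toℕ j ⊙ contract (A ∘ punchIn j) (ι (A j) x)
  contract-punchIn A zero    x = sym (⊙-identity _)
  contract-punchIn {suc m} A (suc j) x = begin
    contract (A ∘ suc) (ι (A zero) x)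
      ≡⟨ contract-punchIn (A ∘ suc) j _ ⟩
    s ⊙ contract B (ι (A (suc j)) (ι (A zero) x))
      ≡⟨ cong (λ u → s ⊙ contract B u) (ι-anticomm (A (suc j)) (A zero) x) ⟩
    s ⊙ contract B (-1ℤ ⊙ ι (A zero) (ι (A (suc j)) x))
      ≡⟨ cong (s ⊙_) (contract-⊙ B -1ℤ _) ⟩
    s ⊙ (-1ℤ ⊙ contract B (ι (A zero) (ι (A (suc j)) x)))
      ≡⟨ trans (⊙-comm s -1ℤ _) (sym (⊙-assoc -1ℤ s _)) ⟩
    (-1ℤ * s) ⊙ contract B (ι (A zero) (ι (A (suc j)) x)) ∎
    where
    open ≡-Reasoning
    s = (- 1ℤ) ^ toℕ j
    B = A ∘ suc ∘ punchIn j

  -- Move row j to the front and replace it by the combination of the rows with coefficients `d`.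
  -- All rows but the j-th repeat a remaining row and vanish, which leaves d j times the determinant
  -- up to sign; on the other hand the combination is a multiple of p.
  cramer : ∀ {n} (A : Fin n → Fin n → ℤ) (d q : Fin n → ℤ) p →
    (∀ i → (sum λ l → d l * A l i) ≡ q i * p) → ∀ j → p ℤ.∣ d j * det A
  cramer {suc n} A d q p eq j = ℤ.divides (s * Ψ q) (begin
    d j * det A                     ≡⟨ cong (d j *_) det-Ψ ⟩
    d j * (s * Ψ (A j))             ≡⟨ swap (d j) s (Ψ (A j)) ⟩
    s * (d j * Ψ (A j))             ≡⟨ cong (s *_) combination ⟨
    s * Ψ (λ i → sum λ l → d l * A l i)
      ≡⟨ cong (λ u → s * scalar (contract B u)) (ι-cong (λ i → trans (eq i) (ℤ.*-comm (q i) p)) top) ⟩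
    s * Ψ (λ i → p * q i)           ≡⟨ cong (s *_) (Ψ-* p q) ⟩
    s * (p * Ψ q)                   ≡⟨ move s p (Ψ q) ⟩
    s * Ψ q * p                     ∎)
    where
    open ≡-Reasoning
    B : Fin n → Fin (suc n) → ℤ
    B = A ∘ punchIn j
    s = (- 1ℤ) ^ toℕ j
    Ψ : (Fin (suc n) → ℤ) → ℤ
    Ψ a = scalar (contract B (ι a top))
    swap : ∀ a b c → a * (b * c) ≡ b * (a * c)
    swap = solve-∀
    move : ∀ a b c → a * (b * c) ≡ a * c * b
    move = solve-∀
    det-Ψ : det A ≡ s * Ψ (A j)
    det-Ψ = trans (det-contract A) (trans (cong scalar (contract-punchIn A j top))
      (scalar-⊙ s (contract B (ι (A j) top))))
    Ψ-* : ∀ c a → Ψ (λ i → c * a i) ≡ c * Ψ a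
    Ψ-* c a = trans (cong (scalar ∘ contract B) (ι-* c a top))
      (trans (cong scalar (contract-⊙ B c _)) (scalar-⊙ c (contract B (ι a top))))
    Ψ-row : ∀ l → l ≢ j → Ψ (A l) ≡ 0ℤ
    Ψ-row l l≢j = trans (cong (λ u → Ψ (A u)) (sym (Fin.punchIn-punchOut (l≢j ∘ sym))))
      (trans (cong scalar (contract-row B (Fin.punchOut (l≢j ∘ sym)) top)) (scalar-0 (suc n)))
    combination : Ψ (λ i → sum λ l → d l * A l i) ≡ d j * Ψ (A j)
    combination = begin
      Ψ (λ i → sum λ l → d l * A l i)
        ≡⟨ cong (scalar ∘ contract B) (ι-sum d A top) ⟩
      scalar (contract B (sumΛ λ l → d l ⊙ ι (A l) top))
        ≡⟨ scalar-contract-sumΛ B (λ l → d l ⊙ ι (A l) top) ⟩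
      (sum λ l → scalar (contract B (d l ⊙ ι (A l) top)))
        ≡⟨ sum-cong (λ l → trans (cong scalar (contract-⊙ B (d l) _))
             (scalar-⊙ (d l) (contract B (ι (A l) top)))) ⟩
      (sum λ l → d l * Ψ (A l))
        ≡⟨ sum-single (λ l → d l * Ψ (A l)) j (λ l l≢j →
             trans (cong (d l *_) (Ψ-row l l≢j)) (ℤ.*-zeroʳ (d l))) ⟩
      d j * Ψ (A j) ∎

  -- Congruences and divisibility by a prime

  infix 4 _≅_⟨_⟩

  record _≅_⟨_⟩ (a b : ℤ) (m : ℕ) : Set where
    constructor congruent
    field difference : + m ℤ.∣ a - b

  open _≅_⟨_⟩ public

  module _ {m : ℕ} where
    ≡⇒≅ : ∀ {a b} → a ≡ b → a ≅ b ⟨ m ⟩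
    ≡⇒≅ {a} refl = congruent (ℤ.divides 0ℤ (ℤ.+-inverseʳ a))

    ≅-refl : ∀ {a} → a ≅ a ⟨ m ⟩
    ≅-refl = ≡⇒≅ refl

    ≅-sym : ∀ {a b} → a ≅ b ⟨ m ⟩ → b ≅ a ⟨ m ⟩
    ≅-sym {a} {b} (congruent d) = congruent (subst (+ m ℤ.∣_) (lemma a b) (ℤ.∣m⇒∣-m d))
      where
      lemma : ∀ a b → - (a - b) ≡ b - a
      lemma = solve-∀

    ≅-trans : ∀ {a b c} → a ≅ b ⟨ m ⟩ → b ≅ c ⟨ m ⟩ → a ≅ c ⟨ m ⟩
    ≅-trans {a} {b} {c} (congruent d) (congruent d′) =
      congruent (subst (+ m ℤ.∣_) (lemma a b c) (ℤ.∣m∣n⇒∣m+n d d′))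
      where
      lemma : ∀ a b c → a - b + (b - c) ≡ a - c
      lemma = solve-∀

    +-≅ : ∀ {a b c d} → a ≅ b ⟨ m ⟩ → c ≅ d ⟨ m ⟩ → a + c ≅ b + d ⟨ m ⟩
    +-≅ {a} {b} {c} {d} (congruent h) (congruent h′) =
      congruent (subst (+ m ℤ.∣_) (lemma a b c d) (ℤ.∣m∣n⇒∣m+n h h′))
      where
      lemma : ∀ a b c d → a - b + (c - d) ≡ a + c - (b + d)
      lemma = solve-∀

    *-≅ : ∀ {a b c d} → a ≅ b ⟨ m ⟩ → c ≅ d ⟨ m ⟩ → a * c ≅ b * d ⟨ m ⟩
    *-≅ {a} {b} {c} {d} (congruent h) (congruent h′) =
      congruent (subst (+ m ℤ.∣_) (lemma a b c d)
        (ℤ.∣m∣n⇒∣m+n (ℤ.∣m⇒∣m*n c h) (ℤ.∣n⇒∣m*n b h′)))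
      where
      lemma : ∀ a b c d → (a - b) * c + b * (c - d) ≡ a * c - b * d
      lemma = solve-∀

    -‿≅ : ∀ {a b} → a ≅ b ⟨ m ⟩ → - a ≅ - b ⟨ m ⟩
    -‿≅ {a} {b} (congruent h) = congruent (subst (+ m ℤ.∣_) (lemma a b) (ℤ.∣m⇒∣-m h))
      where
      lemma : ∀ a b → - (a - b) ≡ - a - - b
      lemma = solve-∀

    ∣⇒≅0 : ∀ {a} → + m ℤ.∣ a → a ≅ 0ℤ ⟨ m ⟩
    ∣⇒≅0 {a} h = congruent (subst (+ m ℤ.∣_) (sym (ℤ.+-identityʳ a)) h)

    ≅0⇒∣ : ∀ {a} → a ≅ 0ℤ ⟨ m ⟩ → + m ℤ.∣ a
    ≅0⇒∣ {a} (congruent h) = subst (+ m ℤ.∣_) (ℤ.+-identityʳ a) h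

    ∣-resp : ∀ {a b} → a ≅ b ⟨ m ⟩ → + m ℤ.∣ a → + m ℤ.∣ b
    ∣-resp a≡b h = ≅0⇒∣ (≅-trans (≅-sym a≡b) (∣⇒≅0 h))

  _≅?_⟨_⟩ : ∀ a b m → Dec (a ≅ b ⟨ m ⟩)
  a ≅? b ⟨ m ⟩ = map′ congruent difference (+ m ℤ.∣? (a - b))

  modular : ℕ → RingRelation ℤᴿ ℤᴿ
  modular m = record
    { _~_ = λ a b → a ≅ b ⟨ m ⟩
    ; +-~ = +-≅
    ; *-~ = *-≅
    ; -‿~ = -‿≅
    ; 0-~ = ≅-refl
    ; 1-~ = ≅-refl
    }

  small⇒∤ : ∀ {p a} → ∣ a ∣ ℕ.< p → a ≢ 0ℤ → ¬ (+ p ℤ.∣ a)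
  small⇒∤ {p} {a} a<p a≢0 p∣a = ℕ.<⇒≱ a<p
    (ℕ.∣⇒≤ {{ℕ.≢-nonZero (a≢0 ∘ ℤ.∣i∣≡0⇒i≡0)}} (ℤ.∣⇒∣ᵤ p∣a))

  euclid : ∀ {p} → Prime p → ∀ a b → + p ℤ.∣ a * b → + p ℤ.∣ a ⊎ + p ℤ.∣ b
  euclid {p} pr a b p∣ab
    with euclidsLemma ∣ a ∣ ∣ b ∣ pr (subst (p ℕ.∣_) (ℤ.abs-* a b) (ℤ.∣⇒∣ᵤ p∣ab))
  ... | inj₁ p∣a = inj₁ (ℤ.∣ᵤ⇒∣ p∣a)
  ... | inj₂ p∣b = inj₂ (ℤ.∣ᵤ⇒∣ p∣b)

  prime∤1 : ∀ {p} → Prime p → ¬ (+ p ℤ.∣ 1ℤ)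
  prime∤1 {p} pr =
    small⇒∤ (ℕ.nonTrivial⇒n>1 p {{prime⇒nonTrivial pr}}) λ ()

  prime∤∏ : ∀ {p} → Prime p → ∀ {n} (f : Fin n → ℤ) → (∀ i → ¬ (+ p ℤ.∣ f i)) → ¬ (+ p ℤ.∣ ∏ f)
  prime∤∏ pr {zero}  f p∤f = prime∤1 pr
  prime∤∏ pr {suc n} f p∤f p∣∏ =
    [ p∤f zero , prime∤∏ pr (f ∘ suc) (p∤f ∘ suc) ]′ (euclid pr (f zero) _ p∣∏)

  -- The cofactor matrix of the arrow-shaped rows e₀ + (i + 1) eᵢ₊₁ is
  -- lower triangular with diagonal entries prime to every p > n.

  unit : ∀ {n} → Fin n → Fin n → ℤ
  unit j k = if ⌊ j Fin.≟ k ⌋ then 1ℤ else 0ℤ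

  -- A cofactor is the determinant of the matrix bordered on top by a basis vector, as only one term
  -- of the Laplace expansion survives. In this form row operations apply to it.
  cofactor-contract : ∀ {n} x (R : Fin n → Fin (suc n) → ℤ) j →
    cofactor x R j ≡ scalar (contract (charEntry x R suc) (ι (unit j) top))
  cofactor-contract {n} x R j = begin
    cofactor x R j
      ≡⟨ cong ((- 1ℤ) ^ toℕ j *_) (trans (cong (_* D j) (δ-≡ j)) (ℤ.*-identityˡ _)) ⟨
    (- 1ℤ) ^ toℕ j * (unit j j * D j)
      ≡⟨ sum-single (λ k → (- 1ℤ) ^ toℕ k * (unit j k * D k)) j (λ k k≢j →
           trans (cong (λ u → (- 1ℤ) ^ toℕ k * (u * D k)) (δ-≢ (k≢j ∘ sym)))
                 (ℤ.*-zeroʳ ((- 1ℤ) ^ toℕ k))) ⟨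
    det bordered
      ≡⟨ det-contract bordered ⟩
    scalar (contract (charEntry x R suc) (ι (unit j) top)) ∎
    where
    open ≡-Reasoning
    D : Fin (suc n) → ℤ
    D k = det λ i l → charEntry x R suc i (punchIn k l)
    bordered : Fin (suc n) → Fin (suc n) → ℤ
    bordered zero    = unit j
    bordered (suc i) = charEntry x R suc i

  -- The lower rows of x I - A for the arrow matrix, with the diagonal values x - (i + 1) abstracted
  -- to `y i`.
  arrow : ∀ {n} → (Fin n → ℤ) → Fin n → Fin (suc n) → ℤ
  arrow y i zero    = - 1ℤ
  arrow y i (suc k) = if ⌊ i Fin.≟ k ⌋ then y i else 0ℤ

  contract-arrow-zero : ∀ {n} (y : Fin n → ℤ) →
    scalar (contract (arrow y) (ι (unit zero) top)) ≡ ∏ y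
  contract-arrow-zero {n} y = trans (sym (det-contract bordered))
    (trans (det-lowerTriangular bordered lower)
      (trans (ℤ.*-identityˡ _) (∏-cong {n} λ i → δ-≡ i)))
    where
    bordered : Fin (suc n) → Fin (suc n) → ℤ
    bordered zero    = unit zero
    bordered (suc i) = arrow y i
    lower : ∀ i j → i Fin.< j → bordered i j ≡ 0ℤ
    lower zero    (suc j) i<j       = refl
    lower (suc i) (suc j) (s≤s i<j) = δ-≢ λ i≡j → ℕ.<⇒≢ i<j (cong toℕ i≡j)

  setOne : ∀ {n} → Fin n → (Fin n → ℤ) → Fin n → ℤ
  setOne j y i = if ⌊ j Fin.≟ i ⌋ then 1ℤ else y i

  -- With e_{j+1} as first row, the diagonal entry of row j may be reset to 1. Then e_{j+1} is row j
  -- plus e₀, row j contributes nothing, and the case of e₀ remains with the factor `y j` replaced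
  -- by 1.
  contract-arrow-suc : ∀ {n} (y : Fin n → ℤ) j →
    scalar (contract (arrow y) (ι (unit (suc j)) top)) ≡ ∏ (setOne j y)
  contract-arrow-suc {n} y j = begin
    scalar (contract (arrow y) (ι (unit (suc j)) top))
      ≡⟨ cong scalar (contract-add (arrow y′) (arrow y) (unit (suc j)) (λ i → y i - y′ i) change top) ⟩
    scalar (contract (arrow y′) (ι (unit (suc j)) top))
      ≡⟨ cong (scalar ∘ contract (arrow y′)) (trans (ι-cong split top) (ι-+ (arrow y′ j) (unit zero) top)) ⟩
    scalar (contract (arrow y′) (ι (arrow y′ j) top ⊕ ι (unit zero) top))
      ≡⟨ cong scalar (trans (contract-⊕ (arrow y′) _ _)
           (trans (cong (_⊕ contract (arrow y′) (ι (unit zero) top)) (contract-row (arrow y′) j top))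
                  (⊕-identityˡ _))) ⟩
    scalar (contract (arrow y′) (ι (unit zero) top))
      ≡⟨ contract-arrow-zero y′ ⟩
    ∏ y′ ∎
    where
    open ≡-Reasoning
    y′ = setOne j y
    change : ∀ i k → arrow y i k ≡ arrow y′ i k + (y i - y′ i) * unit (suc j) k
    change i zero    = sym (cong (λ u → - 1ℤ + u) (ℤ.*-zeroʳ (y i - y′ i)))
    change i (suc k) = trans (change′ i k (i Fin.≟ k) (j Fin.≟ i)) (cong
        (λ u → arrow y′ i (suc k) + (y i - y′ i) * u) (sym (δ-suc j k)))
      where
      same : ∀ a b → a ≡ b + (a - b) * 1ℤ
      same = solve-∀
      other : ∀ a → 0ℤ ≡ 0ℤ + a * 0ℤ
      other = solve-∀
      unchanged : ∀ c a b → c ≡ c + (a - a) * b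
      unchanged = solve-∀
      change′ : ∀ i k → Dec (i ≡ k) → Dec (j ≡ i) →
        arrow y i (suc k) ≡ arrow y′ i (suc k) + (y i - y′ i) * unit j k
      change′ i .i (yes refl) (yes refl) = trans (δ-≡ i) (trans (same (y i) (y′ i))
        (sym (cong₂ (λ u v → u + (y i - y′ i) * v) (δ-≡ i) (δ-≡ i))))
      change′ i k (no i≢k) (yes refl) = trans (δ-≢ i≢k) (trans (other (y i - y′ i))
        (sym (cong₂ (λ u v → u + (y i - y′ i) * v) (δ-≢ i≢k) (δ-≢ i≢k))))
      change′ i k _ (no j≢i) = trans (unchanged (arrow y i (suc k)) (y i) (unit j k))
        (cong (λ u → (if ⌊ i Fin.≟ k ⌋ then u else 0ℤ) + (y i - u) * unit j k) (sym (δ-≢ j≢i)))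
    split : ∀ k → unit (suc j) k ≡ arrow y′ j k + unit zero k
    split zero    = refl
    split (suc k) = trans (δ-suc j k) (trans
      (cong (λ u → if ⌊ j Fin.≟ k ⌋ then u else 0ℤ) (sym (δ-≡ j)))
      (sym (ℤ.+-identityʳ _)))

  arrowRows : ∀ {n} → Fin n → Fin (suc n) → ℤ
  arrowRows i zero    = 1ℤ
  arrowRows i (suc k) = if ⌊ i Fin.≟ k ⌋ then + suc (toℕ i) else 0ℤ

  arrowRows-charEntry : ∀ {n} x i k →
    charEntry x (arrowRows {n}) suc i k ≡ arrow (λ i → x - + suc (toℕ i)) i k
  arrowRows-charEntry x i zero    = refl
  arrowRows-charEntry x i (suc k) with i Fin.≟ k
  ... | yes _ = refl
  ... | no _  = refl

  contract-cong : ∀ {m n} {A B : Fin m → Fin n → ℤ} → (∀ i j → A i j ≡ B i j) →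
                  ∀ x → contract A x ≡ contract B x
  contract-cong {zero}  A≡B x = refl
  contract-cong {suc m} {A = A} {B} A≡B x =
    trans (cong (contract (A ∘ suc)) (ι-cong (A≡B zero) x)) (contract-cong (A≡B ∘ suc) _)

  points : ∀ {n} → Fin n → ℤ
  points i = + toℕ i

  -- As functions of x the cofactors are the nodal polynomial of the nodes 1, ..., n and the
  -- unnormalised Lagrange basis polynomials at these nodes. At the points 0, ..., n the former
  -- vanishes except at 0, and the basis polynomial of a node vanishes except at 0 and at that node.
  -- The diagonal factors that remain are nonzero differences of integers in [0 , n], or 1.
  prime∤det-arrow : ∀ {n p} → Prime p → suc n ℕ.≤ p →
    ¬ (+ p ℤ.∣ det (cofactorMatrix points (arrowRows {n})))
  prime∤det-arrow {n} {p} pr n<p p∣det =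
    prime∤∏ pr (λ i → K i i) diagonal
      (subst (+ p ℤ.∣_) (det-lowerTriangular K lower) p∣det)
    where
    K : Fin (suc n) → Fin (suc n) → ℤ
    K = cofactorMatrix points arrowRows
    y : Fin (suc n) → Fin n → ℤ
    y i l = points i - + suc (toℕ l)
    K-zero : ∀ i → K zero i ≡ ∏ (y i)
    K-zero i = trans (cofactor-contract {n} (points i) arrowRows zero)
      (trans (cong (scalar {suc n})
        (contract-cong (arrowRows-charEntry (points i)) (ι (unit {suc n} zero) top)))
        (contract-arrow-zero (y i)))
    K-suc : ∀ j i → K (suc j) i ≡ ∏ (setOne j (y i))
    K-suc j i = trans (cofactor-contract (points i) arrowRows (suc j))
      (trans (cong (scalar {suc n})
        (contract-cong (arrowRows-charEntry (points i)) (ι (unit {suc n} (suc j)) top)))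
        (contract-arrow-suc (y i) j))
    ∏-zero : ∀ {n} (f : Fin n → ℤ) i → f i ≡ 0ℤ → ∏ f ≡ 0ℤ
    ∏-zero f zero    f≡0 = cong (_* ∏ (f ∘ suc)) f≡0
    ∏-zero f (suc i) f≡0 = trans (cong (f zero *_) (∏-zero (f ∘ suc) i f≡0)) (ℤ.*-zeroʳ (f zero))
    lower : ∀ j i → j Fin.< i → K j i ≡ 0ℤ
    lower zero    (suc i) j<i = trans (K-zero (suc i)) (∏-zero (y (suc i)) i (ℤ.+-inverseʳ (+ suc (toℕ i))))
    lower (suc j) (suc i) (s≤s j<i) = trans (K-suc j (suc i)) (∏-zero _ i
      (trans (δ-≢ λ j≡i → ℕ.<⇒≢ j<i (cong toℕ j≡i)) (ℤ.+-inverseʳ (+ suc (toℕ i)))))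
    y-unit : ∀ i l → i ≢ suc l → ¬ (+ p ℤ.∣ y i l)
    y-unit i l i≢ = small⇒∤ bound λ y≡0 →
      i≢ (Fin.toℕ-injective (ℤ.+-injective (ℤ.i-j≡0⇒i≡j _ _ y≡0)))
      where
      bound : ∣ y i l ∣ ℕ.< p
      bound = subst (ℕ._< p) (cong ∣_∣ (sym (ℤ.m-n≡m⊖n (toℕ i) (suc (toℕ l)))))
        (ℕ.≤-<-trans (ℤ.∣m⊝n∣≤m⊔n (toℕ i) (suc (toℕ l)))
          (ℕ.≤-trans (ℕ.⊔-lub (Fin.toℕ<n i) (s≤s (Fin.toℕ<n l))) n<p))
    diagonal : ∀ i → ¬ (+ p ℤ.∣ K i i)
    diagonal zero = subst (λ u → ¬ (+ p ℤ.∣ u)) (sym (K-zero zero))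
      (prime∤∏ pr (y zero) λ l → y-unit zero l λ ())
    diagonal (suc j) = subst (λ u → ¬ (+ p ℤ.∣ u)) (sym (K-suc j (suc j)))
      (prime∤∏ pr (setOne j (y (suc j))) factor)
      where
      factor : ∀ l → ¬ (+ p ℤ.∣ setOne j (y (suc j)) l)
      factor l with j Fin.≟ l
      ... | yes _  = prime∤1 pr
      ... | no j≢l = y-unit (suc j) l (j≢l ∘ Fin.suc-injective)

-- Characteristic polynomials and their factorisations

module _ where
  open import Data.Integer.Base using (_+_; _*_; _-_; -_)
  open import Data.Integer.Tactic.RingSolver using (solve-∀)
  open import Algebra.Definitions.RawSemiring ℤ[X].rawSemiring using ()
    renaming (sum to sumₚ; _^_ to _^ₚ_)
  open Determinant ℤ[X] using () renaming (det to detₚ)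

  negₚ : Poly → Poly
  negₚ = map (λ a → - a)

  eval-neg : ∀ p x → eval (negₚ p) x ≡ - eval p x
  eval-neg []      x = refl
  eval-neg (a ∷ p) x = trans (cong (λ u → - a + x * u) (eval-neg p x)) (lemma a x _)
    where
    lemma : ∀ a x u → - a + x * - u ≡ - (a + x * u)
    lemma = solve-∀

  eval-const : ∀ a x → eval (const a) x ≡ a
  eval-const a x = trans (cong (λ u → a + u) (ℤ.*-zeroʳ x)) (ℤ.+-identityʳ a)

  eval-X : ∀ x → eval X x ≡ x
  eval-X = lemma
    where
    lemma : ∀ x → 0ℤ + x * (1ℤ + x * 0ℤ) ≡ x
    lemma = solve-∀

  evaluation : ℤ → RingRelation ℤ[X] ℤᴿ
  evaluation x = record
    { _~_ = λ p a → eval p x ≡ a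
    ; +-~ = λ {p} {_} {q} p~a q~b → trans (eval-+ p q x) (cong₂ _+_ p~a q~b)
    ; *-~ = λ {p} {_} {q} p~a q~b → trans (eval-* p q x) (cong₂ _*_ p~a q~b)
    ; -‿~ = λ {p} p~a → trans (eval-neg p x) (cong (λ a → - a) p~a)
    ; 0-~ = refl
    ; 1-~ = eval-const 1ℤ x
    }

  charValue : ∀ {n} → Matrix n → ℤ → ℤ
  charValue A x = det (charEntry x (entry A) id)

  eval-charPoly : ∀ {n} (A : Matrix n) x → eval (charPoly A) x ≡ charValue A x
  eval-charPoly A x = RingRelation.det-~ (evaluation x) λ i j →
    charEntry-~ (evaluation x) {A = λ i j → const (entry A i j)} {entry A} id i j
      (eval-X x) (eval-const (entry A i j) x)

  -- A degree bound together with the coefficient at the bound. As `a` may be 0, the notion is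
  -- closed under sums and products with no condition on cancellation.
  Top : ℕ → Poly → ℤ → Set
  Top d p a = (∀ i → d ℕ.< i → coeff p i ≡ 0ℤ) × coeff p d ≡ a

  Top-+ : ∀ {d p q a b} → Top d p a → Top d q b → Top d (p +ₚ q) (a + b)
  Top-+ {p = p} {q} (above , at) (above′ , at′) =
    (λ i d<i → trans (coeff-+ p q i) (cong₂ _+_ (above i d<i) (above′ i d<i))) ,
    trans (coeff-+ p q _) (cong₂ _+_ at at′)

  Top-* : ∀ {d e p q a b} → Top d p a → Top e q b → Top (d ℕ.+ e) (p *ₚ q) (a * b)
  Top-* {d} {e} {p} {q} (above , at) (above′ , at′) =
    above″ , trans (coeff-*-top d e p q above above′) (cong₂ _*_ at at′)
    where
    above″ : ∀ i → d ℕ.+ e ℕ.< i → coeff (p *ₚ q) i ≡ 0ℤ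
    above″ i lt = begin
      coeff (p *ₚ q) i              ≡⟨ cong (coeff (p *ₚ q)) (ℕ.m∸n+n≡m e≤i) ⟨
      coeff (p *ₚ q) (d′ ℕ.+ e)     ≡⟨ coeff-*-top d′ e p q (λ j d′<j → above j (ℕ.<-trans d<d′ d′<j)) above′ ⟩
      coeff p d′ * coeff q e        ≡⟨ cong (_* coeff q e) (above d′ d<d′) ⟩
      0ℤ                            ∎
      where
      open ≡-Reasoning
      d′ = i ℕ.∸ e
      e≤i : e ℕ.≤ i
      e≤i = ℕ.≤-trans (ℕ.m≤n+m e d) (ℕ.<⇒≤ lt)
      d<d′ : d ℕ.< d′
      d<d′ = ℕ.m+n≤o⇒m≤o∸n (suc d) lt

  Top-0 : ∀ d → Top d [] 0ℤ
  Top-0 d = (λ _ _ → refl) , refl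

  Top-const : ∀ a → Top 0 (const a) a
  Top-const a = (λ { (suc i) _ → refl }) , refl

  Top-sum : ∀ {d n} {p : Fin n → Poly} {a : Fin n → ℤ} →
            (∀ i → Top d (p i) (a i)) → Top d (sumₚ p) (sum a)
  Top-sum {d} {zero}  tops = Top-0 d
  Top-sum {n = suc n} {p} {a} tops =
    Top-+ {p = p zero} {sumₚ (p ∘ suc)} (tops zero) (Top-sum (tops ∘ suc))

  Top-sgn : ∀ k → Top 0 ((ℤ[X].- ℤ[X].1#) ^ₚ k) ((- 1ℤ) ^ k)
  Top-sgn zero    = Top-const 1ℤ
  Top-sgn (suc k) = Top-* {0} {0} {ℤ[X].- ℤ[X].1#} {(ℤ[X].- ℤ[X].1#) ^ₚ k}
    (Top-const (- 1ℤ)) (Top-sgn k)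

  Top-det : ∀ {n} e {A : Fin n → Fin n → Poly} {a : Fin n → Fin n → ℤ} →
            (∀ i j → Top e (A i j) (a i j)) → Top (n ℕ.* e) (detₚ A) (det a)
  Top-det {zero}  e tops = Top-const 1ℤ
  Top-det {suc n} e {A} {a} tops = Top-sum
    {p = λ j → (ℤ[X].- ℤ[X].1#) ^ₚ toℕ j *ₚ (A zero j *ₚ detₚ (λ i k → A (suc i) (punchIn j k)))}
    {a = λ j → (- 1ℤ) ^ toℕ j * (a zero j * det (λ i k → a (suc i) (punchIn j k)))}
    λ j →
    Top-* {0} {e ℕ.+ n ℕ.* e} {(ℤ[X].- ℤ[X].1#) ^ₚ toℕ j}
          {A zero j *ₚ detₚ (λ i k → A (suc i) (punchIn j k))}
      (Top-sgn (toℕ j))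
      (Top-* {e} {n ℕ.* e} {A zero j} {detₚ (λ i k → A (suc i) (punchIn j k))}
        (tops zero j) (Top-det e λ i k → tops (suc i) (punchIn j k)))

  charPoly-monic : ∀ {n} (A : Matrix n) → Top n (charPoly A) 1ℤ
  charPoly-monic {n} A = subst₂ (λ d a → Top d (charPoly A) a) (ℕ.*-identityʳ n) det-1
    (Top-det 1 {a = λ i j → if ⌊ i Fin.≟ j ⌋ then 1ℤ else 0ℤ} λ i j → entry-top i j)
    where
    entry-top : ∀ i j → Top 1 ((if ⌊ i Fin.≟ j ⌋ then X else []) +ₚ negₚ (const (entry A i j)))
                              (if ⌊ i Fin.≟ j ⌋ then 1ℤ else 0ℤ)
    entry-top i j with i Fin.≟ j
    ... | yes _ = (λ { (suc (suc i)) _ → refl ; (suc zero) (s≤s ()) }) , refl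
    ... | no _  = (λ { (suc i) _ → refl }) , refl
    det-1 : det (λ (i j : Fin n) → if ⌊ i Fin.≟ j ⌋ then 1ℤ else 0ℤ) ≡ 1ℤ
    det-1 = trans (det-lowerTriangular {n} _ λ i j i<j → δ-≢ λ i≡j → ℕ.<⇒≢ i<j (cong toℕ i≡j))
      (trans (∏-cong {n} λ i → δ-≡ i) (∏-1 n))

  -- c₀ + c₁ x + … + cₖ₋₁ xᵏ⁻¹ + xᵏ
  evalMonic : ∀ {k} → Vec ℤ k → ℤ → ℤ
  evalMonic []      x = 1ℤ
  evalMonic (c ∷ g) x = c + x * evalMonic g x

  monic-vec : ∀ k p → Top k p 1ℤ → ∃ λ (g : Vec ℤ k) → ∀ x → evalMonic g x ≡ eval p x
  monic-vec zero    []      (_ , ())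
  monic-vec zero    (a ∷ p) (above , at) = [] , λ x → sym
    (trans (cong₂ (λ u v → u + x * v) at (eval-0 p x λ i → above (suc i) z<s))
           (eval-const 1ℤ x))
  monic-vec (suc k) []      (_ , ())
  monic-vec (suc k) (a ∷ p) (above , at)
    with monic-vec k p ((λ i k<i → above (suc i) (s≤s k<i)) , at)
  ... | g , eq = a ∷ g , λ x → cong (λ u → a + x * u) (eq x)

  Split : ∀ {n} → ℕ → ℕ → Matrix n → Set
  Split k l A = ∃₂ λ (g : Vec ℤ k) (h : Vec ℤ l) → ∀ x → charValue A x ≡ evalMonic g x * evalMonic h x

  constant-unit : ∀ g → HasDegree 0 g → coeff g 0 * coeff g 0 ≡ 1ℤ →
                  (const (coeff g 0) *ₚ g) ≈ const 1ℤ
  constant-unit g (_ , above) square zero = trans (coeff-* (coeff g 0) [] g 0)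
    (trans (ℤ.+-identityʳ _) square)
  constant-unit g (_ , above) square (suc i) = trans (coeff-* (coeff g 0) [] g (suc i))
    (trans (cong (λ u → coeff g 0 * u + 0ℤ) (above (suc i) z<s))
      (trans (ℤ.+-identityʳ _) (ℤ.*-zeroʳ (coeff g 0))))

  i*j≡1⇒i*i≡1 : ∀ i j → i * j ≡ 1ℤ → i * i ≡ 1ℤ
  i*j≡1⇒i*i≡1 i j ij≡1 = trans (sym ∣i∣²≡i²) (cong (λ u → + u * + u) ∣i∣≡1)
    where
    lemma : ∀ i → - i * - i ≡ i * i
    lemma = solve-∀
    ∣i∣²≡i² : + ∣ i ∣ * + ∣ i ∣ ≡ i * i
    ∣i∣²≡i² with ℤ.+∣i∣≡i⊎+∣i∣≡-i i
    ... | inj₁ eq = cong₂ _*_ eq eq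
    ... | inj₂ eq = trans (cong₂ _*_ eq eq) (lemma i)
    ∣i∣≡1 : ∣ i ∣ ≡ 1
    ∣i∣≡1 = ℕ.m*n≡1⇒m≡1 ∣ i ∣ ∣ j ∣ (trans (sym (ℤ.abs-* i j)) (cong ∣_∣ ij≡1))

  reducible⇒split : ∀ {n} (A : Matrix n) → Reducible (charPoly A) →
    ∃₂ λ k l → suc k ℕ.+ suc l ≡ n × Split (suc k) (suc l) A
  reducible⇒split {n} A (f≉0 , g , h , f≈gh , g∤1 , h∤1) with degree g | degree h
  ... | inj₁ g≈0 | _        = ⊥-elim (f≉0 λ i → trans (f≈gh i) (*-zeroˡ g h g≈0 i))
  ... | inj₂ _   | inj₁ h≈0 = ⊥-elim (f≉0 λ i → trans (f≈gh i) (*-zeroʳ g h h≈0 i))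
  ... | inj₂ (d , deg-g) | inj₂ (e , deg-h) = conclude d e deg-g deg-h d+e≡n
      (trans (sym (proj₂ top-gh)) (trans (cong (coeff (charPoly A)) d+e≡n) (proj₂ (charPoly-monic A))))
    where
    top-gh : Top (d ℕ.+ e) (charPoly A) (coeff g d * coeff h e)
    top-gh with Top-* {p = g} {h} (proj₂ deg-g , refl) (proj₂ deg-h , refl)
    ... | above , at = (λ i lt → trans (f≈gh i) (above i lt)) , trans (f≈gh _) at
    d+e≡n : d ℕ.+ e ≡ n
    d+e≡n with ℕ.<-cmp (d ℕ.+ e) n
    ... | tri≈ _ eq _ = eq
    ... | tri< lt _ _ with trans (sym (proj₂ (charPoly-monic A))) (proj₁ top-gh n lt)
    ...   | ()
    d+e≡n | tri> _ _ gt
      with ℤ.i*j≡0⇒i≡0∨j≡0 (coeff g d)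
             (trans (sym (proj₂ top-gh)) (proj₁ (charPoly-monic A) (d ℕ.+ e) gt))
    ...   | inj₁ g≡0 = ⊥-elim (proj₁ deg-g g≡0)
    ...   | inj₂ h≡0 = ⊥-elim (proj₁ deg-h h≡0)

    conclude : ∀ d e → HasDegree d g → HasDegree e h → d ℕ.+ e ≡ n → coeff g d * coeff h e ≡ 1ℤ →
      ∃₂ λ k l → suc k ℕ.+ suc l ≡ n × Split (suc k) (suc l) A
    -- The leading coefficients have product 1, so a factor of degree 0 is 1 or -1, hence a unit.
    conclude zero    e       deg-g deg-h _   leads≡1 = ⊥-elim (g∤1
      (const (coeff g 0) by constant-unit g deg-g (i*j≡1⇒i*i≡1 (coeff g 0) (coeff h e) leads≡1)))
    conclude (suc k) zero    deg-g deg-h _   leads≡1 = ⊥-elim (h∤1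
      (const (coeff h 0) by constant-unit h deg-h
        (i*j≡1⇒i*i≡1 (coeff h 0) (coeff g (suc k)) (trans (ℤ.*-comm (coeff h 0) _) leads≡1))))
    conclude (suc k) (suc l) deg-g deg-h k+l leads≡1 = k , l , k+l , proj₁ g′ , proj₁ h′ , values
      where
      -- Both factors are scaled by the leading coefficient of `g`. The product keeps its value
      -- because s² = 1, and `h` becomes monic because the two leading coefficients multiply to 1.
      s = coeff g (suc k)
      s²≡1 : s * s ≡ 1ℤ
      s²≡1 = i*j≡1⇒i*i≡1 s _ leads≡1
      scaled : ∀ d p → HasDegree d p → s * coeff p d ≡ 1ℤ → Top d (s ·ₚ p) 1ℤ
      scaled d p (_ , above) lead =
        (λ i d<i → trans (coeff-· s p i) (trans (cong (s *_) (above i d<i)) (ℤ.*-zeroʳ s))) ,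
        trans (coeff-· s p d) lead
      g′ = monic-vec (suc k) (s ·ₚ g) (scaled (suc k) g deg-g s²≡1)
      h′ = monic-vec (suc l) (s ·ₚ h) (scaled (suc l) h deg-h leads≡1)
      lemma : ∀ s u v → (s * u) * (s * v) ≡ (s * s) * (u * v)
      lemma = solve-∀
      values : ∀ x → charValue A x ≡ evalMonic (proj₁ g′) x * evalMonic (proj₁ h′) x
      values x = begin
        charValue A x                      ≡⟨ eval-charPoly A x ⟨
        eval (charPoly A) x                ≡⟨ eval-cong {charPoly A} {g *ₚ h} x f≈gh ⟩
        eval (g *ₚ h) x                    ≡⟨ eval-* g h x ⟩
        eval g x * eval h x                ≡⟨ ℤ.*-identityˡ _ ⟨
        1ℤ * (eval g x * eval h x)         ≡⟨ cong (_* (eval g x * eval h x)) s²≡1 ⟨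
        (s * s) * (eval g x * eval h x)    ≡⟨ lemma s (eval g x) (eval h x) ⟨
        (s * eval g x) * (s * eval h x)    ≡⟨ cong₂ _*_ (eval-· s g x) (eval-· s h x) ⟨
        eval (s ·ₚ g) x * eval (s ·ₚ h) x  ≡⟨ cong₂ _*_ (proj₂ g′ x) (proj₂ h′ x) ⟨
        evalMonic (proj₁ g′) x * evalMonic (proj₁ h′) x ∎
        where open ≡-Reasoning

  -- Lagrange's bound on the number of roots modulo a prime

  Distinct : ℕ → List ℤ → Set
  Distinct m = AllPairs λ a b → ¬ (a ≅ b ⟨ m ⟩)

  -- Synthetic division by X - m: modulo p the quotient vanishes at the other roots, because their
  -- differences from m are prime to p. By induction all its coefficients are divisible by p, and
  -- the recurrence `coeff-quo` carries this back to the dividend.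
  lagrange : ∀ {p} → Prime p → ∀ f xs → length f ≤ length xs → Distinct p xs →
    All (λ x → + p ℤ.∣ eval f x) xs → ∀ i → + p ℤ.∣ coeff f i
  lagrange {p} pr []      xs       len distinct roots i = ℤ.divides 0ℤ refl
  lagrange {p} pr (a ∷ f) (m ∷ xs) (s≤s len) (m≢ ∷ distinct) (m-root ∷ roots) = coeffs
    where
    quo-roots : ∀ {ys} → All (λ x → ¬ (m ≅ x ⟨ p ⟩)) ys → All (λ x → + p ℤ.∣ eval (a ∷ f) x) ys →
                All (λ x → + p ℤ.∣ eval (quo m f) x) ys
    quo-roots []            []         = []
    quo-roots {x ∷ _} (m≢x ∷ m≢) (x-root ∷ roots) =
      [ (λ d → ⊥-elim (m≢x (≅-sym (congruent d)))) , id ]′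
        (euclid pr (x - m) (eval (quo m f) x)
          (ℤ.∣m+n∣m⇒∣n (subst (+ p ℤ.∣_) (eval-quo m a f x) x-root) m-root))
      ∷ quo-roots m≢ roots
    quo-coeffs : ∀ i → + p ℤ.∣ coeff (quo m f) i
    quo-coeffs = lagrange pr (quo m f) xs
      (ℕ.≤-trans (ℕ.≤-reflexive (length-quo m f)) len) distinct (quo-roots m≢ roots)
    coeffs : ∀ i → + p ℤ.∣ coeff (a ∷ f) i
    coeffs zero    = ℤ.∣m+n∣n⇒∣m {m = a} m-root
      (ℤ.∣n⇒∣m*n m (subst (+ p ℤ.∣_) (coeff-quo-0 m f) (quo-coeffs 0)))
    coeffs (suc i) = ℤ.∣m+n∣n⇒∣m {m = coeff f i} (subst (+ p ℤ.∣_) (coeff-quo m f i) (quo-coeffs i))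
      (ℤ.∣n⇒∣m*n m (quo-coeffs (suc i)))

  root-count : ∀ {p} → Prime p → ∀ d f → length f ≤ suc d → ∀ i → ¬ (+ p ℤ.∣ coeff f i) →
    ∀ xs → Distinct p xs → ∑ xs (λ x → 𝟙 (+ p ℤ.∣? eval f x)) ≤ d
  root-count {p} pr d f len i p∤ xs distinct with ∑ xs (λ x → 𝟙 (+ p ℤ.∣? eval f x)) ℕ.≤? d
  ... | yes le = le
  ... | no ≰d  = ⊥-elim (p∤ (lagrange pr f (filter root? xs)
      (ℕ.≤-trans len (subst (suc d ℕ.≤_) (sym (length-filter-∑ root? xs)) (ℕ.≰⇒> ≰d)))
      (AllPairs.filter⁺ root? distinct) (All.all-filter root? xs) i))
    where
    root? : Decidable (λ x → + p ℤ.∣ eval f x)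
    root? x = + p ℤ.∣? eval f x

-- Residues

module _ where
  open import Data.Integer.Base using (_+_; _*_; _-_; -_)
  open import Data.Integer.Tactic.RingSolver using (solve-∀)

  res : ℕ → List ℤ
  res m = map +_ (upTo m)

  length-res : ∀ m → length (res m) ≡ m
  length-res m = trans (List.length-map +_ (upTo m)) (List.length-upTo m)

  res-unique : ∀ m → Unique (res m)
  res-unique m = Unique.map⁺ ℤ.+-injective (Unique.upTo⁺ m)

  ∈-res : ∀ {m k} → k ℕ.< m → + k ∈ res m
  ∈-res k<m = ∈-map⁺ +_ (∈-upTo⁺ k<m)

  ∈-res⁻ : ∀ {m a} → a ∈ res m → ∃ λ k → k ℕ.< m × a ≡ + k
  ∈-res⁻ a∈ with ∈-map⁻ +_ a∈
  ... | k , k∈ , a≡k = k , ∈-upTo⁻ k∈ , a≡k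

  res-cancel : ∀ {m a b} → a ∈ res m → b ∈ res m → a ≅ b ⟨ m ⟩ → a ≡ b
  res-cancel {m} a∈ b∈ (congruent m∣a-b) with ∈-res⁻ a∈ | ∈-res⁻ b∈
  ... | k , k<m , refl | l , l<m , refl with + k ℤ.≟ + l
  ...   | yes k≡l = k≡l
  ...   | no k≢l  = ⊥-elim (small⇒∤ bound (k≢l ∘ ℤ.i-j≡0⇒i≡j _ _) m∣a-b)
    where
    bound : ∣ + k - + l ∣ ℕ.< m
    bound = subst (ℕ._< m) (cong ∣_∣ (sym (ℤ.m-n≡m⊖n k l)))
      (ℕ.≤-<-trans (ℤ.∣m⊝n∣≤m⊔n k l) (ℕ.⊔-lub k<m l<m))

  res-distinct : ∀ {m xs} → Unique xs → (∀ {x} → x ∈ xs → x ∈ res m) → Distinct m xs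
  res-distinct []             xs⊆ = []
  res-distinct (x≢ ∷ unique) xs⊆ =
    All.tabulate (λ y∈ x≅y → All.lookup x≢ y∈ (res-cancel (xs⊆ (here refl)) (xs⊆ (there y∈)) x≅y))
    ∷ res-distinct unique (xs⊆ ∘ there)

  canon : ∀ m → .{{NonZero m}} → ℤ → ℤ
  canon m a = + (a ℤ.%ℕ m)

  canon∈ : ∀ m → .{{_ : NonZero m}} → ∀ a → canon m a ∈ res m
  canon∈ m a = ∈-res (ℤ.n%ℕd<d a m)

  canon-≅ : ∀ m → .{{_ : NonZero m}} → ∀ a → canon m a ≅ a ⟨ m ⟩
  canon-≅ m a = ≅-sym (congruent (ℤ.divides (a ℤ./ℕ m)
    (trans (cong (_- canon m a) (ℤ.a≡a%ℕn+[a/ℕn]*n a m)) (lemma (canon m a) _))))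
    where
    lemma : ∀ r q → r + q - r ≡ q
    lemma = solve-∀

  affine : ℤ → ℤ → ℤ → ℤ
  affine c y z = y + c * z

  -- The cancellation hypothesis makes z ↦ y + c z injective on residues. The inequality needs no
  -- more than that.
  ∑-affine : ∀ m → .{{_ : NonZero m}} → ∀ c → (∀ a → + m ℤ.∣ c * a → + m ℤ.∣ a) →
    ∀ y f → Respects (λ a b → a ≅ b ⟨ m ⟩) f → ∑ (res m) (f ∘ affine c y) ≤ ∑ (res m) f
  ∑-affine m c cancel y f resp = ℕ.≤-trans
    (ℕ.≤-reflexive (∑-cong (res m) λ z → sym (resp (canon-≅ m (affine c y z)))))
    (∑-injection (canon m ∘ affine c y) f (res-unique m) (λ {z} _ → canon∈ m (affine c y z))
      λ {z} {w} z∈ w∈ eq → res-cancel z∈ w∈ (congruent (cancel (z - w)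
        (subst (+ m ℤ.∣_) (lemma y c z w) (difference
          (≅-trans (≅-sym (canon-≅ m (affine c y z)))
            (≅-trans (≡⇒≅ eq) (canon-≅ m (affine c y w)))))))))
    where
    lemma : ∀ y c z w → y + c * z - (y + c * w) ≡ c * (z - w)
    lemma = solve-∀

  ∑-applyUpTo : ∀ {A : Set} (f : ℕ → A) n g → ∑ (List.applyUpTo f n) g ≡ ∑ (upTo n) (g ∘ f)
  ∑-applyUpTo f n g = trans (cong (λ xs → ∑ xs g) (sym (List.map-upTo f n))) (∑-map f (upTo n) g)

  ∑-applyUpTo-+ : ∀ {A : Set} (f : ℕ → A) m n g →
    ∑ (List.applyUpTo f (m ℕ.+ n)) g ≡ ∑ (List.applyUpTo f m) g ℕ.+ ∑ (List.applyUpTo (f ∘ (m ℕ.+_)) n) g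
  ∑-applyUpTo-+ f zero    n g = refl
  ∑-applyUpTo-+ f (suc m) n g = trans (cong (g (f 0) ℕ.+_) (∑-applyUpTo-+ (f ∘ suc) m n g))
    (sym (ℕ.+-assoc (g (f 0)) _ _))

  ∑-upTo-* : ∀ {A : Set} (f : ℕ → A) m q g → ∑ (List.applyUpTo f (q ℕ.* m)) g ≡
    ∑ (upTo q) λ z → ∑ (upTo m) λ y → g (f (z ℕ.* m ℕ.+ y))
  ∑-upTo-* f m zero    g = refl
  ∑-upTo-* f m (suc q) g = trans (∑-applyUpTo-+ f m (q ℕ.* m) g) (cong₂ ℕ._+_
    (∑-applyUpTo f m g)
    (trans (∑-upTo-* (f ∘ (m ℕ.+_)) m q g)
      (trans (∑-cong (upTo q) λ z → ∑-cong (upTo m) λ y →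
               cong (g ∘ f) (sym (ℕ.+-assoc m (z ℕ.* m) y)))
             (sym (∑-applyUpTo suc q λ z → ∑ (upTo m) λ y → g (f (z ℕ.* m ℕ.+ y)))))))

  -- Expansion in mixed radix. The low digit y is the residue modulo m, so a function of period m
  -- does not see z.
  ∑-res-* : ∀ m q f →
    ∑ (res (m ℕ.* q)) f ≡ ∑ (res m) λ y → ∑ (res q) λ z → f (affine (+ m) y z)
  ∑-res-* m q f = begin
    ∑ (res (m ℕ.* q)) f
      ≡⟨ cong (λ k → ∑ (res k) f) (ℕ.*-comm m q) ⟩
    ∑ (res (q ℕ.* m)) f
      ≡⟨ trans (∑-map +_ (upTo (q ℕ.* m)) f) (∑-upTo-* id m q (f ∘ +_)) ⟩
    (∑ (upTo q) λ z → ∑ (upTo m) λ y → f (+ (z ℕ.* m ℕ.+ y)))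
      ≡⟨ ∑-swap (upTo q) (upTo m) _ ⟩
    (∑ (upTo m) λ y → ∑ (upTo q) λ z → f (+ (z ℕ.* m ℕ.+ y)))
      ≡⟨ ∑-cong (upTo m) (λ y → ∑-cong (upTo q) λ z → cong f (digits y z)) ⟩
    (∑ (upTo m) λ y → ∑ (upTo q) λ z → f (affine (+ m) (+ y) (+ z)))
      ≡⟨ trans (∑-map +_ (upTo m) _) (∑-cong (upTo m) λ y → ∑-map +_ (upTo q) _) ⟨
    (∑ (res m) λ y → ∑ (res q) λ z → f (affine (+ m) y z)) ∎
    where
    open ≡-Reasoning
    digits : ∀ y z → + (z ℕ.* m ℕ.+ y) ≡ + y + + m * + z
    digits y z = trans (ℤ.pos-+ (z ℕ.* m) y) (trans (ℤ.+-comm (+ (z ℕ.* m)) (+ y))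
      (cong (λ u → + y + u) (trans (ℤ.pos-* z m) (ℤ.*-comm (+ z) (+ m)))))

  -- Monic polynomials modulo a prime

  infix 4 _≅ⱽ_⟨_⟩

  _≅ⱽ_⟨_⟩ : ∀ {k} → Vec ℤ k → Vec ℤ k → ℕ → Set
  u ≅ⱽ v ⟨ m ⟩ = Pointwise (λ a b → a ≅ b ⟨ m ⟩) u v

  evalMonic-cong : ∀ {m k} {g h : Vec ℤ k} → g ≅ⱽ h ⟨ m ⟩ → ∀ x → evalMonic g x ≅ evalMonic h x ⟨ m ⟩
  evalMonic-cong []        x = ≅-refl
  evalMonic-cong (a≅b ∷ e) x = +-≅ a≅b (*-≅ (≅-refl {a = x}) (evalMonic-cong e x))

  canonⱽ : ∀ m → .{{NonZero m}} → ∀ {k} → Vec ℤ k → Vec ℤ k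
  canonⱽ m = Vec.map (canon m)

  canonⱽ-≅ : ∀ m → .{{_ : NonZero m}} → ∀ {k} (g : Vec ℤ k) → canonⱽ m g ≅ⱽ g ⟨ m ⟩
  canonⱽ-≅ m []      = []
  canonⱽ-≅ m (a ∷ g) = canon-≅ m a ∷ canonⱽ-≅ m g

  canonⱽ∈ : ∀ m → .{{_ : NonZero m}} → ∀ {k} (g : Vec ℤ k) → canonⱽ m g ∈ vectors (res m) k
  canonⱽ∈ m g = ∈-vectors⁺ (canonⱽ m g) λ i →
    subst (_∈ res m) (sym (Vec.lookup-map i (canon m) g)) (canon∈ m (lookup g i))

  quoMonic : ∀ {k} → ℤ → Vec ℤ (suc k) → Vec ℤ k
  quoMonic         r (c ∷ [])    = []
  quoMonic {suc k} r (c ∷ d ∷ g) = evalMonic (d ∷ g) r ∷ quoMonic r (d ∷ g)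

  evalMonic-quo : ∀ {k} r (g : Vec ℤ (suc k)) x →
    evalMonic g x ≡ evalMonic g r + (x - r) * evalMonic (quoMonic r g) x
  evalMonic-quo r (c ∷ []) x = lemma c r x
    where
    lemma : ∀ c r x → c + x * 1ℤ ≡ c + r * 1ℤ + (x - r) * 1ℤ
    lemma = solve-∀
  evalMonic-quo {suc k} r (c ∷ d ∷ g) x =
    trans (cong (λ u → c + x * u) (evalMonic-quo r (d ∷ g) x)) (lemma c r x _ _)
    where
    lemma : ∀ c r x u v → c + x * (u + (x - r) * v) ≡ c + r * u + (x - r) * (u + x * v)
    lemma = solve-∀

  mulMonic : ∀ {k} → ℤ → Vec ℤ k → Vec ℤ (suc k)
  mulMonic s []      = - s ∷ []
  mulMonic s (c ∷ g) = - s * c ∷ Vec.head (mulMonic s g) + c ∷ Vec.tail (mulMonic s g)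

  evalMonic-mul : ∀ {k} s (g : Vec ℤ k) x → evalMonic (mulMonic s g) x ≡ (x - s) * evalMonic g x
  evalMonic-mul s []      x = lemma s x
    where
    lemma : ∀ s x → - s + x * 1ℤ ≡ (x - s) * 1ℤ
    lemma = solve-∀
  evalMonic-mul s (c ∷ g) x = trans
    (cong (λ u → - s * c + x * u) (trans (add c (mulMonic s g)) (cong (λ u → c + u) (evalMonic-mul s g x))))
    (lemma s x c _)
    where
    add : ∀ {k} c (h : Vec ℤ (suc k)) → evalMonic (Vec.head h + c ∷ Vec.tail h) x ≡ c + evalMonic h x
    add c (d ∷ h) = rearrange d c _
      where
      rearrange : ∀ d c u → d + c + u ≡ c + (d + u)
      rearrange = solve-∀
    lemma : ∀ s x c u → - s * c + x * (c + (x - s) * u) ≡ (x - s) * (c + x * u)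
    lemma = solve-∀

  monicPoly : ∀ {k} → Vec ℤ k → Poly
  monicPoly []      = const 1ℤ
  monicPoly (c ∷ g) = c ∷ monicPoly g

  eval-monicPoly : ∀ {k} (g : Vec ℤ k) x → eval (monicPoly g) x ≡ evalMonic g x
  eval-monicPoly []      x = eval-const 1ℤ x
  eval-monicPoly (c ∷ g) x = cong (λ u → c + x * u) (eval-monicPoly g x)

  length-monicPoly : ∀ {k} (g : Vec ℤ k) → length (monicPoly g) ≡ suc k
  length-monicPoly []      = refl
  length-monicPoly (c ∷ g) = cong suc (length-monicPoly g)

  coeff-monicPoly : ∀ {k} (g : Vec ℤ k) → coeff (monicPoly g) k ≡ 1ℤ
  coeff-monicPoly []      = refl
  coeff-monicPoly (c ∷ g) = coeff-monicPoly g

  root? : ∀ p {k} (g : Vec ℤ k) x → Dec (+ p ℤ.∣ evalMonic g x)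
  root? p g x = + p ℤ.∣? evalMonic g x

  monic-root-count : ∀ {p} → Prime p → ∀ {k} (g : Vec ℤ k) xs → Distinct p xs →
    ∑ xs (λ x → 𝟙 (root? p g x)) ≤ k
  monic-root-count {p} pr {k} g xs distinct = ℕ.≤-trans
    (∑-mono xs λ x _ → 𝟙-mono (root? p g x) (+ p ℤ.∣? eval (monicPoly g) x)
      (subst (+ p ℤ.∣_) (sym (eval-monicPoly g x))))
    (root-count pr k (monicPoly g) (ℕ.≤-reflexive (length-monicPoly g)) k
      (subst (λ a → ¬ (+ p ℤ.∣ a)) (sym (coeff-monicPoly g)) (prime∤1 pr)) xs distinct)

  -- Counting monic polynomials with a root in a prescribed set.

  HasRoot : ℕ → List ℤ → ∀ {k} → Vec ℤ k → Set
  HasRoot p S g = Any (λ r → + p ℤ.∣ evalMonic g r) S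

  hasRoot? : ∀ p S {k} (g : Vec ℤ k) → Dec (HasRoot p S g)
  hasRoot? p S g = Any.any? (root? p g) S

  rooted : ℕ → List ℤ → ℕ → ℕ
  rooted p S k = ∑ (vectors (res p) k) λ g → 𝟙 (hasRoot? p S g)

  -- Counts the pairs of a polynomial and a root in S in two ways. For a given root r the constant
  -- coefficient can be solved for from the others, so at least p ^ k polynomials vanish there; and
  -- no polynomial is counted more than k + 1 times.
  rooted-bound : ∀ {p} → Prime p → ∀ S → Distinct p S → ∀ k →
    length S ℕ.* p ℕ.^ k ≤ suc k ℕ.* rooted p S (suc k)
  rooted-bound {p} pr S distinct k = begin
    length S ℕ.* p ℕ.^ k
      ≡⟨ ∑-const S (p ℕ.^ k) ⟨
    ∑ S (λ _ → p ℕ.^ k)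
      ≤⟨ ∑-mono S (λ r _ → fibre r) ⟩
    (∑ S λ r → ∑ (vectors (res p) (suc k)) λ g → 𝟙 (root? p g r))
      ≡⟨ ∑-swap S (vectors (res p) (suc k)) _ ⟩
    (∑ (vectors (res p) (suc k)) λ g → ∑ S λ r → 𝟙 (root? p g r))
      ≤⟨ ∑-mono (vectors (res p) (suc k)) (λ g _ → multiplicity g (hasRoot? p S g)) ⟩
    (∑ (vectors (res p) (suc k)) λ g → suc k ℕ.* 𝟙 (hasRoot? p S g))
      ≡⟨ ∑-*ˡ (suc k) (vectors (res p) (suc k)) _ ⟩
    suc k ℕ.* rooted p S (suc k) ∎
    where
    open ℕ.≤-Reasoning
    instance
      p≢0 : NonZero p
      p≢0 = prime⇒nonZero pr
    multiplicity : ∀ g (R? : Dec (HasRoot p S g)) → ∑ S (λ r → 𝟙 (root? p g r)) ≤ suc k ℕ.* 𝟙 R?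
    multiplicity g (yes _)  = ℕ.≤-trans (monic-root-count pr g S distinct) (ℕ.≤-reflexive (sym (ℕ.*-identityʳ _)))
    multiplicity g (no ¬R) = ℕ.≤-trans
      (∑-bound S 0 λ r r∈ → none r r∈ (root? p g r))
      (ℕ.≤-trans (ℕ.≤-reflexive (ℕ.*-zeroʳ (length S))) z≤n)
      where
      none : ∀ r → r ∈ S → (r? : Dec (+ p ℤ.∣ evalMonic g r)) → 𝟙 r? ≤ 0
      none r r∈ (no _)      = z≤n
      none r r∈ (yes root) = ⊥-elim (¬R (lose r∈ root))
    fibre : ∀ r → p ℕ.^ k ≤ ∑ (vectors (res p) (suc k)) λ g → 𝟙 (root? p g r)
    fibre r = begin
      p ℕ.^ k
        ≡⟨ cong (ℕ._^ k) (length-res p) ⟨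
      length (res p) ℕ.^ k
        ≡⟨ trans (ℕ.*-identityʳ _) (length-vectors (res p) k) ⟨
      length (vectors (res p) k) ℕ.* 1
        ≡⟨ ∑-const (vectors (res p) k) 1 ⟨
      ∑ (vectors (res p) k) (λ _ → 1)
        ≤⟨ ∑-mono (vectors (res p) k) (λ g _ → constant g) ⟩
      (∑ (vectors (res p) k) λ g → ∑ (res p) λ c → 𝟙 (root? p (c ∷ g) r))
        ≡⟨ ∑-swap (vectors (res p) k) (res p) _ ⟩
      (∑ (res p) λ c → ∑ (vectors (res p) k) λ g → 𝟙 (root? p (c ∷ g) r))
        ≡⟨ ∑-product _∷_ (res p) (vectors (res p) k) _ ⟨
      (∑ (vectors (res p) (suc k)) λ g → 𝟙 (root? p g r)) ∎
      where
      constant : ∀ g → 1 ≤ ∑ (res p) λ c → 𝟙 (root? p (c ∷ g) r)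
      constant g = ℕ.≤-trans (ℕ.≤-reflexive (sym (𝟙-yes (root? p (c₀ ∷ g) r) root)))
        (∑-≥₁ (λ c → 𝟙 (root? p (c ∷ g) r)) (canon∈ p (- u)))
        where
        u = r * evalMonic g r
        c₀ = canon p (- u)
        root : + p ℤ.∣ c₀ + u
        root = ≅0⇒∣ (≅-trans (+-≅ (canon-≅ p (- u)) ≅-refl) (≡⇒≅ (ℤ.+-inverseˡ u)))

  -- Σ (2 - [q ∈ T]) over all q counts every a at least twice, because a
  -- witness in T always comes with a second one.
  double-count : {A Q : Set} {R : A → Q → Set} {T : Q → Set}
    (R? : ∀ a q → Dec (R a q)) (T? : Decidable T) (as : List A) (qs : List Q) → Unique as →
    (∀ {a b q} → a ∈ as → b ∈ as → q ∈ qs → R a q → R b q → a ≡ b) →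
    (∀ {a} → a ∈ as → ∃ λ q → q ∈ qs × R a q) →
    (∀ {a q} → a ∈ as → q ∈ qs → R a q → T q → ∃ λ q′ → q′ ∈ qs × q ≢ q′ × R a q′) →
    2 ℕ.* length as ℕ.+ ∑ qs (𝟙 ∘ T?) ≤ 2 ℕ.* length qs
  double-count {A} {Q} {R} {T} R? T? as qs unique inj witness second = begin
    2 ℕ.* length as ℕ.+ ∑ qs (𝟙 ∘ T?)
      ≡⟨ cong (ℕ._+ ∑ qs (𝟙 ∘ T?)) (trans (ℕ.*-comm 2 (length as)) (sym (∑-const as 2))) ⟩
    ∑ as (λ _ → 2) ℕ.+ ∑ qs (𝟙 ∘ T?)
      ≤⟨ ℕ.+-monoˡ-≤ _ (∑-mono as twice) ⟩
    (∑ as λ a → ∑ qs λ q → w q ℕ.* 𝟙 (R? a q)) ℕ.+ ∑ qs (𝟙 ∘ T?)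
      ≡⟨ cong (ℕ._+ ∑ qs (𝟙 ∘ T?)) (∑-swap as qs _) ⟩
    (∑ qs λ q → ∑ as λ a → w q ℕ.* 𝟙 (R? a q)) ℕ.+ ∑ qs (𝟙 ∘ T?)
      ≤⟨ ℕ.+-monoˡ-≤ _ (∑-mono qs once) ⟩
    ∑ qs w ℕ.+ ∑ qs (𝟙 ∘ T?)
      ≡⟨ ∑-+ qs w (𝟙 ∘ T?) ⟨
    (∑ qs λ q → w q ℕ.+ 𝟙 (T? q))
      ≡⟨ ∑-cong qs (λ q → cong suc (trans (ℕ.+-comm (𝟙 (¬? (T? q))) (𝟙 (T? q))) (𝟙-¬ (T? q)))) ⟩
    ∑ qs (λ _ → 2)
      ≡⟨ trans (∑-const qs 2) (ℕ.*-comm (length qs) 2) ⟩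
    2 ℕ.* length qs ∎
    where
    open ℕ.≤-Reasoning
    w : Q → ℕ
    w q = suc (𝟙 (¬? (T? q)))
    once : ∀ q → q ∈ qs → ∑ as (λ a → w q ℕ.* 𝟙 (R? a q)) ≤ w q
    once q q∈ = ℕ.≤-trans (ℕ.≤-reflexive (∑-*ˡ (w q) as λ a → 𝟙 (R? a q)))
      (ℕ.≤-trans (ℕ.*-monoʳ-≤ (w q) (∑-≤1 (λ a → R? a q) unique λ a∈ b∈ → inj a∈ b∈ q∈))
        (ℕ.≤-reflexive (ℕ.*-identityʳ (w q))))
    term : ∀ {a q} → R a q → 1 ≤ w q ℕ.* 𝟙 (R? a q)
    term {a} {q} r rewrite 𝟙-yes (R? a q) r = s≤s z≤n
    heavy : ∀ {a q} → R a q → ¬ T q → 2 ≤ w q ℕ.* 𝟙 (R? a q)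
    heavy {a} {q} r ¬t rewrite 𝟙-yes (R? a q) r | 𝟙-yes (¬? (T? q)) ¬t = s≤s (s≤s z≤n)
    twice : ∀ a → a ∈ as → 2 ≤ ∑ qs λ q → w q ℕ.* 𝟙 (R? a q)
    twice a a∈ with witness a∈
    ... | q , q∈ , r with T? q
    ...   | no ¬t = ℕ.≤-trans (heavy r ¬t) (∑-≥₁ (λ q → w q ℕ.* 𝟙 (R? a q)) q∈)
    ...   | yes t with second a∈ q∈ r t
    ...     | q′ , q′∈ , q≢q′ , r′ = ℕ.≤-trans (ℕ.+-mono-≤ (term r) (term r′))
      (∑-≥₂ (λ q → w q ℕ.* 𝟙 (R? a q)) q∈ q′∈ q≢q′)

-- Matrices modulo a prime: the first row

module _ where
  open import Data.Integer.Base using (_+_; _*_; _-_; -_)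
  open import Data.Integer.Tactic.RingSolver using (solve-∀)

  -- Comparing values at residues instead of coefficients makes this decidable and evidently
  -- periodic in the matrix. It still determines the first row, since `res p` contains the n points
  -- used in `first-row-unique`.
  Factors : ∀ (p : ℕ) {n k l} → Matrix n → Vec ℤ k × Vec ℤ l → Set
  Factors p A (g , h) = All (λ x → charValue A x ≅ evalMonic g x * evalMonic h x ⟨ p ⟩) (res p)

  factors? : ∀ p {n k l} (A : Matrix n) (gh : Vec ℤ k × Vec ℤ l) → Dec (Factors p A gh)
  factors? p A (g , h) = All.all? (λ x → charValue A x ≅? evalMonic g x * evalMonic h x ⟨ p ⟩) (res p)

  pairs : ∀ p k l → List (Vec ℤ k × Vec ℤ l)
  pairs p k l = cartesianProductWith _,_ (vectors (res p) k) (vectors (res p) l)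

  Bad : ∀ (p : ℕ) {n} → ℕ → ℕ → Matrix n → Set
  Bad p k l A = Any (Factors p A) (pairs p k l)

  bad? : ∀ p {n} k l (A : Matrix n) → Dec (Bad p k l A)
  bad? p k l A = Any.any? (factors? p A) (pairs p k l)

  split⇒bad : ∀ p → .{{NonZero p}} → ∀ {n k l} (A : Matrix n) → Split k l A → Bad p k l A
  split⇒bad p A (g , h , eq) = lose
    (∈-cartesianProductWith⁺ _,_ (canonⱽ∈ p g) (canonⱽ∈ p h))
    (All.tabulate λ {x} _ → ≅-trans (≡⇒≅ (eq x)) (≅-sym
      (*-≅ (evalMonic-cong (canonⱽ-≅ p g) x) (evalMonic-cong (canonⱽ-≅ p h) x))))

  Rows : ℕ → Set
  Rows n = Vec (Vec ℤ (suc n)) n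

  cofactors : ∀ {n} → Rows n → Fin (suc n) → Fin (suc n) → ℤ
  cofactors R = cofactorMatrix points (λ i j → lookup (lookup R i) j)

  charValue-difference : ∀ {n} a b (R : Rows n) x →
    charValue (a ∷ R) x - charValue (b ∷ R) x ≡
    sum λ j → (lookup b j - lookup a j) * cofactor x (λ i j → lookup (lookup R i) j) j
  charValue-difference {n} a b R x = trans (sum-- (term a) (term b))
    (sum-cong λ j → lemma ((- 1ℤ) ^ toℕ j) (if ⌊ zero Fin.≟ j ⌋ then x else 0ℤ)
      (lookup a j) (lookup b j) (minor j))
    where
    minor : Fin (suc n) → ℤ
    minor j = det λ i k → charEntry x (λ i j → lookup (lookup R i) j) suc i (punchIn j k)
    term : Vec ℤ (suc n) → Fin (suc n) → ℤ
    term a j = (- 1ℤ) ^ toℕ j * (((if ⌊ zero Fin.≟ j ⌋ then x else 0ℤ) + - lookup a j) * minor j)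
    lemma : ∀ s e u v d → s * ((e + - u) * d) - s * ((e + - v) * d) ≡ (v - u) * (s * d)
    lemma = solve-∀

  -- The characteristic values are affine in the first row. Agreement at the points 0, ..., n says
  -- that the difference of the two rows is annihilated modulo p by the cofactor matrix, and
  -- `cramer` applies.
  first-row-unique : ∀ {p n} → Prime p → suc n ≤ p → ∀ (R : Rows n) → ¬ (+ p ℤ.∣ det (cofactors R)) →
    ∀ {a b} → a ∈ vectors (res p) (suc n) → b ∈ vectors (res p) (suc n) →
    (∀ {x} → x ∈ res p → charValue (a ∷ R) x ≅ charValue (b ∷ R) x ⟨ p ⟩) → a ≡ b
  first-row-unique {p} {n} pr n<p R p∤ {a} {b} a∈ b∈ same = lookup-injective a b λ j →
    sym (res-cancel (∈-vectors⁻ b b∈ j) (∈-vectors⁻ a a∈ j)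
      (congruent ([ id , ⊥-elim ∘ p∤ ]′ (euclid pr (lookup b j - lookup a j) _
        (cramer (cofactors R) (λ j → lookup b j - lookup a j) (ℤ.quotient ∘ at) (+ p) combination j)))))
    where
    lookup-injective : ∀ {k} (u v : Vec ℤ k) → (∀ j → lookup u j ≡ lookup v j) → u ≡ v
    lookup-injective []      []      eq = refl
    lookup-injective (x ∷ u) (y ∷ v) eq = cong₂ _∷_ (eq zero) (lookup-injective u v (eq ∘ suc))
    at : ∀ i → + p ℤ.∣ charValue (a ∷ R) (points {suc n} i) - charValue (b ∷ R) (points {suc n} i)
    at i = difference (same (∈-res (ℕ.≤-trans (Fin.toℕ<n i) n<p)))
    combination : ∀ i → (sum λ l → (lookup b l - lookup a l) * cofactors R l i) ≡ ℤ.quotient (at i) * + p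
    combination i = trans (sym (charValue-difference a b R (points {suc n} i))) (ℤ._∣_.equality (at i))

  -- g (x - s) / (x - r) and h (x - r) / (x - s) have the same product as g and h.
  exchange : ∀ {p k l n} → Prime p → k ℕ.< p → ∀ (A : Matrix n) (g : Vec ℤ (suc k)) (h : Vec ℤ (suc l)) r s →
    ¬ (r ≅ s ⟨ p ⟩) → + p ℤ.∣ evalMonic g r → + p ℤ.∣ evalMonic h s →
    Factors p A (g , h) → ∃ λ gh → gh ∈ pairs p (suc k) (suc l) × (g , h) ≢ gh × Factors p A gh
  exchange {p} {k} pr k<p A g h r s r≢s g-root h-root factors =
    (g′ , h′) , ∈-cartesianProductWith⁺ _,_ (canonⱽ∈ p _) (canonⱽ∈ p _) , distinct ,
    All.map (λ {x} eq → ≅-trans eq (product x)) factors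
    where
    instance
      p≢0 : NonZero p
      p≢0 = prime⇒nonZero pr
    G = quoMonic r g
    H = quoMonic s h
    g′ = canonⱽ p (mulMonic s G)
    h′ = canonⱽ p (mulMonic r H)
    divided : ∀ {j} (f : Vec ℤ (suc j)) t → + p ℤ.∣ evalMonic f t → ∀ x →
              evalMonic f x ≅ (x - t) * evalMonic (quoMonic t f) x ⟨ p ⟩
    divided f t root x = ≅-trans (≡⇒≅ (evalMonic-quo t f x))
      (≅-trans (+-≅ (∣⇒≅0 root) ≅-refl) (≡⇒≅ (ℤ.+-identityˡ _)))
    multiplied : ∀ {j} (f : Vec ℤ j) t x →
                 evalMonic (canonⱽ p (mulMonic t f)) x ≅ (x - t) * evalMonic f x ⟨ p ⟩
    multiplied f t x = ≅-trans (evalMonic-cong (canonⱽ-≅ p (mulMonic t f)) x) (≡⇒≅ (evalMonic-mul t f x))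
    product : ∀ x → evalMonic g x * evalMonic h x ≅ evalMonic g′ x * evalMonic h′ x ⟨ p ⟩
    product x = ≅-trans (*-≅ (divided g r g-root x) (divided h s h-root x))
      (≅-trans (≡⇒≅ (lemma (x - r) (evalMonic G x) (x - s) (evalMonic H x)))
        (≅-sym (*-≅ (multiplied G s x) (multiplied H r x))))
      where
      lemma : ∀ a b c d → (a * b) * (c * d) ≡ (c * b) * (a * d)
      lemma = solve-∀
    distinct : (g , h) ≢ (g′ , h′)
    -- If the exchange changed nothing, (x - r) G and (x - s) G would agree modulo p at every x. As
    -- r ≢ s, each of the p residues would be a root of G, which has degree k < p.
    distinct eq = ℕ.<⇒≱ k<p (begin
      p                                    ≡⟨ trans (ℕ.*-identityʳ _) (length-res p) ⟨
      length (res p) ℕ.* 1                 ≡⟨ ∑-const (res p) 1 ⟨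
      ∑ (res p) (λ _ → 1)                  ≤⟨ ∑-mono (res p) (λ x _ → ℕ.≤-reflexive (sym (𝟙-yes (root? p G x) (G-root x)))) ⟩
      ∑ (res p) (λ x → 𝟙 (root? p G x))    ≤⟨ monic-root-count pr G (res p) (res-distinct (res-unique p) id) ⟩
      k                                    ∎)
      where
      open ℕ.≤-Reasoning
      lemma : ∀ x r s u → (x - s) * u - (x - r) * u ≡ (r - s) * u
      lemma = solve-∀
      G-root : ∀ x → + p ℤ.∣ evalMonic G x
      G-root x = [ ⊥-elim ∘ r≢s ∘ congruent , id ]′ (euclid pr (r - s) (evalMonic G x)
        (subst (+ p ℤ.∣_) (lemma x r s (evalMonic G x)) (difference
          (≅-trans (≅-sym (multiplied G s x))
            (≅-trans (≡⇒≅ (cong (λ gh → evalMonic (proj₁ gh) x) (sym eq))) (divided g r g-root x))))))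

  -- The residues modulo m + m′ that are not in `res m`. Taking r from one part and s from the other
  -- ensures r ≢ s, as `exchange` requires.
  high : ℕ → ℕ → List ℤ
  high m m′ = map (λ i → + (m ℕ.+ i)) (upTo m′)

  high⊆res : ∀ {m m′ x} → x ∈ high m m′ → x ∈ res (m ℕ.+ m′)
  high⊆res {m} x∈ with ∈-map⁻ (λ i → + (m ℕ.+ i)) x∈
  ... | i , i∈ , refl = ∈-res (ℕ.+-monoʳ-< m (∈-upTo⁻ i∈))

  high-unique : ∀ m m′ → Unique (high m m′)
  high-unique m m′ = Unique.map⁺ (ℕ.+-cancelˡ-≡ m _ _ ∘ ℤ.+-injective) (Unique.upTo⁺ m′)

  res⊆res : ∀ {m p x} → m ≤ p → x ∈ res m → x ∈ res p
  res⊆res m≤p x∈ with ∈-res⁻ x∈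
  ... | i , i<m , refl = ∈-res (ℕ.≤-trans i<m m≤p)

  low≢high : ∀ {m m′ r s} → r ∈ res m → s ∈ high m m′ → ¬ (r ≅ s ⟨ m ℕ.+ m′ ⟩)
  low≢high {m} {m′} r∈ s∈ r≅s with res-cancel (res⊆res (ℕ.m≤m+n m m′) r∈) (high⊆res {m} s∈) r≅s
    | ∈-res⁻ r∈ | ∈-map⁻ (λ i → + (m ℕ.+ i)) s∈
  ... | refl | k , k<m , refl | i , i∈ , eq =
    ℕ.<⇒≱ k<m (ℕ.≤-trans (ℕ.m≤m+n m i) (ℕ.≤-reflexive (sym (ℤ.+-injective eq))))

  𝟙-× : {P Q : Set} (P? : Dec P) (Q? : Dec Q) → 𝟙 (P? ×-dec Q?) ≡ 𝟙 P? ℕ.* 𝟙 Q?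
  𝟙-× (yes _) (yes _) = refl
  𝟙-× (yes _) (no _)  = refl
  𝟙-× (no _)  _       = refl

  badRows : ℕ → ∀ {n} → ℕ → ℕ → Rows n → ℕ
  badRows p {n} k l R = ∑ (vectors (res p) (suc n)) λ a → 𝟙 (bad? p k l (a ∷ R))

  -- `double-count` with the bad first rows as objects and the pairs (g , h) as witnesses. A pair
  -- serves at most one row because R is regular; a pair with a low root of g and a high root of h
  -- brings a second pair by exchange.
  badRows-bound : ∀ {p n k l m m′} → Prime p → suc n ≤ p → suc k ℕ.+ suc l ≡ suc n → m ℕ.+ m′ ≡ p →
    ∀ (R : Rows n) → ¬ (+ p ℤ.∣ det (cofactors R)) →
    2 ℕ.* badRows p (suc k) (suc l) R ℕ.+ rooted p (res m) (suc k) ℕ.* rooted p (high m m′) (suc l)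
      ≤ 2 ℕ.* p ℕ.^ suc n
  badRows-bound {p} {n} {k} {l} {m} {m′} pr n<p k+l refl R p∤ = begin
    2 ℕ.* badRows p (suc k) (suc l) R ℕ.+ rooted p (res m) (suc k) ℕ.* rooted p (high m m′) (suc l)
      ≡⟨ cong₂ (λ u v → 2 ℕ.* u ℕ.+ v) (length-filter-∑ bad (vectors (res p) (suc n))) count-T ⟨
    2 ℕ.* length as ℕ.+ ∑ qs (𝟙 ∘ T?)
      ≤⟨ double-count (λ a q → factors? p (a ∷ R) q) T? as qs
           (Unique.filter⁺ bad (vectors-unique (suc n) (res-unique p))) inj witness second ⟩
    2 ℕ.* length qs
      ≡⟨ cong (2 ℕ.*_) length-qs ⟩
    2 ℕ.* p ℕ.^ suc n ∎
    where
    open ℕ.≤-Reasoning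
    bad : Decidable λ a → Bad p (suc k) (suc l) (a ∷ R)
    bad a = bad? p (suc k) (suc l) (a ∷ R)
    as = filter bad (vectors (res p) (suc n))
    qs = pairs p (suc k) (suc l)
    T : Vec ℤ (suc k) × Vec ℤ (suc l) → Set
    T (g , h) = HasRoot p (res m) g × HasRoot p (high m m′) h
    T? : Decidable T
    T? (g , h) = hasRoot? p (res m) g ×-dec hasRoot? p (high m m′) h
    count-T : ∑ qs (𝟙 ∘ T?) ≡ rooted p (res m) (suc k) ℕ.* rooted p (high m m′) (suc l)
    count-T = trans (∑-product _,_ (vectors (res p) (suc k)) (vectors (res p) (suc l)) (𝟙 ∘ T?))
      (trans (∑-cong (vectors (res p) (suc k)) λ g →
          trans (∑-cong (vectors (res p) (suc l)) λ h → 𝟙-× (hasRoot? p (res m) g) (hasRoot? p (high m m′) h))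
                (∑-*ˡ (𝟙 (hasRoot? p (res m) g)) (vectors (res p) (suc l)) _))
        (∑-*ʳ (rooted p (high m m′) (suc l)) (vectors (res p) (suc k)) _))
    length-qs : length qs ≡ p ℕ.^ suc n
    length-qs = trans (length-cartesianProductWith _,_ (vectors (res p) (suc k)) (vectors (res p) (suc l)))
      (trans (cong₂ ℕ._*_ (size (suc k)) (size (suc l)))
        (trans (sym (ℕ.^-distribˡ-+-* p (suc k) (suc l))) (cong (p ℕ.^_) k+l)))
      where
      size : ∀ j → length (vectors (res p) j) ≡ p ℕ.^ j
      size j = trans (length-vectors (res p) j) (cong (ℕ._^ j) (length-res p))
    inj : ∀ {a b q} → a ∈ as → b ∈ as → q ∈ qs → Factors p (a ∷ R) q → Factors p (b ∷ R) q → a ≡ b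
    inj a∈ b∈ _ a-factors b-factors = first-row-unique pr n<p R p∤
      (proj₁ (∈-filter⁻ bad a∈)) (proj₁ (∈-filter⁻ bad b∈))
      λ x∈ → ≅-trans (All.lookup a-factors x∈) (≅-sym (All.lookup b-factors x∈))
    witness : ∀ {a} → a ∈ as → ∃ λ q → q ∈ qs × Factors p (a ∷ R) q
    witness a∈ = find (proj₂ (∈-filter⁻ bad {xs = vectors (res p) (suc n)} a∈))
    k<p : k ℕ.< p
    k<p = ℕ.≤-trans (ℕ.m≤m+n (suc k) (suc l)) (ℕ.≤-trans (ℕ.≤-reflexive k+l) n<p)
    second : ∀ {a q} → a ∈ as → q ∈ qs → Factors p (a ∷ R) q → T q →
             ∃ λ q′ → q′ ∈ qs × q ≢ q′ × Factors p (a ∷ R) q′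
    second {a} {g , h} _ _ factors (g-rooted , h-rooted) with find g-rooted | find h-rooted
    ... | r , r∈ , g-root | s , s∈ , h-root =
      exchange pr k<p (a ∷ R) g h r s (low≢high {m} r∈ s∈) g-root h-root factors

-- Matrices modulo a prime: the rows below the first one

module _ where
  open import Data.Integer.Base using (_+_; _*_; _-_; -_)
  open import Data.Integer.Tactic.RingSolver using (solve-∀)
  open Determinant ℤ[X] using () renaming (det to detₚ)
  private module ℤ[X]ᶜ = CharacteristicMatrix ℤ[X]

  affineᴹ : ∀ {r n} → ℤ → Vec (Vec ℤ n) r → Vec (Vec ℤ n) r → Vec (Vec ℤ n) r
  affineᴹ c = Vec.zipWith (Vec.zipWith (affine c))

  lookup-affineᴹ : ∀ {r n} c (Y Z : Vec (Vec ℤ n) r) i j →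
    lookup (lookup (affineᴹ c Y Z) i) j ≡ affine c (lookup (lookup Y i) j) (lookup (lookup Z i) j)
  lookup-affineᴹ c Y Z i j = trans
    (cong (λ v → lookup v j) (Vec.lookup-zipWith (Vec.zipWith (affine c)) i Y Z))
    (Vec.lookup-zipWith (affine c) j (lookup Y i) (lookup Z i))

  infix 4 _≅ᴹ_⟨_⟩

  _≅ᴹ_⟨_⟩ : ∀ {r n} → Vec (Vec ℤ n) r → Vec (Vec ℤ n) r → ℕ → Set
  Y ≅ᴹ Z ⟨ m ⟩ = Pointwise (λ u v → u ≅ⱽ v ⟨ m ⟩) Y Z

  Periodic : ∀ {r n} → ℕ → (Vec (Vec ℤ n) r → ℕ) → Set
  Periodic m = Respects λ Y Z → Y ≅ᴹ Z ⟨ m ⟩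

  residueMatrices : ℕ → ∀ n r → List (Vec (Vec ℤ n) r)
  residueMatrices m n r = vectors (vectors (res m) n) r

  ∑-affineᴹ : ∀ m → .{{_ : NonZero m}} → ∀ c → (∀ a → + m ℤ.∣ c * a → + m ℤ.∣ a) →
    ∀ {n r} (Y : Vec (Vec ℤ n) r) f → Periodic m f →
    ∑ (residueMatrices m n r) (f ∘ affineᴹ c Y) ≤ ∑ (residueMatrices m n r) f
  ∑-affineᴹ m c cancel {n} = ∑-vectors-transport (λ u v → u ≅ⱽ v ⟨ m ⟩)
    (Pointwise.refl ≅-refl) (Vec.zipWith (affine c))
    (∑-vectors-transport (λ a b → a ≅ b ⟨ m ⟩) ≅-refl (affine c) (∑-affine m c cancel))

  -- The cofactor determinant on the line of matrices arrow + t R, as a polynomial in t. The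
  -- evaluation points of the characteristic polynomial are constants here.
  linePoly : ∀ {n} → Rows n → Poly
  linePoly {n} R = detₚ λ (j i : Fin (suc n)) →
    ℤ[X]ᶜ.cofactor (const (points i)) (λ i j → arrowRows i j ∷ lookup (lookup R i) j ∷ []) j

  -- Each cofactor has degree at most n in t and the cofactor matrix has n + 1 rows; `n * 1` is the
  -- shape that `Top-det` produces.
  lineDegree : ℕ → ℕ
  lineDegree n = suc n ℕ.* (n ℕ.* 1)

  linePoly-top : ∀ {n} (R : Rows n) → ∃ (Top (lineDegree n) (linePoly R))
  linePoly-top {n} R = _ , Top-det (n ℕ.* 1)
      {λ j i → ℤ[X]ᶜ.cofactor (const (points i)) L j}
      {λ j i → (- 1ℤ) ^ toℕ j * det λ i′ k → 0ℤ - lookup (lookup R i′) (punchIn j k)}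
      λ j i → Top-* {0} {n ℕ.* 1} {(ℤ[X].- ℤ[X].1#) ^ₚ toℕ j} (Top-sgn (toℕ j))
        (Top-det 1 {a = λ i′ k → 0ℤ - lookup (lookup R i′) (punchIn j k)} λ i′ k → entry-top i i′ (punchIn j k))
    where
    open import Algebra.Definitions.RawSemiring ℤ[X].rawSemiring using () renaming (_^_ to _^ₚ_)
    L : Fin n → Fin (suc n) → Poly
    L i j = arrowRows i j ∷ lookup (lookup R i) j ∷ []
    entry-top : ∀ (i : Fin (suc n)) i′ j → Top 1 (ℤ[X]ᶜ.charEntry (const (points i)) L suc i′ j)
                              (0ℤ - lookup (lookup R i′) j)
    entry-top i i′ j with suc i′ Fin.≟ j
    ... | yes _ = (λ { (suc (suc i)) _ → refl ; (suc zero) (s≤s ()) }) , sym (ℤ.+-identityˡ _)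
    ... | no _  = (λ { (suc (suc i)) _ → refl ; (suc zero) (s≤s ()) }) , sym (ℤ.+-identityˡ _)

  arrowMatrix : ∀ {n} → Rows n
  arrowMatrix = Vec.tabulate λ i → Vec.tabulate (arrowRows i)

  lookup-arrowMatrix : ∀ {n} i j → lookup (lookup (arrowMatrix {n}) i) j ≡ arrowRows i j
  lookup-arrowMatrix i j = trans
    (cong (λ v → lookup v j) (Vec.lookup∘tabulate (λ i → Vec.tabulate (arrowRows i)) i))
    (Vec.lookup∘tabulate (arrowRows i) j)

  eval-linePoly : ∀ {n} (R : Rows n) t →
    eval (linePoly R) t ≡ det (cofactors (affineᴹ t arrowMatrix R))
  eval-linePoly {n} R t = RingRelation.det-~ (evaluation t)
    {A = λ j i → ℤ[X]ᶜ.cofactor (const (points i)) (λ i j → arrowRows i j ∷ lookup (lookup R i) j ∷ []) j}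
    {cofactors (affineᴹ t arrowMatrix R)} λ j i →
    cofactor-~ (evaluation t) {x = const (points i)} {points i}
      {A = λ i j → arrowRows i j ∷ lookup (lookup R i) j ∷ []}
      {λ i j → lookup (lookup (affineᴹ t arrowMatrix R) i) j}
      (eval-const (points i) t) entries j
    where
    entries : ∀ i j → eval (arrowRows i j ∷ lookup (lookup R i) j ∷ []) t ≡
                      lookup (lookup (affineᴹ t arrowMatrix R) i) j
    entries i j = trans
      (cong₂ (λ u v → u + t * v) (sym (lookup-arrowMatrix i j)) (eval-const (lookup (lookup R i) j) t))
      (sym (lookup-affineᴹ t arrowMatrix R i j))

  cofactors-cong : ∀ {m n} {R S : Rows n} → R ≅ᴹ S ⟨ m ⟩ → det (cofactors R) ≅ det (cofactors S) ⟨ m ⟩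
  cofactors-cong {m} {n} {R} {S} R≅S = RingRelation.det-~ (modular m) λ j i →
    cofactor-~ (modular m) {x = points i} {points i}
      {A = λ i j → lookup (lookup R i) j} {λ i j → lookup (lookup S i) j}
      ≅-refl (λ i j → Pointwise.lookup (Pointwise.lookup R≅S i) j) j

  Degenerate : ℕ → ∀ {n} → Rows n → Set
  Degenerate p R = + p ℤ.∣ det (cofactors R)

  degenerate? : ∀ p {n} (R : Rows n) → Dec (Degenerate p R)
  degenerate? p R = + p ℤ.∣? det (cofactors R)

  𝟙-cong : {P Q : Set} (P? : Dec P) (Q? : Dec Q) → (P → Q) → (Q → P) → 𝟙 P? ≡ 𝟙 Q?
  𝟙-cong P? Q? P⇒Q Q⇒P = ℕ.≤-antisym (𝟙-mono P? Q? P⇒Q) (𝟙-mono Q? P? Q⇒P)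

  regular-periodic : ∀ p {n} → Periodic p (λ (R : Rows n) → 𝟙 (¬? (degenerate? p R)))
  regular-periodic p {n} {R} {S} R≅S = 𝟙-cong (¬? (degenerate? p R)) (¬? (degenerate? p S))
    (λ ¬R S → ¬R (∣-resp (≅-sym (cofactors-cong R≅S)) S))
    (λ ¬S R → ¬S (∣-resp (cofactors-cong R≅S) R))

  -- At t = 0 the line passes through the arrow matrix, whose cofactor determinant is prime to p. So
  -- the polynomial along the line is not zero modulo p, and its degree bounds the number of
  -- degenerate parameters.
  line-count : ∀ {p n} → Prime p → suc n ≤ p → ∀ (R : Rows n) ts → Distinct p ts →
    ∑ ts (λ t → 𝟙 (degenerate? p (affineᴹ t arrowMatrix R))) ≤ lineDegree n
  line-count {p} {n} pr n<p R ts distinct = ℕ.≤-trans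
    (∑-mono ts λ t _ → 𝟙-mono (degenerate? p (affineᴹ t arrowMatrix R)) (+ p ℤ.∣? eval f t)
      (subst (+ p ℤ.∣_) (sym (value t))))
    (root-count pr (lineDegree n) f short 0 constant ts distinct)
    where
    -- `root-count` measures a polynomial by the length of its list, while only the degree of
    -- `linePoly` is controlled.
    f = List.take (suc (lineDegree n)) (linePoly R)
    linePoly≈f : linePoly R ≈ f
    linePoly≈f = truncate (suc (lineDegree n)) (linePoly R) (proj₁ (proj₂ (linePoly-top R)))
    short : length f ≤ suc (lineDegree n)
    short = ℕ.≤-trans (ℕ.≤-reflexive (List.length-take (suc (lineDegree n)) (linePoly R)))
      (ℕ.m⊓n≤m _ _)
    value : ∀ t → eval f t ≡ det (cofactors (affineᴹ t arrowMatrix R))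
    value t = trans (sym (eval-cong {linePoly R} {f} t linePoly≈f)) (eval-linePoly R t)
    eval-at-0 : ∀ g → eval g 0ℤ ≡ coeff g 0
    eval-at-0 []      = refl
    eval-at-0 (a ∷ g) = ℤ.+-identityʳ a
    at-0 : det (cofactors (affineᴹ 0ℤ arrowMatrix R)) ≡ det (cofactorMatrix points (arrowRows {n}))
    at-0 = RingRelation.det-~ ≡-relation λ j i →
      cofactor-~ ≡-relation {x = points i} {points i}
        {A = λ i j → lookup (lookup (affineᴹ 0ℤ arrowMatrix R) i) j} {arrowRows}
        refl (λ i j → trans (lookup-affineᴹ 0ℤ arrowMatrix R i j)
          (trans (ℤ.+-identityʳ _) (lookup-arrowMatrix i j))) j
    constant : ¬ (+ p ℤ.∣ coeff f 0)
    constant = subst (λ a → ¬ (+ p ℤ.∣ a)) (sym (trans (sym (eval-at-0 f)) (trans (value 0ℤ) at-0)))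
      (prime∤det-arrow pr n<p)

  regularCount : ℕ → ℕ → ℕ
  regularCount p n = ∑ (residueMatrices p (suc n) n) λ R → 𝟙 (¬? (degenerate? p R))

  -- Averages over the punctured lines through the arrow matrix.
  regular-half : ∀ {p n} → Prime p → suc n ≤ p → lineDegree n ℕ.+ lineDegree n ℕ.< p →
    length (residueMatrices p (suc n) n) ≤ regularCount p n ℕ.+ regularCount p n
  regular-half {p} {n} pr n<p 2d<p =
    ℕ.*-cancelʳ-≤ Q (G ℕ.+ G) q {{q≢0}} (ℕ.+-cancelʳ-≤ (Q ℕ.* q) _ _ doubled)
    where
    open ℕ.≤-Reasoning
    d = lineDegree n
    Rs = residueMatrices p (suc n) n
    Q = length Rs
    G = regularCount p n
    q = ℕ.pred p
    1+q≡p : suc q ≡ p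
    1+q≡p = ℕ.suc-pred p {{prime⇒nonZero pr}}
    q≢0 : NonZero q
    q≢0 = ℕ.>-nonZero (s≤s⁻¹ (subst (1 ℕ.<_) (sym 1+q≡p) (ℕ.nonTrivial⇒n>1 p {{prime⇒nonTrivial pr}})))
    2d≤q : d ℕ.+ d ≤ q
    2d≤q = s≤s⁻¹ (subst (d ℕ.+ d ℕ.<_) (sym 1+q≡p) 2d<p)
    i<q⇒1+i<p : ∀ {i} → i ℕ.< q → suc i ℕ.< p
    i<q⇒1+i<p i<q = subst (_ ℕ.<_) 1+q≡p (s≤s i<q)
    -- The parameter 0 is left out, since R ↦ arrow + t R permutes the residue matrices only for t
    -- prime to p.
    ts = map (λ i → + suc i) (upTo q)
    length-ts : length ts ≡ q
    length-ts = trans (List.length-map _ (upTo q)) (List.length-upTo q)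
    ts-distinct : Distinct p ts
    ts-distinct = res-distinct (Unique.map⁺ (ℕ.suc-injective ∘ ℤ.+-injective) (Unique.upTo⁺ q)) ts⊆
      where
      ts⊆ : ∀ {x} → x ∈ ts → x ∈ res p
      ts⊆ x∈ with ∈-map⁻ (λ i → + suc i) x∈
      ... | i , i∈ , refl = ∈-res (i<q⇒1+i<p (∈-upTo⁻ i∈))
    good : ℤ → Rows n → ℕ
    good t R = 𝟙 (¬? (degenerate? p (affineᴹ t arrowMatrix R)))
    along : ∀ t → t ∈ ts → ∑ Rs (good t) ≤ G
    along t t∈ with ∈-map⁻ (λ i → + suc i) t∈
    ... | i , i∈ , refl = ∑-affineᴹ p {{prime⇒nonZero pr}} t cancel arrowMatrix
        (λ (R : Rows n) → 𝟙 (¬? (degenerate? p R))) (regular-periodic p)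
      where
      cancel : ∀ a → + p ℤ.∣ t * a → + p ℤ.∣ a
      cancel a p∣ta = [ ⊥-elim ∘ small⇒∤ (i<q⇒1+i<p (∈-upTo⁻ i∈)) (λ ()) , id ]′ (euclid pr t a p∣ta)
    across : ∀ R → q ≤ ∑ ts (λ t → good t R) ℕ.+ d
    across R = begin
      q                                      ≡⟨ trans (ℕ.*-identityʳ _) length-ts ⟨
      length ts ℕ.* 1                        ≡⟨ ∑-const ts 1 ⟨
      ∑ ts (λ _ → 1)                         ≡⟨ ∑-cong ts (λ t → 𝟙-¬ (bad t)) ⟨
      ∑ ts (λ t → 𝟙 (bad t) ℕ.+ good t R)    ≡⟨ ∑-+ ts (𝟙 ∘ bad) (λ t → good t R) ⟩
      ∑ ts (𝟙 ∘ bad) ℕ.+ ∑ ts (λ t → good t R)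
        ≤⟨ ℕ.+-monoˡ-≤ _ (line-count pr n<p R ts ts-distinct) ⟩
      d ℕ.+ ∑ ts (λ t → good t R)            ≡⟨ ℕ.+-comm d _ ⟩
      ∑ ts (λ t → good t R) ℕ.+ d            ∎
      where
      bad : ∀ t → Dec (Degenerate p (affineᴹ t arrowMatrix R))
      bad t = degenerate? p (affineᴹ t arrowMatrix R)
    counted : Q ℕ.* q ≤ q ℕ.* G ℕ.+ Q ℕ.* d
    counted = begin
      Q ℕ.* q                                              ≡⟨ ∑-const Rs q ⟨
      ∑ Rs (λ _ → q)                                       ≤⟨ ∑-mono Rs (λ R _ → across R) ⟩
      (∑ Rs λ R → ∑ ts (λ t → good t R) ℕ.+ d)             ≡⟨ ∑-+ Rs _ _ ⟩
      (∑ Rs λ R → ∑ ts (λ t → good t R)) ℕ.+ ∑ Rs (λ _ → d)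
        ≡⟨ cong₂ ℕ._+_ (∑-swap Rs ts (flip good)) (∑-const Rs d) ⟩
      (∑ ts λ t → ∑ Rs (good t)) ℕ.+ Q ℕ.* d               ≤⟨ ℕ.+-monoˡ-≤ _ (∑-bound ts G along) ⟩
      length ts ℕ.* G ℕ.+ Q ℕ.* d                          ≡⟨ cong (λ u → u ℕ.* G ℕ.+ Q ℕ.* d) length-ts ⟩
      q ℕ.* G ℕ.+ Q ℕ.* d                                  ∎
    -- Twice the count leaves an error Q (d + d) ≤ Q q, so half of the left-hand side survives.
    doubled : Q ℕ.* q ℕ.+ Q ℕ.* q ≤ (G ℕ.+ G) ℕ.* q ℕ.+ Q ℕ.* q
    doubled = begin
      Q ℕ.* q ℕ.+ Q ℕ.* q                                  ≤⟨ ℕ.+-mono-≤ counted counted ⟩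
      (q ℕ.* G ℕ.+ Q ℕ.* d) ℕ.+ (q ℕ.* G ℕ.+ Q ℕ.* d)      ≡⟨ rearrange q G Q d ⟩
      (G ℕ.+ G) ℕ.* q ℕ.+ Q ℕ.* (d ℕ.+ d)                  ≤⟨ ℕ.+-monoʳ-≤ ((G ℕ.+ G) ℕ.* q) (ℕ.*-monoʳ-≤ Q 2d≤q) ⟩
      (G ℕ.+ G) ℕ.* q ℕ.+ Q ℕ.* q                          ∎
      where
      rearrange : ∀ q G Q d → (q ℕ.* G ℕ.+ Q ℕ.* d) ℕ.+ (q ℕ.* G ℕ.+ Q ℕ.* d) ≡ (G ℕ.+ G) ℕ.* q ℕ.+ Q ℕ.* (d ℕ.+ d)
      rearrange = ℕ-solve-∀
        where open import Data.Nat.Tactic.RingSolver using () renaming (solve-∀ to ℕ-solve-∀)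

  -- The proportion of bad matrices modulo one large prime.

  badCount : ℕ → ℕ → ℕ → ℕ → ℕ
  badCount p n k l = ∑ (residueMatrices p n n) λ A → 𝟙 (bad? p k l A)

  module _ where
    open import Data.Nat.Base using () renaming (_+_ to _✚_; _*_ to _✖_)
    open import Data.Nat.Tactic.RingSolver using () renaming (solve-∀ to ℕ-solve-∀)

    -- A near-halving of p; the constant 3 in place of 2 absorbs the rounding and is attained at p =
    -- 3.
    third : ∀ p → 2 ≤ p → ∃₂ λ m m′ → m ✚ m′ ≡ p × p ≤ 3 ✖ m × p ≤ 3 ✖ m′
    third (suc zero) (s≤s ())
    third (suc (suc zero)) _ = 1 , 1 , refl , s≤s (s≤s z≤n) , s≤s (s≤s z≤n)
    third (suc (suc (suc zero))) _ = 1 , 2 , refl , s≤s (s≤s (s≤s z≤n)) , s≤s (s≤s (s≤s z≤n))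
    third (suc (suc (suc (suc p)))) _ with third (suc (suc p)) (s≤s (s≤s z≤n))
    ... | m , m′ , eq , p≤3m , p≤3m′ = suc m , suc m′ ,
      trans (cong suc (ℕ.+-suc m m′)) (cong (λ u → suc (suc u)) eq) , step m p≤3m , step m′ p≤3m′
      where
      step : ∀ m → suc (suc p) ≤ 3 ✖ m → suc (suc (suc (suc p))) ≤ 3 ✖ suc m
      step m h = ℕ.≤-trans (s≤s (s≤s h)) (ℕ.≤-trans (ℕ.n≤1+n _) (ℕ.≤-reflexive (sym (ℕ.*-suc 3 m))))

    -- Three inequalities are combined: P ≤ 9 n² T, since a share 1/(9 n²) of the pairs is
    -- exchangeable; Q ≤ 2 G, since half of the lower rows are regular; and the sum over all R of
    -- the bound for its first rows, where the saving T occurs only for regular R.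
    badCount-bound : ∀ {p n k l} → Prime p → suc n ≤ p → lineDegree n ✚ lineDegree n ℕ.< p →
      suc k ✚ suc l ≡ suc n →
      36 ✖ (suc n ✖ suc n) ✖ badCount p (suc n) (suc k) (suc l) ✚ length (residueMatrices p (suc n) (suc n))
        ≤ 36 ✖ (suc n ✖ suc n) ✖ length (residueMatrices p (suc n) (suc n))
    badCount-bound {p} {n} {k} {l} pr n<p 2d<p k+l with third p (ℕ.nonTrivial⇒n>1 p {{prime⇒nonTrivial pr}})
    ... | m , m′ , m+m′≡p , p≤3m , p≤3m′ = begin
      36 ✖ NN ✖ bad ✚ length (residueMatrices p (suc n) (suc n))
        ≡⟨ cong (36 ✖ NN ✖ bad ✚_) total ⟩
      36 ✖ NN ✖ bad ✚ P ✖ Q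
        ≤⟨ ℕ.+-monoʳ-≤ (36 ✖ NN ✖ bad) (ℕ.*-monoˡ-≤ Q many) ⟩
      36 ✖ NN ✖ bad ✚ 9 ✖ NN ✖ T ✖ Q
        ≤⟨ ℕ.+-monoʳ-≤ (36 ✖ NN ✖ bad) (ℕ.*-monoʳ-≤ (9 ✖ NN ✖ T) (regular-half pr n<p 2d<p)) ⟩
      36 ✖ NN ✖ bad ✚ 9 ✖ NN ✖ T ✖ (G ✚ G)
        ≡⟨ factor NN bad T G ⟩
      18 ✖ NN ✖ (2 ✖ bad ✚ T ✖ G)
        ≤⟨ ℕ.*-monoʳ-≤ (18 ✖ NN) summed ⟩
      18 ✖ NN ✖ (2 ✖ P ✖ Q)
        ≡⟨ collect NN P Q ⟩
      36 ✖ NN ✖ (P ✖ Q)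
        ≡⟨ cong (36 ✖ NN ✖_) total ⟨
      36 ✖ NN ✖ length (residueMatrices p (suc n) (suc n)) ∎
      where
      open ℕ.≤-Reasoning
      NN = suc n ✖ suc n
      bad = badCount p (suc n) (suc k) (suc l)
      P = p ℕ.^ suc n
      Rs = residueMatrices p (suc n) n
      rows = vectors (res p) (suc n)
      Q = length Rs
      G = regularCount p n
      r₁ = rooted p (res m) (suc k)
      r₂ = rooted p (high m m′) (suc l)
      T = r₁ ✖ r₂
      factor : ∀ N b T G → 36 ✖ N ✖ b ✚ 9 ✖ N ✖ T ✖ (G ✚ G) ≡ 18 ✖ N ✖ (2 ✖ b ✚ T ✖ G)
      factor = ℕ-solve-∀
      collect : ∀ N P Q → 18 ✖ N ✖ (2 ✖ P ✖ Q) ≡ 36 ✖ N ✖ (P ✖ Q)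
      collect = ℕ-solve-∀
      length-rows : length rows ≡ P
      length-rows = trans (length-vectors (res p) (suc n)) (cong (ℕ._^ suc n) (length-res p))
      total : length (residueMatrices p (suc n) (suc n)) ≡ P ✖ Q
      total = trans (length-cartesianProductWith _∷_ rows Rs) (cong (_✖ Q) length-rows)
      length-high : length (high m m′) ≡ m′
      length-high = trans (List.length-map _ (upTo m′)) (List.length-upTo m′)
      m≤p : m ≤ p
      m≤p = ℕ.≤-trans (ℕ.m≤m+n m m′) (ℕ.≤-reflexive m+m′≡p)
      low-bound : m ✖ p ℕ.^ k ≤ suc k ✖ r₁
      low-bound = subst (λ u → u ✖ p ℕ.^ k ≤ suc k ✖ r₁) (length-res m)
        (rooted-bound pr (res m) (res-distinct (res-unique m) (res⊆res m≤p)) k)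
      high-bound : m′ ✖ p ℕ.^ l ≤ suc l ✖ r₂
      high-bound = subst (λ u → u ✖ p ℕ.^ l ≤ suc l ✖ r₂) length-high
        (rooted-bound pr (high m m′) (res-distinct (high-unique m m′)
          (subst (λ q → _ ∈ res q) m+m′≡p ∘ high⊆res {m})) l)
      many : P ≤ 9 ✖ NN ✖ T
      many = begin
        p ℕ.^ suc n
          ≡⟨ trans (cong (p ℕ.^_) (sym k+l)) (ℕ.^-distribˡ-+-* p (suc k) (suc l)) ⟩
        (p ✖ p ℕ.^ k) ✖ (p ✖ p ℕ.^ l)
          ≤⟨ ℕ.*-mono-≤ (ℕ.*-monoˡ-≤ (p ℕ.^ k) p≤3m) (ℕ.*-monoˡ-≤ (p ℕ.^ l) p≤3m′) ⟩
        (3 ✖ m ✖ p ℕ.^ k) ✖ (3 ✖ m′ ✖ p ℕ.^ l)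
          ≡⟨ regroup m (p ℕ.^ k) m′ (p ℕ.^ l) ⟩
        9 ✖ ((m ✖ p ℕ.^ k) ✖ (m′ ✖ p ℕ.^ l))
          ≤⟨ ℕ.*-monoʳ-≤ 9 (ℕ.*-mono-≤ low-bound high-bound) ⟩
        9 ✖ ((suc k ✖ r₁) ✖ (suc l ✖ r₂))
          ≡⟨ regroup′ (suc k) r₁ (suc l) r₂ ⟩
        9 ✖ (suc k ✖ suc l) ✖ T
          ≤⟨ ℕ.*-monoˡ-≤ T (ℕ.*-monoʳ-≤ 9 (ℕ.*-mono-≤
               (ℕ.≤-trans (ℕ.m≤m+n (suc k) (suc l)) (ℕ.≤-reflexive k+l))
               (ℕ.≤-trans (ℕ.m≤n+m (suc l) (suc k)) (ℕ.≤-reflexive k+l)))) ⟩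
        9 ✖ NN ✖ T ∎
        where
        regroup : ∀ a b c d → (3 ✖ a ✖ b) ✖ (3 ✖ c ✖ d) ≡ 9 ✖ ((a ✖ b) ✖ (c ✖ d))
        regroup = ℕ-solve-∀
        regroup′ : ∀ a b c d → 9 ✖ ((a ✖ b) ✖ (c ✖ d)) ≡ 9 ✖ (a ✖ c) ✖ (b ✖ d)
        regroup′ = ℕ-solve-∀
      row-bound : ∀ R (D? : Dec (Degenerate p R)) →
        2 ✖ badRows p (suc k) (suc l) R ✚ T ✖ 𝟙 (¬? D?) ≤ 2 ✖ P
      row-bound R (no ¬D) = ℕ.≤-trans
        (ℕ.≤-reflexive (cong (2 ✖ badRows p (suc k) (suc l) R ✚_) (ℕ.*-identityʳ T)))
        (badRows-bound {m = m} pr n<p k+l m+m′≡p R ¬D)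
      -- For degenerate rows nothing is saved: every first row may be bad.
      row-bound R (yes D) = ℕ.≤-trans
        (ℕ.≤-reflexive (trans (cong (2 ✖ badRows p (suc k) (suc l) R ✚_) (ℕ.*-zeroʳ T)) (ℕ.+-identityʳ _)))
        (ℕ.*-monoʳ-≤ 2 (ℕ.≤-trans
          (∑-bound rows 1 λ a _ → 𝟙≤1 (bad? p (suc k) (suc l) (a ∷ R)))
          (ℕ.≤-reflexive (trans (ℕ.*-identityʳ _) length-rows))))
      by-rows : bad ≡ ∑ Rs (badRows p (suc k) (suc l))
      by-rows = trans (∑-product _∷_ rows Rs _) (∑-swap rows Rs _)
      summed : 2 ✖ bad ✚ T ✖ G ≤ 2 ✖ P ✖ Q
      summed = begin
        2 ✖ bad ✚ T ✖ G
          ≡⟨ cong₂ _✚_ (trans (cong (2 ✖_) by-rows) (sym (∑-*ˡ 2 Rs _))) (sym (∑-*ˡ T Rs _)) ⟩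
        ∑ Rs (λ R → 2 ✖ badRows p (suc k) (suc l) R) ✚ ∑ Rs (λ R → T ✖ 𝟙 (¬? (degenerate? p R)))
          ≡⟨ ∑-+ Rs _ _ ⟨
        (∑ Rs λ R → 2 ✖ badRows p (suc k) (suc l) R ✚ T ✖ 𝟙 (¬? (degenerate? p R)))
          ≤⟨ ∑-bound Rs (2 ✖ P) (λ R _ → row-bound R (degenerate? p R)) ⟩
        Q ✖ (2 ✖ P)
          ≡⟨ ℕ.*-comm Q (2 ✖ P) ⟩
        2 ✖ P ✖ Q ∎

-- The sieve over several primes

module _ where
  open import Data.Nat.Base using (_+_; _*_; _∸_; _<_; _!)
  open import Data.Nat.Tactic.RingSolver using (solve-∀)
  open import Data.Nat.ListAction using (product)
  open import Data.Nat.Primality.Factorisation using (factorise; PrimeFactorisation)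

  -- Euclid's argument: a prime factor of N ! + 1 cannot divide N !.
  prime-above : ∀ N → ∃ λ p → Prime p × N < p
  prime-above N with factorise (suc (N !))
  ... | record { factors = []    ; isFactorisation = eq } =
    ⊥-elim (ℕ.<⇒≢ (ℕ.1≤n! N) (sym (ℕ.suc-injective eq)))
  ... | record { factors = p ∷ ps ; isFactorisation = eq ; factorsPrime = pr ∷ _ } = p , pr , ℕ.≰⇒> p≰N
    where
    instance
      p-nonTrivial = prime⇒nonTrivial pr
    p∣! : ∀ {n} → p ≤ n → p ℕ.∣ n !
    p∣! {n} p≤n = ℕ.∣-trans (ℕ.m∣m*n (ℕ.pred p !))
      (subst (λ q → q * ℕ.pred p ! ℕ.∣ n !) (ℕ.suc-pred p {{prime⇒nonZero pr}})
        (ℕ.m≤n⇒m!∣n! (subst (_≤ n) (sym (ℕ.suc-pred p {{prime⇒nonZero pr}})) p≤n)))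
    p≰N : ¬ (p ≤ N)
    p≰N p≤N = ℕ.nonTrivial⇒≢1 (ℕ.∣1⇒≡1 (ℕ.∣m+n∣m⇒∣n
      (subst (p ℕ.∣_) (trans (sym eq) (ℕ.+-comm 1 (N !))) (ℕ.m∣m*n (product ps))) (p∣! p≤N)))

  -- Periodicity of badness and the Chinese remainder theorem for matrices.

  charValue-cong : ∀ {m n} {A B : Matrix n} → A ≅ᴹ B ⟨ m ⟩ → ∀ x → charValue A x ≅ charValue B x ⟨ m ⟩
  charValue-cong {m} {n} {A} {B} A≅B x = RingRelation.det-~ (modular m)
    {A = charEntry x (entry A) id} {charEntry x (entry B) id} λ i j →
    charEntry-~ (modular m) {x = x} {x} {entry A} {entry B} id i j ≅-refl
      (Pointwise.lookup (Pointwise.lookup A≅B i) j)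

  ≅ᴹ-sym : ∀ {m r n} {A B : Vec (Vec ℤ n) r} → A ≅ᴹ B ⟨ m ⟩ → B ≅ᴹ A ⟨ m ⟩
  ≅ᴹ-sym = Pointwise.sym (Pointwise.sym ≅-sym)

  bad-cong : ∀ {p n k l} {A B : Matrix n} → A ≅ᴹ B ⟨ p ⟩ → Bad p k l A → Bad p k l B
  bad-cong A≅B = Any.map λ {gh} → All.map λ {x} → ≅-trans (≅-sym (charValue-cong A≅B x))

  bad-periodic : ∀ p {n} k l → Periodic p (λ (A : Matrix n) → 𝟙 (bad? p k l A))
  bad-periodic p k l {A} {B} A≅B = 𝟙-cong (bad? p k l A) (bad? p k l B)
    (bad-cong A≅B) (bad-cong (≅ᴹ-sym A≅B))

  ≅-weaken : ∀ {m q a b} → a ≅ b ⟨ m * q ⟩ → a ≅ b ⟨ m ⟩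
  ≅-weaken {m} {q} (congruent d) = congruent (ℤ.∣-trans (ℤ.∣ᵤ⇒∣ (ℕ.m∣m*n q)) d)

  ≅-weakenʳ : ∀ {m q a b} → a ≅ b ⟨ m * q ⟩ → a ≅ b ⟨ q ⟩
  ≅-weakenʳ {m} {q} (congruent d) = congruent (ℤ.∣-trans (ℤ.∣ᵤ⇒∣ (ℕ.n∣m*n m)) d)

  Pointwise-map : ∀ {A : Set} {R S : A → A → Set} → (∀ {x y} → R x y → S x y) →
    ∀ {n} {u v : Vec A n} → Pointwise R u v → Pointwise S u v
  Pointwise-map f []      = []
  Pointwise-map f (r ∷ rs) = f r ∷ Pointwise-map f rs

  ≅ᴹ-map : ∀ {m q r n} → (∀ {a b} → a ≅ b ⟨ m ⟩ → a ≅ b ⟨ q ⟩) →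
    {A B : Vec (Vec ℤ n) r} → A ≅ᴹ B ⟨ m ⟩ → A ≅ᴹ B ⟨ q ⟩
  ≅ᴹ-map f = Pointwise-map (Pointwise-map f)

  box : ∀ n → ℕ → List (Matrix n)
  box n m = residueMatrices m n n

  ∑-box-* : ∀ n m q f →
    ∑ (box n (m * q)) f ≡ ∑ (box n m) λ Y → ∑ (box n q) λ Z → f (affineᴹ (+ m) Y Z)
  ∑-box-* n m q = ∑-vectors-zipWith (Vec.zipWith (affine (+ m)))
    (∑-vectors-zipWith (affine (+ m)) (∑-res-* m q) n) n

  length-box-* : ∀ n m q → length (box n (m * q)) ≡ length (box n m) * length (box n q)
  length-box-* n m q = begin
    length (box n (m * q))                            ≡⟨ count (box n (m * q)) ⟨
    ∑ (box n (m * q)) (λ _ → 1)                       ≡⟨ ∑-box-* n m q (λ _ → 1) ⟩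
    ∑ (box n m) (λ _ → ∑ (box n q) λ _ → 1)           ≡⟨ ∑-cong (box n m) (λ _ → count (box n q)) ⟩
    ∑ (box n m) (λ _ → length (box n q))              ≡⟨ ∑-const (box n m) _ ⟩
    length (box n m) * length (box n q)               ∎
    where
    open ≡-Reasoning
    count : ∀ {A : Set} (xs : List A) → ∑ xs (λ _ → 1) ≡ length xs
    count xs = trans (∑-const xs 1) (ℕ.*-identityʳ (length xs))

  affine-≅ : ∀ {m r n} (Y Z : Vec (Vec ℤ n) r) → affineᴹ (+ m) Y Z ≅ᴹ Y ⟨ m ⟩
  affine-≅ {m} []      []      = []
  affine-≅ {m} (u ∷ Y) (v ∷ Z) = rows u v ∷ affine-≅ Y Z
    where
    lemma : ∀ y m z → (y ℤ.+ m ℤ.* z) ℤ.- y ≡ z ℤ.* m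
    lemma = ℤ-solve-∀
      where open import Data.Integer.Tactic.RingSolver using () renaming (solve-∀ to ℤ-solve-∀)
    rows : ∀ {n} (u v : Vec ℤ n) → Vec.zipWith (affine (+ m)) u v ≅ⱽ u ⟨ m ⟩
    rows []      []      = []
    rows (y ∷ u) (z ∷ v) = congruent (ℤ.divides z (lemma y (+ m) z)) ∷ rows u v

  -- Here s is the number of primes and c / (1 + c) the factor that each contributes. `weight k l`
  -- majorises the indicator of a splitting into degrees k + 1 and l + 1. One modulus serves all
  -- shapes.
  record Sieve (n c s : ℕ) : Set where
    field
      modulus   : ℕ
      {{modulus≢0}} : NonZero modulus
      weight    : ℕ → ℕ → Matrix n → ℕ
      periodic  : ∀ k l → Periodic modulus (weight k l)
      detects   : ∀ k l A → Split (suc k) (suc l) A → 1 ≤ weight k l A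
      bound     : ∀ k l → suc k + suc l ≡ n →
        suc c ℕ.^ s * ∑ (box n modulus) (weight k l) ≤ c ℕ.^ s * length (box n modulus)

  sieve : ∀ n c → suc c ≡ 36 * (suc n * suc n) → ∀ s → Sieve (suc n) c s
  sieve n c 1+c≡C zero = record
    { modulus  = 1
    ; weight   = λ _ _ _ → 1
    ; periodic = λ _ _ _ → refl
    ; detects  = λ _ _ _ _ → ℕ.≤-refl
    ; bound    = λ _ _ _ → ℕ.*-monoʳ-≤ 1 (ℕ.≤-reflexive
        (trans (∑-const (box (suc n) 1) 1) (ℕ.*-identityʳ _)))
    }
  sieve n c 1+c≡C (suc s) = record
    { modulus  = m * p
    ; modulus≢0 = ℕ.m*n≢0 m p {{modulus≢0}} {{prime⇒nonZero pr}}
    ; weight   = λ k l A → weight k l A * 𝟙 (bad? p (suc k) (suc l) A)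
    ; periodic = λ k l {A} {B} A≅B → cong₂ _*_
        (periodic k l (≅ᴹ-map ≅-weaken A≅B))
        (bad-periodic p (suc k) (suc l) (≅ᴹ-map (≅-weakenʳ {m}) A≅B))
    ; detects  = λ k l A split → ℕ.*-mono-≤ (detects k l A split)
        (ℕ.≤-reflexive (sym (𝟙-yes (bad? p (suc k) (suc l) A)
          (split⇒bad p {{prime⇒nonZero pr}} A split))))
    ; bound    = step
    }
    where
    open Sieve (sieve n c 1+c≡C s) renaming (modulus to m)
    C = 36 * (suc n * suc n)
    d = lineDegree n
    -- The new prime exceeds m, hence does not divide it; it exceeds n for the arrow matrix and 2 d
    -- for the averaging over lines.
    big = prime-above (m + suc n + (d + d))
    p = proj₁ big
    pr = proj₁ (proj₂ big)
    big<p = proj₂ (proj₂ big)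
    m<p : m < p
    m<p = ℕ.≤-<-trans (ℕ.≤-trans (ℕ.m≤m+n m (suc n)) (ℕ.m≤m+n _ (d + d))) big<p
    n<p : suc n ≤ p
    n<p = ℕ.<⇒≤ (ℕ.≤-<-trans (ℕ.≤-trans (ℕ.m≤n+m (suc n) m) (ℕ.m≤m+n _ (d + d))) big<p)
    2d<p : d + d < p
    2d<p = ℕ.≤-<-trans (ℕ.m≤n+m (d + d) (m + suc n)) big<p
    cancel : ∀ a → + p ℤ.∣ + m ℤ.* a → + p ℤ.∣ a
    cancel a p∣ma = [ ⊥-elim ∘ small⇒∤ m<p (ℕ.≢-nonZero⁻¹ m {{modulus≢0}} ∘ ℤ.+-injective) , id ]′
      (euclid pr (+ m) a p∣ma)
    n⁺ = suc n
    module _ (k l : ℕ) (k+l : suc k + suc l ≡ n⁺) where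
      open ℕ.≤-Reasoning
      w : Matrix n⁺ → ℕ
      w = weight k l
      bad : Matrix n⁺ → ℕ
      bad A = 𝟙 (bad? p (suc k) (suc l) A)
      -- As `C` is 1 + c, one copy of the box can be cancelled on both sides of `badCount-bound`.
      prime-bound : suc c * badCount p n⁺ (suc k) (suc l) ≤ c * length (box n⁺ p)
      prime-bound = ℕ.+-cancelˡ-≤ (length (box n⁺ p)) _ _ (begin
        length (box n⁺ p) + suc c * badCount p n⁺ (suc k) (suc l)
          ≡⟨ trans (ℕ.+-comm (length (box n⁺ p)) _)
               (cong (λ u → u * badCount p n⁺ (suc k) (suc l) + length (box n⁺ p)) 1+c≡C) ⟩
        C * badCount p n⁺ (suc k) (suc l) + length (box n⁺ p)
          ≤⟨ badCount-bound {k = k} pr n<p 2d<p k+l ⟩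
        C * length (box n⁺ p)
          ≡⟨ cong (_* length (box n⁺ p)) 1+c≡C ⟨
        length (box n⁺ p) + c * length (box n⁺ p) ∎)
      -- The Chinese remainder theorem as an inequality. Writing A = Y + m Z, the old weight depends
      -- on Y alone, and for fixed Y the map Z ↦ Y + m Z is injective modulo p.
      independent : ∑ (box n⁺ (m * p)) (λ A → w A * bad A) ≤ ∑ (box n⁺ m) w * badCount p n⁺ (suc k) (suc l)
      independent = begin
        ∑ (box n⁺ (m * p)) (λ A → w A * bad A)
          ≡⟨ ∑-box-* n⁺ m p _ ⟩
        (∑ (box n⁺ m) λ Y → ∑ (box n⁺ p) λ Z → w (affineᴹ (+ m) Y Z) * bad (affineᴹ (+ m) Y Z))
          ≡⟨ ∑-cong (box n⁺ m) (λ Y → trans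
               (∑-cong (box n⁺ p) λ Z → cong (_* bad (affineᴹ (+ m) Y Z)) (periodic k l (affine-≅ Y Z)))
               (∑-*ˡ (w Y) (box n⁺ p) _)) ⟩
        (∑ (box n⁺ m) λ Y → w Y * ∑ (box n⁺ p) λ Z → bad (affineᴹ (+ m) Y Z))
          ≤⟨ ∑-mono (box n⁺ m) (λ Y _ → ℕ.*-monoʳ-≤ (w Y)
               (∑-affineᴹ p {{prime⇒nonZero pr}} (+ m) cancel Y bad (bad-periodic p (suc k) (suc l)))) ⟩
        (∑ (box n⁺ m) λ Y → w Y * badCount p n⁺ (suc k) (suc l))
          ≡⟨ ∑-*ʳ _ (box n⁺ m) w ⟩
        ∑ (box n⁺ m) w * badCount p n⁺ (suc k) (suc l) ∎
      step : suc c ℕ.^ suc s * ∑ (box n⁺ (m * p)) (λ A → w A * bad A) ≤ c ℕ.^ suc s * length (box n⁺ (m * p))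
      step = begin
        suc c * suc c ℕ.^ s * ∑ (box n⁺ (m * p)) (λ A → w A * bad A)
          ≤⟨ ℕ.*-monoʳ-≤ (suc c * suc c ℕ.^ s) independent ⟩
        suc c * suc c ℕ.^ s * (∑ (box n⁺ m) w * badCount p n⁺ (suc k) (suc l))
          ≡⟨ regroup (suc c) (suc c ℕ.^ s) (∑ (box n⁺ m) w) _ ⟩
        (suc c ℕ.^ s * ∑ (box n⁺ m) w) * (suc c * badCount p n⁺ (suc k) (suc l))
          ≤⟨ ℕ.*-mono-≤ (bound k l k+l) prime-bound ⟩
        (c ℕ.^ s * length (box n⁺ m)) * (c * length (box n⁺ p))
          ≡⟨ regroup c (c ℕ.^ s) (length (box n⁺ m)) (length (box n⁺ p)) ⟨
        c * c ℕ.^ s * (length (box n⁺ m) * length (box n⁺ p))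
          ≡⟨ cong (c * c ℕ.^ s *_) (length-box-* n⁺ m p) ⟨
        c ℕ.^ suc s * length (box n⁺ (m * p)) ∎
        where
        regroup : ∀ a b x y → a * b * (x * y) ≡ (b * x) * (a * y)
        regroup = solve-∀

  -- Covering the matrices of M n B by translates of a box

  ∑-shift : ∀ B b → B < b → ∀ f → ∑ (interval B) (f ∘ affine 1ℤ (+ b)) ≤ ∑ (res (b + b)) f
  ∑-shift B b B<b f = ∑-injection (affine 1ℤ (+ b)) f (interval-unique B) into
    λ {x} {y} _ _ eq → trans (sym (untranslate (+ b) x)) (trans (cong (ℤ._- + b) eq) (untranslate (+ b) y))
    where
    open import Data.Integer.Tactic.RingSolver using () renaming (solve-∀ to ℤ-solve-∀)
    untranslate : ∀ b x → b ℤ.+ 1ℤ ℤ.* x ℤ.- b ≡ x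
    untranslate = ℤ-solve-∀
    ℤ-lemma : ∀ b k B → b ℤ.+ 1ℤ ℤ.* (k ℤ.- B) ≡ k ℤ.+ (b ℤ.- B)
    ℤ-lemma = ℤ-solve-∀
    into : ∀ {x} → x ∈ interval B → affine 1ℤ (+ b) x ∈ res (b + b)
    into x∈ with ∈-map⁻ (λ k → + k ℤ.- + B) x∈
    ... | k , k∈ , refl = subst (_∈ res (b + b)) eq (∈-res small)
      where
      eq : + (k + (b ∸ B)) ≡ affine 1ℤ (+ b) (+ k ℤ.- + B)
      eq = sym (trans (ℤ-lemma (+ b) (+ k) (+ B))
        (trans (cong (λ u → + k ℤ.+ u) (trans (ℤ.m-n≡m⊖n b B) (ℤ.⊖-≥ (ℕ.<⇒≤ B<b))))
               (sym (ℤ.pos-+ k (b ∸ B)))))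
      small : k + (b ∸ B) < b + b
      small = begin-strict
        k + (b ∸ B)          ≤⟨ ℕ.+-monoˡ-≤ (b ∸ B) (s≤s⁻¹ (∈-upTo⁻ k∈)) ⟩
        B + B + (b ∸ B)      ≡⟨ trans (ℕ.+-assoc B B (b ∸ B)) (cong (λ u → B + u) (ℕ.m+[n∸m]≡n (ℕ.<⇒≤ B<b))) ⟩
        B + b                <⟨ ℕ.+-monoˡ-< b B<b ⟩
        b + b                ∎
        where open ℕ.≤-Reasoning

  -- Adding b m to every entry does not change a weight of period m, and it moves the matrices into
  -- the nonnegative box of side 2 b m. That box consists of whole periods, 2 b in each entry.
  ∑-M-periodic : ∀ n m (w : Matrix n → ℕ) → Periodic m w → ∀ B b → B < b * m →
    ∑ (M n B) w ≤ ∑ (box n m) w * length (box n (b + b))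
  ∑-M-periodic n m w w-periodic B b B<bm = begin
    ∑ (M n B) w
      ≡⟨ ∑-cong (M n B) (λ A → w-periodic (translate-≅ᴹ units A)) ⟨
    ∑ (M n B) (w ∘ Vec.zipWith (Vec.zipWith translate) units)
      ≤⟨ ∑-vectors-transport _≡_ refl (Vec.zipWith translate) rows units w
           (cong w ∘ Pointwise.Pointwise-≡⇒≡) ⟩
    ∑ (box n (b * m + b * m)) w
      ≡⟨ cong (λ k → ∑ (box n k) w) (trans (sym (ℕ.*-distribʳ-+ m b b)) (ℕ.*-comm (b + b) m)) ⟩
    ∑ (box n (m * (b + b))) w
      ≡⟨ ∑-box-* n m (b + b) w ⟩
    (∑ (box n m) λ Y → ∑ (box n (b + b)) λ Z → w (affineᴹ (+ m) Y Z))
      ≡⟨ ∑-cong (box n m) (λ Y → trans (∑-cong (box n (b + b)) λ Z → w-periodic (affine-≅ Y Z))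
           (trans (∑-const (box n (b + b)) (w Y)) (ℕ.*-comm _ (w Y)))) ⟩
    (∑ (box n m) λ Y → w Y * length (box n (b + b)))
      ≡⟨ ∑-*ʳ _ (box n m) w ⟩
    ∑ (box n m) w * length (box n (b + b)) ∎
    where
    open ℕ.≤-Reasoning
    translate : ⊤ → ℤ → ℤ
    translate _ = affine 1ℤ (+ (b * m))
    units : Vec (Vec ⊤ n) n
    units = Vec.replicate n (Vec.replicate n tt)
    rows : ∀ u f → Respects _≡_ f →
      ∑ (vectors (interval B) n) (f ∘ Vec.zipWith translate u) ≤ ∑ (vectors (res (b * m + b * m)) n) f
    rows u f _ = ∑-vectors-transport _≡_ refl translate (λ _ g _ → ∑-shift B (b * m) B<bm g) u f
      (cong f ∘ Pointwise.Pointwise-≡⇒≡)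
    translate-≅ : ∀ x → affine 1ℤ (+ (b * m)) x ≅ x ⟨ m ⟩
    translate-≅ x = congruent (ℤ.divides (+ b) (trans (lemma (+ (b * m)) x) (ℤ.pos-* b m)))
      where
      lemma : ∀ y x → y ℤ.+ 1ℤ ℤ.* x ℤ.- x ≡ y
      lemma = ℤ-solve-∀
        where open import Data.Integer.Tactic.RingSolver using () renaming (solve-∀ to ℤ-solve-∀)
    translate-≅ⱽ : ∀ {k} u (v : Vec ℤ k) → Vec.zipWith translate u v ≅ⱽ v ⟨ m ⟩
    translate-≅ⱽ []      []      = []
    translate-≅ⱽ (_ ∷ u) (x ∷ v) = translate-≅ x ∷ translate-≅ⱽ u v
    translate-≅ᴹ : ∀ {r} U (A : Vec (Vec ℤ n) r) → Vec.zipWith (Vec.zipWith translate) U A ≅ᴹ A ⟨ m ⟩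
    translate-≅ᴹ []      []      = []
    translate-≅ᴹ (u ∷ U) (v ∷ A) = translate-≅ⱽ u v ∷ translate-≅ᴹ U A

  ^-distribʳ-* : ∀ a b n → (a * b) ℕ.^ n ≡ a ℕ.^ n * b ℕ.^ n
  ^-distribʳ-* a b zero    = refl
  ^-distribʳ-* a b (suc n) = trans (cong (a * b *_) (^-distribʳ-* a b n)) (lemma a b _ _)
    where
    lemma : ∀ a b c d → a * b * (c * d) ≡ a * c * (b * d)
    lemma = solve-∀

  length-matrices : ∀ (xs : List ℤ) n → length (vectors (vectors xs n) n) ≡ (length xs ℕ.^ n) ℕ.^ n
  length-matrices xs n = trans (length-vectors (vectors xs n) n) (cong (ℕ._^ n) (length-vectors xs n))

  -- A factor 2 for each of the n² entries, the loss from covering 2 B + 1 integers by at most 2 (2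
  -- B + 1) residues.
  dilation : ℕ → ℕ
  dilation n = (2 ℕ.^ n) ℕ.^ n

  box-vs-M : ∀ n m b B → (b + b) * m ≤ 2 * suc (B + B) →
    length (box n m) * length (box n (b + b)) ≤ dilation n * length (M n B)
  box-vs-M n m b B le = begin
    length (box n m) * length (box n (b + b))
      ≡⟨ length-box-* n m (b + b) ⟨
    length (box n (m * (b + b)))
      ≡⟨ trans (length-matrices (res (m * (b + b))) n) (cong (λ k → (k ℕ.^ n) ℕ.^ n)
           (trans (length-res (m * (b + b))) (ℕ.*-comm m (b + b)))) ⟩
    ((((b + b) * m) ℕ.^ n) ℕ.^ n)
      ≤⟨ ℕ.^-monoˡ-≤ n (ℕ.^-monoˡ-≤ n le) ⟩
    ((2 * suc (B + B)) ℕ.^ n) ℕ.^ n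
      ≡⟨ trans (cong (ℕ._^ n) (^-distribʳ-* 2 (suc (B + B)) n)) (^-distribʳ-* (2 ℕ.^ n) _ n) ⟩
    dilation n * (suc (B + B) ℕ.^ n) ℕ.^ n
      ≡⟨ cong (dilation n *_) (trans (length-matrices (interval B) n) (cong (λ k → (k ℕ.^ n) ℕ.^ n)
           (trans (List.length-map _ (upTo (suc (B + B)))) (List.length-upTo _)))) ⟨
    dilation n * length (M n B) ∎
    where open ℕ.≤-Reasoning

  -- Rounding B up to a multiple b m beyond it adds at most m, which is at most B; this is why B
  -- must reach the modulus.
  multiplier : ∀ m → .{{_ : NonZero m}} → ∀ B → m ≤ B →
    ∃ λ b → B < b * m × (b + b) * m ≤ 2 * suc (B + B)
  multiplier m B m≤B = suc (B ℕ./ m) , (begin-strict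
      B                                  ≡⟨ ℕ.m≡m%n+[m/n]*n B m ⟩
      B ℕ.% m + (B ℕ./ m) * m            <⟨ ℕ.+-monoˡ-< _ (ℕ.m%n<n B m) ⟩
      suc (B ℕ./ m) * m                  ∎) , (begin
      (b + b) * m                        ≡⟨ double b m ⟩
      2 * (b * m)                        ≤⟨ ℕ.*-monoʳ-≤ 2 (ℕ.+-mono-≤ m≤B (ℕ.m/n*n≤m B m)) ⟩
      2 * (B + B)                        ≤⟨ ℕ.*-monoʳ-≤ 2 (ℕ.n≤1+n (B + B)) ⟩
      2 * suc (B + B)                    ∎)
    where
    open ℕ.≤-Reasoning
    b = suc (B ℕ./ m)
    double : ∀ b m → (b + b) * m ≡ 2 * (b * m)
    double = solve-∀

  -- That is, (1 + 1/c)^s ≥ s/c, a weak form of Bernoulli's inequality with denominators cleared. It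
  -- turns the geometric decay of the sieve into a bound of order 1/s.
  bernoulli : ∀ c s → s * c ℕ.^ s ≤ c * suc c ℕ.^ s
  bernoulli c zero    = z≤n
  bernoulli c (suc s) = begin
    suc s * (c * c ℕ.^ s)                         ≡⟨ expand s c (c ℕ.^ s) ⟩
    c * (s * c ℕ.^ s) + c * c ℕ.^ s               ≤⟨ ℕ.+-mono-≤ (ℕ.*-monoʳ-≤ c (bernoulli c s))
                                                       (ℕ.*-monoʳ-≤ c (ℕ.^-monoˡ-≤ s (ℕ.n≤1+n c))) ⟩
    c * (c * suc c ℕ.^ s) + c * suc c ℕ.^ s       ≡⟨ collect c (suc c ℕ.^ s) ⟩
    c * (suc c * suc c ℕ.^ s)                     ∎
    where
    open ℕ.≤-Reasoning
    expand : ∀ s c x → suc s * (c * x) ≡ c * (s * x) + c * x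
    expand = solve-∀
    collect : ∀ c y → c * (c * y) + c * y ≡ c * (suc c * y)
    collect = solve-∀

  -- Each degree of a factor contributes at most the proportion
  -- dilation n * (c / (1 + c)) ^ s ≤ dilation n * c / s.
  reducible-bound : ∀ n c → suc c ≡ 36 * (suc (suc n) * suc (suc n)) → ∀ s → ∃ λ B₀ → ∀ B → B₀ ≤ B →
    s * N (suc (suc n)) B ≤ suc n * dilation (suc (suc n)) * c * length (M (suc (suc n)) B)
  reducible-bound n′ c 1+c≡C s = m , bounded-by
    where
    open ℕ.≤-Reasoning
    n = suc (suc n′)
    open Sieve (sieve (suc n′) c 1+c≡C s) renaming (modulus to m)
    w : ℕ → Matrix n → ℕ
    -- The total degree fixes the second index once the first is given, so n - 1 shapes cover every
    -- splitting.
    w k = weight k (n′ ∸ k)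
    degrees : ∀ {k} → k ∈ upTo (suc n′) → suc k + suc (n′ ∸ k) ≡ n
    degrees {k} k∈ = cong suc (trans (ℕ.+-suc k (n′ ∸ k)) (cong suc (ℕ.m+[n∸m]≡n (s≤s⁻¹ (∈-upTo⁻ k∈)))))
    detected : ∀ A (R? : Dec (Reducible (charPoly A))) → 𝟙 R? ≤ ∑ (upTo (suc n′)) λ k → w k A
    detected A (no _)  = z≤n
    detected A (yes r) with reducible⇒split A r
    ... | k , l , k+l≡n , split = ℕ.≤-trans
      (subst (λ l → 1 ≤ weight k l A) l≡ (detects k l A split))
      (∑-≥₁ (λ k → w k A) (∈-upTo⁺ (s≤s (ℕ.≤-trans (ℕ.m≤m+n k l) (ℕ.≤-reflexive k+l)))))
      where
      k+l : k + l ≡ n′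
      k+l = ℕ.suc-injective (trans (sym (ℕ.+-suc k l)) (ℕ.suc-injective k+l≡n))
      l≡ : l ≡ n′ ∸ k
      l≡ = trans (sym (ℕ.m+n∸m≡n k l)) (cong (_∸ k) k+l)
    bounded-by : ∀ B → m ≤ B → s * N n B ≤ suc n′ * dilation n * c * length (M n B)
    bounded-by B m≤B with multiplier m {{modulus≢0}} B m≤B
    ... | b , B<bm , small = ℕ.*-cancelˡ-≤ (suc c ℕ.^ s) {{ℕ.m^n≢0 (suc c) s}} (begin
      suc c ℕ.^ s * (s * N n B)
        ≡⟨ swap-factors (suc c ℕ.^ s) s (N n B) ⟩
      s * (suc c ℕ.^ s * N n B)
        ≤⟨ ℕ.*-monoʳ-≤ s counted ⟩
      s * (suc n′ * (c ℕ.^ s * (D * L)))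
        ≡⟨ move s (suc n′) (c ℕ.^ s) (D * L) ⟩
      s * c ℕ.^ s * (suc n′ * (D * L))
        ≤⟨ ℕ.*-monoˡ-≤ (suc n′ * (D * L)) (bernoulli c s) ⟩
      c * suc c ℕ.^ s * (suc n′ * (D * L))
        ≡⟨ arrange c (suc c ℕ.^ s) (suc n′) D L ⟩
      suc c ℕ.^ s * (suc n′ * D * c * L) ∎)
      where
      L = length (M n B)
      D = dilation n
      swap-factors : ∀ a b c → a * (b * c) ≡ b * (a * c)
      swap-factors = solve-∀
      move : ∀ a b c d → a * (b * (c * d)) ≡ a * c * (b * d)
      move = solve-∀
      arrange : ∀ c x n D L → c * x * (n * (D * L)) ≡ x * (n * D * c * L)
      arrange = solve-∀
      per-degree : ∀ k → k ∈ upTo (suc n′) → suc c ℕ.^ s * ∑ (M n B) (w k) ≤ c ℕ.^ s * (D * L)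
      per-degree k k∈ = begin
        suc c ℕ.^ s * ∑ (M n B) (w k)
          ≤⟨ ℕ.*-monoʳ-≤ (suc c ℕ.^ s) (∑-M-periodic n m (w k) (periodic k (n′ ∸ k)) B b B<bm) ⟩
        suc c ℕ.^ s * (∑ (box n m) (w k) * length (box n (b + b)))
          ≡⟨ ℕ.*-assoc (suc c ℕ.^ s) _ _ ⟨
        suc c ℕ.^ s * ∑ (box n m) (w k) * length (box n (b + b))
          ≤⟨ ℕ.*-monoˡ-≤ (length (box n (b + b))) (bound k (n′ ∸ k) (degrees k∈)) ⟩
        c ℕ.^ s * length (box n m) * length (box n (b + b))
          ≡⟨ ℕ.*-assoc (c ℕ.^ s) _ _ ⟩
        c ℕ.^ s * (length (box n m) * length (box n (b + b)))
          ≤⟨ ℕ.*-monoʳ-≤ (c ℕ.^ s) (box-vs-M n m b B small) ⟩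
        c ℕ.^ s * (D * L) ∎
      counted : suc c ℕ.^ s * N n B ≤ suc n′ * (c ℕ.^ s * (D * L))
      counted = begin
        suc c ℕ.^ s * N n B
          ≡⟨ cong (suc c ℕ.^ s *_) (length-filter-∑ (reducible? ∘ charPoly) (M n B)) ⟩
        suc c ℕ.^ s * ∑ (M n B) (λ A → 𝟙 (reducible? (charPoly A)))
          ≤⟨ ℕ.*-monoʳ-≤ (suc c ℕ.^ s) (∑-mono (M n B) λ A _ → detected A (reducible? (charPoly A))) ⟩
        suc c ℕ.^ s * ∑ (M n B) (λ A → ∑ (upTo (suc n′)) λ k → w k A)
          ≡⟨ cong (suc c ℕ.^ s *_) (∑-swap (M n B) (upTo (suc n′)) (flip w)) ⟩
        suc c ℕ.^ s * ∑ (upTo (suc n′)) (λ k → ∑ (M n B) (w k))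
          ≡⟨ ∑-*ˡ (suc c ℕ.^ s) (upTo (suc n′)) _ ⟨
        ∑ (upTo (suc n′)) (λ k → suc c ℕ.^ s * ∑ (M n B) (w k))
          ≤⟨ ∑-bound (upTo (suc n′)) (c ℕ.^ s * (D * L)) per-degree ⟩
        length (upTo (suc n′)) * (c ℕ.^ s * (D * L))
          ≡⟨ cong (_* (c ℕ.^ s * (D * L))) (List.length-upTo (suc n′)) ⟩
        suc n′ * (c ℕ.^ s * (D * L)) ∎

  nonZero⇒suc : ∀ m → .{{NonZero m}} → ∃ λ c → suc c ≡ m
  nonZero⇒suc (suc c) = c , refl

  -- The limit in terms of natural numbers: K is chosen before s, so the density is eventually at
  -- most K / s for every s.
  reducible-density : ∀ n → ∃ λ K → ∀ s → ∃ λ B₀ → ∀ B → B₀ ≤ B →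
    s * N (suc (suc n)) B ≤ K * length (M (suc (suc n)) B)
  reducible-density n with nonZero⇒suc (36 * (suc (suc n) * suc (suc n)))
      {{ℕ.m*n≢0 36 (suc (suc n) * suc (suc n))}}
  ... | c , 1+c≡C = suc n * dilation (suc (suc n)) * c , reducible-bound n c 1+c≡C

  -- From natural-number bounds to the limit of rationals.

  ratio<ε : ∀ a L → .{{_ : NonZero L}} → ∀ ε → 0ℚ ℚ.< ε → a * ℚ.↧ₙ ε < L → ℚ.∣ + a / L ℚ.- 0ℚ ∣ ℚ.< ε
  ratio<ε a (suc L) ε@(ℚ.mkℚ (+ zero) d _)  0<ε small with ℚ.positive 0<ε
  ... | ()
  ratio<ε a (suc L) ε@(ℚ.mkℚ -[1+ _ ] d _)  0<ε small with ℚ.positive 0<ε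
  ... | ()
  -- The numerator of a positive ε is at least 1, so being below the reciprocal of its denominator
  -- suffices.
  ratio<ε a (suc L) ε@(ℚ.mkℚ (+ suc e) d _) 0<ε small = subst (ℚ._< ε) (sym ∣q-0∣≡q)
    (ℚ.toℚᵘ-cancel-< (ℚᵘ.<-respˡ-≃ (ℚᵘ.≃-sym (ℚ.toℚᵘ-fromℚᵘ (ℚᵘ.mkℚᵘ (+ a) L))) (ℚᵘ.*<* cross)))
    where
    q = + a / suc L
    ∣q-0∣≡q : ℚ.∣ q ℚ.- 0ℚ ∣ ≡ q
    ∣q-0∣≡q = trans (cong ℚ.∣_∣ (ℚ.+-identityʳ q))
      (ℚ.0≤p⇒∣p∣≡p (ℚ.nonNegative⁻¹ q {{ℚ.normalize-nonNeg a (suc L)}}))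
    cross : + a ℤ.* + suc d ℤ.< + suc e ℤ.* + suc L
    cross = subst₂ ℤ._<_ (ℤ.pos-* a (suc d)) (ℤ.pos-* (suc e) (suc L))
      (ℤ.+<+ (ℕ.≤-trans small (ℕ.m≤m+n (suc L) (e * suc L))))

  -- If L ≤ x d, the hypothesis gives (1 + K d) x ≤ K d x, hence x = 0 and then L = 0. The extra 1
  -- in the multiplier also covers K = 0.
  ratio-bound : ∀ K d x L → .{{NonZero L}} → suc (K * d) * x ≤ K * L → x * d < L
  ratio-bound K d x L le = ℕ.≰⇒> λ L≤xd → ℕ.<⇒≱ (ℕ.>-nonZero⁻¹ L) (subst (λ y → L ≤ y * d) (x≡0 L≤xd) L≤xd)
    where
    open ℕ.≤-Reasoning
    lemma : ∀ K d x → K * (x * d) ≡ K * d * x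
    lemma = solve-∀
    x≡0 : L ≤ x * d → x ≡ 0
    x≡0 L≤xd = ℕ.n≤0⇒n≡0 (ℕ.+-cancelʳ-≤ (K * d * x) x 0 (begin
      x + K * d * x    ≤⟨ le ⟩
      K * L            ≤⟨ ℕ.*-monoʳ-≤ K L≤xd ⟩
      K * (x * d)      ≡⟨ lemma K d x ⟩
      K * d * x        ∎))

  ratio-tendsTo-0 : ∀ (a L : ℕ → ℕ) (L≢0 : ∀ B → NonZero (L B)) →
    (∃ λ K → ∀ s → ∃ λ B₀ → ∀ B → B₀ ≤ B → s * a B ≤ K * L B) →
    (λ B → _/_ (+ a B) (L B) {{L≢0 B}}) TendsTo 0ℚ
  ratio-tendsTo-0 a L L≢0 (K , density) ε 0<ε with density (suc (K * ℚ.↧ₙ ε))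
  ... | B₀ , bound = B₀ , λ B B₀≤B → ratio<ε (a B) (L B) {{L≢0 B}} ε 0<ε
    (ratio-bound K (ℚ.↧ₙ ε) (a B) (L B) {{L≢0 B}} (bound B B₀≤B))

theorem6p4 : (n : ℕ) → 2 ≤ n →
    (λ B → _/_ (+ N n B) (length (M n B)) {{M-nonEmpty n B}}) TendsTo 0ℚ
theorem6p4 (suc zero)    (s≤s ())
theorem6p4 (suc (suc n)) _ = ratio-tendsTo-0 (N (suc (suc n))) (λ B → length (M (suc (suc n)) B))
  (M-nonEmpty (suc (suc n))) (reducible-density n)
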